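{- For every $\varepsilon>0$ there exists a constant $c_{\varepsilon}>0$ such that $\vec\chi_{\ell}(KG(n,k))\geq c_{\varepsilon}\,n\ln n$ for all integers $n,k$ with $2\leq k\leq n^{\frac{1}{2}-\varepsilon}$.
   Context: The Kneser graph $KG(n,k)$ has vertex set $\binom{[n]}{k}$, two $k$-sets being adjacent iff they are disjoint. A $k$-list assignment to a digraph $D$ assigns to each vertex $v$ a set $L(v)$ of $k$ positive integers; a colouring $f$ is accepted if $f(v)\in L(v)$ for all $v$; it is proper if every colour class induces a subdigraph with no directed cycle. The list dichromatic number $\vec\chi_\ell(D)$ is the least $k$ such that every $k$-list assignment accepts a proper colouring; for an undirected graph $G$, $\vec\chi_\ell(G)$ is the maximum of $\vec\chi_\ell(D)$ over all orientations $D$ of $G$. -}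

module Defs where

open import Level using (Level; _⊔_) renaming (suc to lsuc; zero to lzero)
open import Data.Nat using (ℕ; zero; suc; _+_; _*_; _^_; _≤_; _<_; _!)
open import Data.Fin using (Fin; zero; suc; inject₁; fromℕ)
open import Data.Fin.Subset using (Subset; _∩_; ∣_∣; Empty)
open import Data.List using (List; length)
open import Data.List.Membership.Propositional using (_∈_)
open import Data.List.Relation.Unary.Unique.Propositional using (Unique)
open import Data.List.Relation.Unary.All using (All)
open import Data.Product using (Σ; ∃; _×_; proj₁)
open import Data.Sum using (_⊎_)
open import Relation.Nullary using (¬_)
open import Relation.Binary.PropositionalEquality using (_≡_)
open import Function.Definitions using (Injective)

record Graph : Set₁ where
  field
    V   : Set
    Adj : V → V → Set

KG : ℕ → ℕ → Graph
KG n k = record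
  { V   = Σ (Subset n) (λ s → ∣ s ∣ ≡ k)
  ; Adj = λ u v → Empty (proj₁ u ∩ proj₁ v)
  }

record Orientation (G : Graph) : Set₁ where
  open Graph G
  field
    Arc     : V → V → Set
    arc⇒adj : ∀ {u v} → Arc u v → Adj u v
    adj⇒one : ∀ {u v} → Adj u v →
              (Arc u v × ¬ Arc v u) ⊎ (Arc v u × ¬ Arc u v)

record DiCycle {G : Graph} (D : Orientation G) : Set where
  open Graph G
  open Orientation D
  field
    len   : ℕ
    w     : Fin (suc len) → V
    inj   : Injective _≡_ _≡_ w
    steps : ∀ (i : Fin len) → Arc (w (inject₁ i)) (w (suc i))
    close : Arc (w (fromℕ len)) (w zero)

IsKListAssignment : (G : Graph) → ℕ → (Graph.V G → List ℕ) → Set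
IsKListAssignment G k L =
  ∀ v → length (L v) ≡ k × Unique (L v) × All (λ c → 0 < c) (L v)

Accepts : (G : Graph) → (Graph.V G → List ℕ) → (Graph.V G → ℕ) → Set
Accepts G L f = ∀ v → f v ∈ L v

Proper : {G : Graph} → Orientation G → (Graph.V G → ℕ) → Set
Proper D f = ∀ (C : DiCycle D) →
  ¬ (∀ i → f (DiCycle.w C i) ≡ f (DiCycle.w C zero))

ListDiColourable : {G : Graph} → Orientation G → ℕ → Set
ListDiColourable {G} D k =
  ∀ (L : Graph.V G → List ℕ) → IsKListAssignment G k L →
  ∃ λ (f : Graph.V G → ℕ) → Accepts G L f × Proper D f

-- m is the list dichromatic number of the undirected graph G:
-- the maximum over orientations D of the least k such that D is
-- k-list-dicolourable, i.e. the least k such that every orientation is.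
IsListDichromaticNumber : Graph → ℕ → Set₁
IsListDichromaticNumber G m =
  (∀ (D : Orientation G) → ListDiColourable D m) ×
  (∀ (k : ℕ) → (∀ (D : Orientation G) → ListDiColourable D k) → m ≤ k)

-- expT m t = Σ_{i=0}^{t} m^i · t!/i!   (so expT m t / t! is the t-th
-- Taylor partial sum of e^m).
expT : ℕ → ℕ → ℕ
expT m zero    = 1
expT m (suc t) = suc t * expT m t + m ^ suc t

-- ExpGe m N  ⇔  e^m ≥ N  (for naturals m, N): the partial sums increase
-- to e^m, and e^m is irrational for m ≥ 1, so e^m ≥ N iff some partial
-- sum is ≥ N.
ExpGe : ℕ → ℕ → Set
ExpGe m N = ∃ λ (t : ℕ) → N * (t !) ≤ expT m t

-- GeCNLnN a b n x  ⇔  x ≥ (a/b)·n·ln n   (for a, b > 0, n ≥ 1),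
-- since x ≥ (a/b) n ln n ⇔ e^(b·x) ≥ n^(a·n).
GeCNLnN : (a b n x : ℕ) → Set
GeCNLnN a b n x = ExpGe (b * x) (n ^ (a * n))

{-# OPTIONS --safe #-}

-- KG(n,k) contains the k-fold direct product H of K_s, s = ⌊n/k⌋, whose vertices are the
-- vectors in [s]^k, adjacent when they differ in every coordinate.  By Hoffman's bound a
-- set of more than 2s^(k-1) vertices of H spans a 2^-k fraction of all pairs.  In a random
-- orientation every acyclic set is sparse (it spans O(log) times as many edges as it has
-- vertices), so a Kleitman–Winston argument puts all acyclic sets into few containers,
-- each of size at most 3s^(k-1).  Give every vertex a random subset of a palette of 12m
-- colours.  For a fixed choice of one container per colour, a typical vertex lies in only
-- O(m/s) of them, so its list avoids all of these with probability n^(-ck), c small when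
-- m is a small multiple of n log n; since |H| is larger than n^(1+ck), the probability
-- that every vertex finds a colour beats the number of choices of containers.
module Submission where

open import Defs
open import Data.Bool using (Bool; T; true; false; not; _∧_; _∨_; if_then_else_)
open import Data.Bool.Properties using (∨-zeroʳ; ∧-comm)
import Data.Bool.Properties as Boolₚ
open import Data.Empty using (⊥; ⊥-elim)
open import Data.Fin using (Fin; zero; suc; inject₁; fromℕ; toℕ; inject≤)
import Data.Fin.Properties as Finₚ
open import Data.Fin.Subset using (Subset; _∩_; ∣_∣; Empty; ⁅_⁆) renaming (⊥ to ⊥ₛ; _∈_ to _∈ₛ_)
open import Data.Fin.Subset.Properties using (∣⊥∣≡0; ∣⁅x⁆∣≡1; x∈⁅x⁆; x∈⁅y⁆⇒x≡y; x∈p∩q⁻; Empty-unique; ∉⊥; ∩-idem; ∩-comm)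
open import Data.List using (List; []; _∷_; _++_; map; length; cartesianProductWith; cartesianProduct; filter; take; replicate; concatMap; allFin)
open import Data.List.Properties using (length-map; length-++; length-filter; length-take; length-replicate; length-tabulate)
open import Data.List.Membership.Propositional using (_∈_; find; lose)
open import Data.List.Membership.Propositional.Properties
import Data.List.Membership.DecPropositional as DecMem
open import Data.List.Relation.Unary.Any using (here; there; index; any?)
import Data.List.Relation.Unary.Any.Properties as Anyₚ
open import Data.List.Relation.Unary.All using (All; []; _∷_; all?)
import Data.List.Relation.Unary.All as All
import Data.List.Relation.Unary.All.Properties as Allₚ
open import Data.List.Relation.Unary.AllPairs using (AllPairs; []; _∷_)
open import Data.List.Relation.Unary.Unique.Propositional using (Unique)
import Data.List.Relation.Unary.Unique.Propositional.Properties as Uniq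
open import Data.List.Relation.Binary.Permutation.Propositional using (_↭_; ↭-refl; ↭-sym; ↭-trans; prep)
open import Data.List.Relation.Binary.Permutation.Propositional.Properties using (∈-resp-↭; All-resp-↭; shift; ↭-length)
open import Data.Nat hiding (_≟_)
open import Data.Nat.DivMod using (m≡m%n+[m/n]*n; m%n<n; m/n*n≤m; m≥n⇒m/n>0)
open import Data.Nat.Properties hiding (_≟_)
open import Data.Nat.Tactic.RingSolver using (solve-∀)
open import Data.Product using (∃; _×_; _,_; proj₁; proj₂)
open import Data.Product.Properties using (≡-dec)
open import Data.Sum using (_⊎_; inj₁; inj₂)
open import Data.Vec using (Vec; []; _∷_; toList; fromList; lookup)
import Data.Vec as Vec
import Data.Vec.Properties as Vecₚ
import Data.Vec.Relation.Unary.All as VAll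
import Data.Vec.Relation.Unary.All.Properties as VAllₚ
open import Function using (_∘_)
open import Function.Definitions using (Injective)
open import Relation.Binary.Definitions using (DecidableEquality)
open import Relation.Binary.PropositionalEquality hiding (J; [_])
open import Relation.Nullary using (¬_; Dec; yes; no; does)
open import Relation.Nullary.Decidable using (dec-true; dec-false)

-- Sums, products and the method of conditional expectations

-- The binding inequality is `2 * (2 ^ suc g * suc (κ * M)) ≤ s ^ k`. Here `M = 12m` is the palette,
-- `g` is about `72m/s`, and the containers number at most `2 ^ κ`. At least half of the `s ^ k`
-- vertices lie in at most `g` of the chosen containers, and each of them fails to get a useful list
-- with probability at most `1 - 2^-(g+1)`. All of them must fail for one of `2 ^ (κM)` choices of
-- containers, so `s ^ k` has to beat `2 ^ g * κ * m`, where `m` may be of order `n log n`. With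
-- `ε = p/q` the bound on `k` gives `2s ≥ n^(1/2+ε)`, hence `(2s)^k ≥ n^(k/2) * n^(εk)`. The first
-- factor pays for the `n` in `n log n` exactly when `k ≥ 2`. The second is split evenly between
-- `2 ^ g` and the factor `2^O(k)` polylog `n`, bounded by `τ ^ k`, that comes from `κ`. The
-- containers depend on the graph alone. The orientation enters only through the sparsity of acyclic
-- sets, so it can be fixed before the lists are drawn.

private variable
  A B C : Set

∑ : List A → (A → ℕ) → ℕ
∑ []       f = 0
∑ (x ∷ xs) f = f x + ∑ xs f

∏ : List A → (A → ℕ) → ℕ
∏ []       f = 1
∏ (x ∷ xs) f = f x * ∏ xs f

syntax ∑ xs (λ x → e) = ∑[ x ∈ xs ] e
syntax ∏ xs (λ x → e) = ∏[ x ∈ xs ] e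
infix 5 ∑ ∏

∑-mono-∈ : ∀ (xs : List A) {f g} → (∀ x → x ∈ xs → f x ≤ g x) → ∑ xs f ≤ ∑ xs g
∑-mono-∈ []       h = z≤n
∑-mono-∈ (x ∷ xs) h = +-mono-≤ (h x (here refl)) (∑-mono-∈ xs (λ z z∈ → h z (there z∈)))

∑-mono : ∀ (xs : List A) {f g} → (∀ x → f x ≤ g x) → ∑ xs f ≤ ∑ xs g
∑-mono xs h = ∑-mono-∈ xs (λ x _ → h x)

∑-cong : ∀ (xs : List A) {f g} → (∀ x → f x ≡ g x) → ∑ xs f ≡ ∑ xs g
∑-cong []       h = refl
∑-cong (x ∷ xs) h = cong₂ _+_ (h x) (∑-cong xs h)

∏-mono-∈ : ∀ (xs : List A) {f g} → (∀ x → x ∈ xs → f x ≤ g x) → ∏ xs f ≤ ∏ xs g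
∏-mono-∈ []       h = ≤-refl
∏-mono-∈ (x ∷ xs) h = *-mono-≤ (h x (here refl)) (∏-mono-∈ xs (λ z z∈ → h z (there z∈)))

∏-mono : ∀ (xs : List A) {f g} → (∀ x → f x ≤ g x) → ∏ xs f ≤ ∏ xs g
∏-mono xs h = ∏-mono-∈ xs (λ x _ → h x)

∑-distrib-+ : ∀ (xs : List A) f g → ∑[ x ∈ xs ] (f x + g x) ≡ ∑ xs f + ∑ xs g
∑-distrib-+ []       f g = refl
∑-distrib-+ (x ∷ xs) f g = trans (cong (f x + g x +_) (∑-distrib-+ xs f g))
  (lemma (f x) (g x) (∑ xs f) (∑ xs g))
  where
  lemma : ∀ a b c d → a + b + (c + d) ≡ a + c + (b + d)
  lemma = solve-∀

∑-*ˡ : ∀ (xs : List A) c f → ∑[ x ∈ xs ] (c * f x) ≡ c * ∑ xs f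
∑-*ˡ []       c f = sym (*-zeroʳ c)
∑-*ˡ (x ∷ xs) c f = trans (cong (c * f x +_) (∑-*ˡ xs c f)) (sym (*-distribˡ-+ c (f x) (∑ xs f)))

∑-*ʳ : ∀ (xs : List A) c f → ∑[ x ∈ xs ] (f x * c) ≡ ∑ xs f * c
∑-*ʳ xs c f = trans (∑-cong xs (λ x → *-comm (f x) c)) (trans (∑-*ˡ xs c f) (*-comm c _))

∑-const : ∀ (xs : List A) c → ∑[ _ ∈ xs ] c ≡ length xs * c
∑-const []       c = refl
∑-const (x ∷ xs) c = cong (c +_) (∑-const xs c)

∑-zero : ∀ (xs : List A) → ∑[ _ ∈ xs ] 0 ≡ 0
∑-zero xs = trans (∑-const xs 0) (*-zeroʳ (length xs))

∑-swap : ∀ (xs : List A) (ys : List B) (f : A → B → ℕ) →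
         ∑[ x ∈ xs ] ∑[ y ∈ ys ] f x y ≡ ∑[ y ∈ ys ] ∑[ x ∈ xs ] f x y
∑-swap []       ys f = sym (∑-zero ys)
∑-swap (x ∷ xs) ys f = trans (cong (∑ ys (f x) +_) (∑-swap xs ys f))
  (sym (∑-distrib-+ ys (f x) (λ y → ∑[ z ∈ xs ] f z y)))

∑-++ : ∀ (xs ys : List A) f → ∑ (xs ++ ys) f ≡ ∑ xs f + ∑ ys f
∑-++ []       ys f = refl
∑-++ (x ∷ xs) ys f = trans (cong (f x +_) (∑-++ xs ys f)) (sym (+-assoc (f x) _ _))

∑-map : ∀ (g : A → B) xs f → ∑ (map g xs) f ≡ ∑ xs (f ∘ g)
∑-map g []       f = refl
∑-map g (x ∷ xs) f = cong (f (g x) +_) (∑-map g xs f)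

∑-cartesianProductWith : ∀ (h : A → B → C) xs ys f →
  ∑ (cartesianProductWith h xs ys) f ≡ ∑[ x ∈ xs ] ∑[ y ∈ ys ] f (h x y)
∑-cartesianProductWith h []       ys f = refl
∑-cartesianProductWith h (x ∷ xs) ys f =
  trans (∑-++ (map (h x) ys) (cartesianProductWith h xs ys) f)
        (cong₂ _+_ (∑-map (h x) ys f) (∑-cartesianProductWith h xs ys f))

term≤∑ : ∀ {xs : List A} {x} f → x ∈ xs → f x ≤ ∑ xs f
term≤∑ f (here refl) = m≤m+n _ _
term≤∑ f (there x∈)  = ≤-trans (term≤∑ f x∈) (m≤n+m _ _)

∑≤length* : ∀ (xs : List A) c {f} → (∀ x → x ∈ xs → f x ≤ c) → ∑ xs f ≤ length xs * c
∑≤length* xs c h = ≤-trans (∑-mono-∈ xs h) (≤-reflexive (∑-const xs c))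

length≡∑1 : ∀ (xs : List A) → length xs ≡ ∑[ _ ∈ xs ] 1
length≡∑1 xs = sym (trans (∑-const xs 1) (*-identityʳ _))

length-cartesianProductWith : ∀ (h : A → B → C) xs ys →
  length (cartesianProductWith h xs ys) ≡ length xs * length ys
length-cartesianProductWith h xs ys = begin
  length (cartesianProductWith h xs ys)           ≡⟨ length≡∑1 (cartesianProductWith h xs ys) ⟩
  ∑ (cartesianProductWith h xs ys) (λ _ → 1)      ≡⟨ ∑-cartesianProductWith h xs ys (λ _ → 1) ⟩
  (∑[ x ∈ xs ] ∑[ y ∈ ys ] 1)                     ≡⟨ ∑-cong xs (λ _ → sym (length≡∑1 ys)) ⟩
  (∑[ x ∈ xs ] length ys)                         ≡⟨ ∑-const xs (length ys) ⟩
  length xs * length ys                           ∎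
  where open ≡-Reasoning

vecs : List A → (t : ℕ) → List (Vec A t)
vecs xs zero    = [] ∷ []
vecs xs (suc t) = cartesianProductWith _∷_ xs (vecs xs t)

length-vecs : ∀ (xs : List A) t → length (vecs xs t) ≡ length xs ^ t
length-vecs xs zero    = refl
length-vecs xs (suc t) = trans (length-cartesianProductWith _∷_ xs (vecs xs t))
  (cong (length xs *_) (length-vecs xs t))

∈-vecs : ∀ {xs : List A} {t} {v : Vec A t} → VAll.All (_∈ xs) v → v ∈ vecs xs t
∈-vecs VAll.[]         = here refl
∈-vecs (x∈ VAll.∷ v∈) = ∈-cartesianProductWith⁺ _∷_ x∈ (∈-vecs v∈)

∑-vecs : ∀ (xs : List A) t f → ∑ (vecs xs (suc t)) f ≡ ∑[ x ∈ xs ] ∑[ v ∈ vecs xs t ] f (x ∷ v)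
∑-vecs xs t f = ∑-cartesianProductWith _∷_ xs (vecs xs t) f

vecs-unique : ∀ {xs : List A} → Unique xs → ∀ t → Unique (vecs xs t)
vecs-unique xs! zero    = [] ∷ []
vecs-unique xs! (suc t) = Uniq.cartesianProductWith⁺ _∷_ Vecₚ.∷-injective xs! (vecs-unique xs! t)

⟦_⟧ : Bool → ℕ
⟦ true ⟧  = 1
⟦ false ⟧ = 0

⟦⟧≤1 : ∀ b → ⟦ b ⟧ ≤ 1
⟦⟧≤1 true  = ≤-refl
⟦⟧≤1 false = z≤n

⟦⟧-∧ : ∀ a b → ⟦ a ∧ b ⟧ ≡ ⟦ a ⟧ * ⟦ b ⟧
⟦⟧-∧ true  b = sym (+-identityʳ _)
⟦⟧-∧ false b = refl

⟦not⟧ : ∀ b → ⟦ b ⟧ + ⟦ not b ⟧ ≡ 1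
⟦not⟧ true  = refl
⟦not⟧ false = refl

∃-below-average : ∀ {b : A} (as : List A) {h : A → ℕ} → b ∈ as → ∃ λ a → length as * h a ≤ ∑ as h
∃-below-average (a ∷ []) {h} _ = a , ≤-refl
∃-below-average (a ∷ as@(a′ ∷ _)) {h} _ with ∃-below-average as {h} (here refl)
... | c , hc with h a ≤? h c
...   | yes p = a , +-monoʳ-≤ (h a) (≤-trans (*-monoʳ-≤ (length as) p) hc)
...   | no ¬p = c , +-mono-≤ (≰⇒≥ ¬p) hc

-- The method of conditional expectations: the values ω v are fixed one
-- vertex at a time, g carrying the product over the vertices already treated.
module _ {V I : Set} (_≟_ : DecidableEquality V) {b : A} (as : List A) (b∈as : b ∈ as)
         (is : List I) (f : I → V → A → ℕ) where

  private
    update : (V → A) → V → A → V → A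
    update ω v a u with u ≟ v
    ... | yes _ = a
    ... | no  _ = ω u

    update-here : ∀ ω v a → update ω v a v ≡ a
    update-here ω v a with v ≟ v
    ... | yes _ = refl
    ... | no ¬p = ⊥-elim (¬p refl)

    update-there : ∀ ω v a {u} → v ≢ u → update ω v a u ≡ ω u
    update-there ω v a {u} v≢u with u ≟ v
    ... | yes p = ⊥-elim (v≢u (sym p))
    ... | no  _ = refl

    ∏-update : ∀ (vs : List V) i ω v a → All (v ≢_) vs →
               ∏[ u ∈ vs ] f i u (update ω v a u) ≡ ∏[ u ∈ vs ] f i u (ω u)
    ∏-update []       i ω v a []         = refl
    ∏-update (u ∷ vs) i ω v a (v≢u ∷ v∉) =
      cong₂ _*_ (cong (f i u) (update-there ω v a v≢u)) (∏-update vs i ω v a v∉)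

  weighted-below-expectation : ∀ (vs : List V) → Unique vs → ∀ (g : I → ℕ) → ∃ λ (ω : V → A) →
    length as ^ length vs * (∑[ i ∈ is ] (g i * (∏[ v ∈ vs ] f i v (ω v)))) ≤
    ∑[ i ∈ is ] (g i * (∏[ v ∈ vs ] ∑[ a ∈ as ] f i v a))
  weighted-below-expectation []       _           g = (λ _ → b) , ≤-reflexive (*-identityˡ _)
  weighted-below-expectation (v ∷ vs) (v∉ ∷ vs!) g = update ω v a , (begin
    Q * Q ^ length vs * (∑[ i ∈ is ] (g i * (f i v (ω′ v) * ∏ vs (λ u → f i u (ω′ u)))))
      ≡⟨ cong (Q * Q ^ length vs *_) (∑-cong is (λ i → trans (sym (*-assoc (g i) _ _))
           (cong₂ _*_ (cong (λ z → g i * f i v z) (update-here ω v a)) (∏-update vs i ω v a v∉)))) ⟩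
    Q * Q ^ length vs * (∑[ i ∈ is ] (g i * f i v a * ∏ vs (λ u → f i u (ω u))))
      ≡⟨ *-assoc Q _ _ ⟩
    Q * (Q ^ length vs * (∑[ i ∈ is ] (g i * f i v a * ∏ vs (λ u → f i u (ω u)))))
      ≤⟨ *-monoʳ-≤ Q (proj₂ rest) ⟩
    Q * (∑[ i ∈ is ] (g i * f i v a * R i))
      ≤⟨ proj₂ best ⟩
    (∑[ a ∈ as ] ∑[ i ∈ is ] (g i * f i v a * R i))
      ≡⟨ ∑-swap as is (λ a i → g i * f i v a * R i) ⟩
    (∑[ i ∈ is ] ∑[ a ∈ as ] (g i * f i v a * R i))
      ≡⟨ ∑-cong is (λ i → trans (∑-*ʳ as (R i) (λ a → g i * f i v a))
           (trans (cong (_* R i) (∑-*ˡ as (g i) (f i v))) (*-assoc (g i) _ _))) ⟩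
    (∑[ i ∈ is ] (g i * ((∑[ a ∈ as ] f i v a) * R i))) ∎)
    where
    open ≤-Reasoning
    Q = length as
    R : I → ℕ
    R i = ∏[ u ∈ vs ] ∑[ a ∈ as ] f i u a
    best = ∃-below-average as {λ a → ∑[ i ∈ is ] (g i * f i v a * R i)} b∈as
    a = proj₁ best
    rest = weighted-below-expectation vs vs! (λ i → g i * f i v a)
    ω = proj₁ rest
    ω′ = update ω v a

  below-expectation : ∀ (vs : List V) → Unique vs → ∃ λ (ω : V → A) →
    length as ^ length vs * (∑[ i ∈ is ] ∏[ v ∈ vs ] f i v (ω v)) ≤
    ∑[ i ∈ is ] ∏[ v ∈ vs ] ∑[ a ∈ as ] f i v a
  below-expectation vs vs! with weighted-below-expectation vs vs! (λ _ → 1)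
  ... | ω , h = ω , subst₂ _≤_
    (cong (length as ^ length vs *_) (∑-cong is (λ i → *-identityˡ _)))
    (∑-cong is (λ i → *-identityˡ _)) h

  -- First moment: `f i v a` is meant to be 0 when the choice `a` at `v` averts the bad event `i`,
  -- so the product over `v` is the indicator that nothing averts it. The hypothesis says that the
  -- expected number of surviving bad events is below 1, so some `ω` leaves none.
  union-bound : ∀ (vs : List V) → Unique vs →
    ∑[ i ∈ is ] ∏[ v ∈ vs ] ∑[ a ∈ as ] f i v a < length as ^ length vs →
    ∃ λ (ω : V → A) → ∀ {i} → i ∈ is → ∃ λ v → f i v (ω v) ≡ 0
  union-bound vs vs! small with below-expectation vs vs!
  ... | ω , h = ω , λ {i} i∈ → zero-factor vs (n≤0⇒n≡0 (≤-trans (term≤∑ _ i∈) (≤-reflexive ∑≡0)))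
    where
    total = ∑[ i ∈ is ] ∏[ v ∈ vs ] f i v (ω v)

    ∑≡0 : total ≡ 0
    ∑≡0 = n<1⇒n≡0 (*-cancelˡ-< (length as ^ length vs) total 1
            (≤-<-trans h (<-≤-trans small (≤-reflexive (sym (*-identityʳ _))))))

    zero-factor : ∀ us {i} → ∏[ v ∈ us ] f i v (ω v) ≡ 0 → ∃ λ v → f i v (ω v) ≡ 0
    zero-factor (u ∷ us) {i} eq with m*n≡0⇒m≡0∨n≡0 (f i u (ω u)) eq
    ... | inj₁ p = u , p
    ... | inj₂ p = zero-factor us p

does⇒ : ∀ {P : Set} (d : Dec P) → does d ≡ true → P
does⇒ (yes p) _ = p

∧-split : ∀ a {b} → a ∧ b ≡ true → a ≡ true × b ≡ true
∧-split true h = refl , h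

∨-split : ∀ a {b} → a ∨ b ≡ true → a ≡ true ⊎ b ≡ true
∨-split true  _ = inj₁ refl
∨-split false h = inj₂ h

not-split : ∀ {a} → not a ≡ true → a ≡ false
not-split {false} _ = refl

-- Topological sorting

module Finite {V : Set} (_≟_ : DecidableEquality V) (vs : List V)
              (complete : ∀ v → v ∈ vs) (unique : Unique vs) where

  open DecMem _≟_ using (_∈?_) public

  N : ℕ
  N = length vs

  mem : List V → V → Bool
  mem w v = does (v ∈? w)

  ∈⇒mem : ∀ {w v} → v ∈ w → mem w v ≡ true
  ∈⇒mem {w} {v} = dec-true (v ∈? w)

  mem⇒∈ : ∀ w {v} → mem w v ≡ true → v ∈ w
  mem⇒∈ w {v} = does⇒ (v ∈? w)

  mem-cong : ∀ {w w′} → (∀ {v} → v ∈ w → v ∈ w′) → (∀ {v} → v ∈ w′ → v ∈ w) → ∀ v → mem w v ≡ mem w′ v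
  mem-cong {w} {w′} to from v with v ∈? w
  ... | yes p = sym (dec-true (v ∈? w′) (to p))
  ... | no ¬p = sym (dec-false (v ∈? w′) (¬p ∘ from))

  # : (V → Bool) → ℕ
  # S = ∑[ v ∈ vs ] ⟦ S v ⟧

  -- Words of length `t`, repetitions allowed, stand for the sets of at most `t` vertices. This
  -- overcounts, but the number `N ^ t` is all that the union bounds need.
  words : ℕ → List (List V)
  words t = map toList (vecs vs t)

  length-words : ∀ t → length (words t) ≡ N ^ t
  length-words t = trans (length-map toList (vecs vs t)) (length-vecs vs t)

  ∈-words : ∀ {w : List V} {t} → length w ≡ t → w ∈ words t
  ∈-words {w} refl = subst (_∈ words (length w)) (Vecₚ.toList∘fromList w)
                           (∈-map⁺ toList (∈-vecs (all∈ (fromList w))))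
    where
    all∈ : ∀ {t} (w : Vec V t) → VAll.All (_∈ vs) w
    all∈ []      = VAll.[]
    all∈ (x ∷ w) = complete x VAll.∷ all∈ w

  ∈-words⁻ : ∀ {w t} → w ∈ words t → length w ≡ t
  ∈-words⁻ w∈ with ∈-map⁻ toList w∈
  ... | v , _ , refl = Vecₚ.length-toList v

  module _ (arc : V → V → Bool) where

    Forward : List V → Set
    Forward = AllPairs (λ u v → arc v u ≡ false)

    record Cycle (U : V → Bool) : Set where
      field
        len   : ℕ
        w     : Fin (suc len) → V
        inj   : Injective _≡_ _≡_ w
        steps : ∀ (i : Fin len) → arc (w (inject₁ i)) (w (suc i)) ≡ true
        close : arc (w (fromℕ len)) (w zero) ≡ true
        inU   : ∀ i → U (w i) ≡ true

    Acyclic : (V → Bool) → Set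
    Acyclic U = ¬ Cycle U

    private
      -- A directed path that is extended backwards until it bites its own tail.
      record Path (xs : List V) (l : ℕ) : Set where
        field
          p      : Fin (suc l) → V
          inj    : Injective _≡_ _≡_ p
          steps  : ∀ (i : Fin l) → arc (p (inject₁ i)) (p (suc i)) ≡ true
          inside : ∀ i → p i ∈ xs

      path-length≤N : ∀ {xs l} → Path xs l → suc l ≤ N
      path-length≤N P = Finₚ.injective⇒≤ {f = λ i → index (complete (p i))}
        (λ {i} {j} eq → inj (trans (Anyₚ.lookup-index (complete (p i)))
          (trans (cong (Data.List.lookup vs) eq) (sym (Anyₚ.lookup-index (complete (p j)))))))
        where open Path P

      initial-cycle : ∀ {xs l U} (P : Path xs l) → All (λ x → U x ≡ true) xs → ∀ i →
                      arc (Path.p P i) (Path.p P zero) ≡ true → Cycle U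
      initial-cycle {l = l} P U∋ i back = record
        { len   = toℕ i
        ; w     = λ j → p (inject≤ j i<l)
        ; inj   = λ eq → Finₚ.inject≤-injective i<l i<l _ _ (inj eq)
        ; steps = λ j → subst₂ (λ a b → arc (p a) (p b) ≡ true)
                    (Finₚ.toℕ-injective (trans (Finₚ.toℕ-inject₁ _)
                      (trans (Finₚ.toℕ-inject≤ j _)
                        (sym (trans (Finₚ.toℕ-inject≤ (inject₁ j) i<l) (Finₚ.toℕ-inject₁ j))))))
                    (Finₚ.toℕ-injective (cong suc (trans (Finₚ.toℕ-inject≤ j (s≤s⁻¹ i<l))
                      (sym (Finₚ.toℕ-inject≤ j (s≤s⁻¹ i<l))))))
                    (steps (inject≤ j (s≤s⁻¹ i<l)))
        ; close = subst₂ (λ a b → arc (p a) (p b) ≡ true)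
                    (Finₚ.toℕ-injective (sym (trans (Finₚ.toℕ-inject≤ (fromℕ (toℕ i)) i<l) (Finₚ.toℕ-fromℕ (toℕ i)))))
                    refl back
        ; inU   = λ j → All.lookup U∋ (inside _)
        }
        where
        open Path P
        i<l : suc (toℕ i) ≤ suc l
        i<l = Finₚ.toℕ<n i

      extend : ∀ {xs l} (P : Path xs l) y → y ∈ xs → arc y (Path.p P zero) ≡ true →
               (∀ i → Path.p P i ≢ y) → Path xs (suc l)
      extend {xs} {l} P y y∈ a new = record
        { p = q ; inj = q-inj ; steps = q-steps ; inside = λ { zero → y∈ ; (suc i) → inside i } }
        where
        open Path P
        q : Fin (suc (suc l)) → V
        q zero    = y
        q (suc i) = p i
        q-inj : Injective _≡_ _≡_ q
        q-inj {zero}  {zero}  _  = refl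
        q-inj {zero}  {suc j} eq = ⊥-elim (new j (sym eq))
        q-inj {suc i} {zero}  eq = ⊥-elim (new i eq)
        q-inj {suc i} {suc j} eq = cong suc (inj eq)
        q-steps : ∀ (i : Fin (suc l)) → arc (q (inject₁ i)) (q (suc i)) ≡ true
        q-steps zero    = a
        q-steps (suc i) = steps i

      -- The fuel cannot run out: it would leave an injective path on more than `N` vertices.
      walk : ∀ {xs U} → All (λ x → U x ≡ true) xs →
             (∀ {x} → x ∈ xs → ∃ λ y → y ∈ xs × arc y x ≡ true) →
             ∀ fuel {l} → Path xs l → N ≤ fuel + l → Cycle U
      walk U∋ prev zero P N≤ = ⊥-elim (<-irrefl refl (≤-trans (path-length≤N P) N≤))
      walk U∋ prev (suc fuel) {l} P N≤ with prev (Path.inside P zero)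
      ... | y , y∈ , a with Finₚ.any? (λ i → Path.p P i ≟ y)
      ...   | yes (i , refl) = initial-cycle P U∋ i a
      ...   | no  new = walk U∋ prev fuel (extend P y y∈ a (λ i eq → new (i , eq)))
                          (≤-trans N≤ (≤-reflexive (sym (+-suc fuel l))))

    -- If no entry were a source, every entry would have an in-neighbour in `xs`, and walking
    -- backwards from `x₀` would close a cycle inside `U`.
    source : ∀ {U xs x₀} → Acyclic U → x₀ ∈ xs → All (λ x → U x ≡ true) xs →
             ∃ λ x → x ∈ xs × All (λ y → arc y x ≡ false) xs
    source {U} {xs} {x₀} acyc x₀∈ U∋
      with any? (λ x → all? (λ y → arc y x Boolₚ.≟ false) xs) xs
    ... | yes p = let x , x∈ , h = find p in x , x∈ , h
    ... | no ¬p = ⊥-elim (acyc (walk U∋ prev N start (m≤m+n N 0)))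
      where
      prev : ∀ {x} → x ∈ xs → ∃ λ y → y ∈ xs × arc y x ≡ true
      prev {x} x∈ with find (Allₚ.¬All⇒Any¬ (λ y → arc y x Boolₚ.≟ false) xs
                              (All.lookup (Allₚ.¬Any⇒All¬ xs ¬p) x∈))
      ... | y , y∈ , h = y , y∈ , Boolₚ.¬-not h
      start : Path xs 0
      start = record { p = λ _ → x₀ ; inj = λ { {zero} {zero} _ → refl } ; steps = λ () ; inside = λ _ → x₀∈ }

    topological-sort : ∀ {U} → Acyclic U → ∀ n xs → length xs ≡ n → All (λ x → U x ≡ true) xs →
                       ∃ λ ys → ys ↭ xs × Forward ys
    topological-sort acyc zero    []       _   _  = [] , ↭-refl , []
    topological-sort acyc (suc n) xs@(x₀ ∷ _) len U∋
      with x , x∈ , src ← source acyc (here refl) U∋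
      with as , bs , eq ← ∈-∃++ x∈
      with topological-sort acyc n (as ++ bs)
             (suc-injective (trans (↭-length (↭-sym (shift x as bs))) (trans (cong length (sym eq)) len)))
             (All.tail (All-resp-↭ (shift x as bs) (subst (All _) eq U∋)))
    ... | ys , ys↭ , fwd = x ∷ ys , x∷ys↭xs , All.tail (All-resp-↭ (↭-sym x∷ys↭xs) src) ∷ fwd
      where
      x∷ys↭xs : x ∷ ys ↭ xs
      x∷ys↭xs = ↭-trans (prep x ys↭) (↭-trans (↭-sym (shift x as bs)) (subst (_↭ xs) eq ↭-refl))

-- Orientations whose acyclic sets are sparse

bools : List Bool
bools = true ∷ false ∷ []

true≢false : true ≢ false
true≢false ()

-- Some occurrence of `u` precedes an occurrence of `v`. In a word with repetitions both
-- `before w u v` and `before w v u` can hold; then neither direction of the edge respects the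
-- order.
before : {V : Set} (_≟_ : DecidableEquality V) → List V → V → V → Bool
before _≟_ []      u v = false
before _≟_ (x ∷ w) u v = (does (u ≟ x) ∧ does (DecMem._∈?_ _≟_ v w)) ∨ before _≟_ w u v

module Orient {V : Set} (_≟_ : DecidableEquality V) (vs : List V)
              (complete : ∀ v → v ∈ vs) (unique : Unique vs)
              (adj : V → V → Bool) (adj-sym : ∀ u v → adj u v ≡ adj v u) (adj-irr : ∀ v → adj v v ≡ false)
              (lt : V → V → Bool) (lt-total : ∀ {u v} → u ≢ v → lt u v ≡ not (lt v u)) where

  open Finite _≟_ vs complete unique

  -- The edges inside w, each counted in both directions.
  e₂ : List V → ℕ
  e₂ w = ∑[ u ∈ vs ] ∑[ v ∈ vs ] ⟦ adj u v ∧ mem w u ∧ mem w v ⟧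

  -- There is a coin for every ordered pair, but an edge reads only the coin of its `lt`-increasing
  -- pair. Uniform coins therefore orient the edges uniformly and independently.
  arc : (V × V → Bool) → V → V → Bool
  arc b u v = adj u v ∧ (if lt u v then b (u , v) else not (b (v , u)))

  adj⇒≢ : ∀ {u v} → adj u v ≡ true → u ≢ v
  adj⇒≢ {u} a refl = true≢false (trans (sym a) (adj-irr u))

  private
    before⇒ : ∀ {P : V → V → Set} {w} → AllPairs P w → ∀ {u v} → before _≟_ w u v ≡ true → P u v
    before⇒ {w = x ∷ w} (px ∷ pw) {u} {v} h with ∨-split (does (u ≟ x) ∧ mem w v) h
    ... | inj₂ h₂ = before⇒ pw h₂
    ... | inj₁ h₁ with ∧-split (does (u ≟ x)) h₁
    ...   | h₃ , h₄ with does⇒ (u ≟ x) h₃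
    ...     | refl = All.lookup px (mem⇒∈ w h₄)

    before-total : ∀ {w u v} → u ∈ w → v ∈ w → u ≢ v → before _≟_ w u v ∨ before _≟_ w v u ≡ true
    before-total (here refl) (here refl) u≢v = ⊥-elim (u≢v refl)
    before-total {x ∷ w} {u} {v} (here refl) (there v∈) u≢v
      rewrite dec-true (u ≟ u) refl | ∈⇒mem v∈ = refl
    before-total {x ∷ w} {u} {v} (there u∈) (here refl) u≢v
      rewrite dec-true (v ≟ v) refl | ∈⇒mem u∈ = ∨-zeroʳ _
    before-total {x ∷ w} {u} {v} (there u∈) (there v∈) u≢v
      with before _≟_ w u v | before _≟_ w v u | before-total u∈ v∈ u≢v
    ... | true  | _    | _ rewrite ∨-zeroʳ (does (u ≟ x) ∧ mem w v) = refl
    ... | false | true | _ rewrite ∨-zeroʳ (does (v ≟ x) ∧ mem w u) = ∨-zeroʳ _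

    pairs : List (V × V)
    pairs = cartesianProduct vs vs

    con : List V → V × V → Bool
    con w (u , v) = lt u v ∧ (adj u v ∧ mem w u ∧ mem w v)

    wrong : List V → V × V → Bool → Bool
    wrong w (u , v) c = (before _≟_ w u v ∧ not c) ∨ (before _≟_ w v u ∧ c)

    -- Zero exactly when the coin value `c` orients the edge `e` of `w` against the order of `w`.
    -- The product over all pairs vanishes unless `w` is a forward order of the oriented graph.
    f : List V → V × V → Bool → ℕ
    f w e c = ⟦ not (con w e ∧ wrong w e c) ⟧

    con-adj : ∀ w u v → con w (u , v) ≡ true → lt u v ≡ true × adj u v ≡ true
    con-adj w u v c = let l , c₁ = ∧-split (lt u v) c in l , proj₁ (∧-split (adj u v) c₁)

    arc-back : ∀ b {u v} → lt u v ≡ true → adj u v ≡ true → b (u , v) ≡ false → arc b v u ≡ true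
    arc-back b {u} {v} l a nb rewrite trans (adj-sym v u) a | lt-total (adj⇒≢ a ∘ sym) | l | nb = refl

    arc-forth : ∀ b {u v} → lt u v ≡ true → adj u v ≡ true → b (u , v) ≡ true → arc b u v ≡ true
    arc-forth b l a yb rewrite a | l | yb = refl

    forward-not-wrong : ∀ b w e → Forward (arc b) w → con w e ≡ true → wrong w e (b e) ≡ true → ⊥
    forward-not-wrong b w (u , v) fwd c wr
      with l , a ← con-adj w u v c
      with ∨-split (before _≟_ w u v ∧ not (b (u , v))) wr
    ... | inj₁ h = let uv , nb = ∧-split (before _≟_ w u v) h in
      true≢false (trans (sym (arc-back b l a (not-split nb))) (before⇒ fwd uv))
    ... | inj₂ h = let vu , yb = ∧-split (before _≟_ w v u) h in
      true≢false (trans (sym (arc-forth b l a yb)) (before⇒ fwd vu))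

    ⟦not⟧≡0 : ∀ {a} → ⟦ not a ⟧ ≡ 0 → a ≡ true
    ⟦not⟧≡0 {true} _ = refl

    ∑f≤ : ∀ w e → ∑ bools (f w e) ≤ (if con w e then 1 else 2)
    ∑f≤ w e@(u , v) with con w e in eq
    ... | false = ≤-refl
    ... | true with ∧-split (lt u v) eq
    ...   | _ , eq₁ with ∧-split (adj u v) eq₁
    ...     | a , eq₂ with ∧-split (mem w u) eq₂
    ...       | mu , mv with before _≟_ w u v | before _≟_ w v u | before-total (mem⇒∈ w mu) (mem⇒∈ w mv) (adj⇒≢ a)
    ...         | true  | true  | _ = z≤n
    ...         | true  | false | _ = ≤-refl
    ...         | false | true  | _ = ≤-refl
    ...         | false | false | ()

    ∏-con : ∀ w (es : List (V × V)) →
      2 ^ (∑[ e ∈ es ] ⟦ con w e ⟧) * (∏[ e ∈ es ] (if con w e then 1 else 2)) ≡ 2 ^ length es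
    ∏-con w []       = refl
    ∏-con w (e ∷ es) with con w e
    ... | true  = trans (cong (2 * 2 ^ (∑[ e ∈ es ] ⟦ con w e ⟧) *_) (*-identityˡ _))
                    (trans (*-assoc 2 (2 ^ (∑[ e ∈ es ] ⟦ con w e ⟧)) _) (cong (2 *_) (∏-con w es)))
    ... | false = trans (lemma (2 ^ (∑[ e ∈ es ] ⟦ con w e ⟧)) _) (cong (2 *_) (∏-con w es))
      where
      lemma : ∀ a b → a * (2 * b) ≡ 2 * (a * b)
      lemma = solve-∀

    e₂≤2con : ∀ w → e₂ w ≤ 2 * (∑[ e ∈ pairs ] ⟦ con w e ⟧)
    e₂≤2con w = begin
      e₂ w ≤⟨ ∑-mono vs (λ u → ∑-mono vs (split u)) ⟩
      (∑[ u ∈ vs ] ∑[ v ∈ vs ] (⟦ con w (u , v) ⟧ + ⟦ con w (v , u) ⟧))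
        ≡⟨ ∑-cong vs (λ u → ∑-distrib-+ vs _ _) ⟩
      (∑[ u ∈ vs ] ((∑[ v ∈ vs ] ⟦ con w (u , v) ⟧) + (∑[ v ∈ vs ] ⟦ con w (v , u) ⟧)))
        ≡⟨ ∑-distrib-+ vs _ _ ⟩
      (∑[ u ∈ vs ] ∑[ v ∈ vs ] ⟦ con w (u , v) ⟧) + (∑[ u ∈ vs ] ∑[ v ∈ vs ] ⟦ con w (v , u) ⟧)
        ≡⟨ cong₂ _+_ (sym whole) (trans (∑-swap vs vs _) (trans (sym whole) (sym (+-identityʳ _)))) ⟩
      2 * (∑[ e ∈ pairs ] ⟦ con w e ⟧) ∎
      where
      open ≤-Reasoning
      whole : ∑[ e ∈ pairs ] ⟦ con w e ⟧ ≡ ∑[ u ∈ vs ] ∑[ v ∈ vs ] ⟦ con w (u , v) ⟧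
      whole = ∑-cartesianProductWith _,_ vs vs (λ e → ⟦ con w e ⟧)
      split : ∀ u v → ⟦ adj u v ∧ mem w u ∧ mem w v ⟧ ≤ ⟦ con w (u , v) ⟧ + ⟦ con w (v , u) ⟧
      split u v with adj u v in a
      ... | false = z≤n
      ... | true rewrite trans (adj-sym v u) a | lt-total (adj⇒≢ a) | ∧-comm (mem w v) (mem w u)
          with lt v u
      ...   | true  = ≤-refl
      ...   | false = m≤m+n _ _

  -- A set of at most t vertices spanning E edges is oriented along a given
  -- linear order with probability 2^-E, and there are at most N^t orders.
  sparse-orientation : ∀ t E → N ^ t < 2 ^ E →
    ∃ λ b → ∀ w → length w ≡ t → Forward (arc b) w → e₂ w < 2 * E
  sparse-orientation t E N^t<2^E = b , sparse
    where
    heavy : List (List V)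
    heavy = filter (λ w → 2 * E ≤? e₂ w) (words t)

    heavy⇒ : ∀ {w} → w ∈ heavy → 2 * E ≤ e₂ w
    heavy⇒ w∈ = proj₂ (∈-filter⁻ (λ w → 2 * E ≤? e₂ w) {xs = words t} w∈)

    length-heavy : length heavy ≤ N ^ t
    length-heavy = ≤-trans (length-filter (λ w → 2 * E ≤? e₂ w) (words t))
      (≤-reflexive (length-words t))

    term : ∀ w → w ∈ heavy → 2 ^ E * (∏[ e ∈ pairs ] ∑ bools (f w e)) ≤ 2 ^ length pairs
    term w w∈ = ≤-trans
      (*-mono-≤ (^-monoʳ-≤ 2 (*-cancelˡ-≤ {E} {∑[ e ∈ pairs ] ⟦ con w e ⟧} 2 (≤-trans (heavy⇒ w∈) (e₂≤2con w)))) (∏-mono pairs (∑f≤ w)))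
      (≤-reflexive (∏-con w pairs))

    small : ∑[ w ∈ heavy ] ∏[ e ∈ pairs ] ∑ bools (f w e) < 2 ^ length pairs
    small = *-cancelˡ-< (2 ^ E) _ _ (begin-strict
      2 ^ E * (∑[ w ∈ heavy ] ∏[ e ∈ pairs ] ∑ bools (f w e)) ≡⟨ ∑-*ˡ heavy (2 ^ E) _ ⟨
      (∑[ w ∈ heavy ] (2 ^ E * (∏[ e ∈ pairs ] ∑ bools (f w e)))) ≤⟨ ∑≤length* heavy _ term ⟩
      length heavy * 2 ^ length pairs ≤⟨ *-monoˡ-≤ _ length-heavy ⟩
      N ^ t * 2 ^ length pairs <⟨ *-monoˡ-< (2 ^ length pairs) {{m^n≢0 2 (length pairs)}} N^t<2^E ⟩
      2 ^ E * 2 ^ length pairs ∎)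
      where open ≤-Reasoning

    good = union-bound (≡-dec _≟_ _≟_) bools (here refl) heavy f pairs (Uniq.cartesianProduct⁺ unique unique) small
    b = proj₁ good

    sparse : ∀ w → length w ≡ t → Forward (arc b) w → e₂ w < 2 * E
    sparse w len fwd with 2 * E ≤? e₂ w
    ... | no ¬p = ≰⇒> ¬p
    ... | yes p with proj₂ good {w} (∈-filter⁺ (λ w → 2 * E ≤? e₂ w) (∈-words len) p)
    ...   | e , z = let c , wr = ∧-split (con w e) (⟦not⟧≡0 z) in ⊥-elim (forward-not-wrong b w e fwd c wr)

  Sparse : ℕ → ℕ → (V → Bool) → Set
  Sparse t E U = ∀ w → length w ≡ t → All (λ x → U x ≡ true) w → e₂ w < 2 * E

  -- `e₂` sees only which vertices occur in `w`, so `w` may be replaced by its topological sort, to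
  -- which the bound on forward words applies.
  acyclic⇒sparse : ∀ {t E b U} → (∀ w → length w ≡ t → Forward (arc b) w → e₂ w < 2 * E) →
                   Acyclic (arc b) U → Sparse t E U
  acyclic⇒sparse {b = b} sparse acyc w len U∋ with topological-sort (arc b) acyc _ w refl U∋
  ... | w′ , w′↭w , fwd = subst (_< _) same (sparse w′ (trans (↭-length w′↭w) len) fwd)
    where
    mem≡ : ∀ v → mem w′ v ≡ mem w v
    mem≡ = mem-cong (∈-resp-↭ w′↭w) (∈-resp-↭ (↭-sym w′↭w))
    same : e₂ w′ ≡ e₂ w
    same = ∑-cong vs λ u → ∑-cong vs λ v → cong₂ (λ x y → ⟦ adj u v ∧ x ∧ y ⟧) (mem≡ u) (mem≡ v)

-- Supersaturation in products of complete graphs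

^-distribʳ-* : ∀ a b n → (a * b) ^ n ≡ a ^ n * b ^ n
^-distribʳ-* a b zero    = refl
^-distribʳ-* a b (suc n) = trans (cong (a * b *_) (^-distribʳ-* a b n)) (shuffle a b (a ^ n) (b ^ n))
  where
  shuffle : ∀ a b c d → a * b * (c * d) ≡ a * c * (b * d)
  shuffle = solve-∀

∑-pick : {A : Set} (_≟_ : DecidableEquality A) {as : List A} {a : A} → Unique as → a ∈ as →
         ∀ (h : A → ℕ) → ∑[ b ∈ as ] (⟦ does (a ≟ b) ⟧ * h b) ≡ h a
∑-pick _≟_ {b ∷ as} {a} (b∉ ∷ as!) (here refl) h rewrite dec-true (a ≟ a) refl =
  trans (cong₂ _+_ (*-identityˡ (h a)) (trans (others as b∉) (∑-zero as))) (+-identityʳ (h a))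
  where
  others : ∀ cs → All (a ≢_) cs → ∑[ c ∈ cs ] (⟦ does (a ≟ c) ⟧ * h c) ≡ ∑[ c ∈ cs ] 0
  others []       []           = refl
  others (c ∷ cs) (a≢c ∷ a∉) rewrite dec-false (a ≟ c) a≢c = others cs a∉
∑-pick _≟_ {b ∷ as} {a} (b∉ ∷ as!) (there a∈) h
  rewrite dec-false (a ≟ b) (λ eq → All.lookup b∉ a∈ (sym eq)) = ∑-pick _≟_ as! a∈ h

-- The expansion of `(a - b)²` with the mixed term moved across, which avoids truncated subtraction.
∣-∣²+2* : ∀ a b → ∣ a - b ∣ * ∣ a - b ∣ + 2 * (a * b) ≡ a * a + b * b
∣-∣²+2* zero    b       = +-identityʳ (b * b)
∣-∣²+2* (suc a) zero    = cong (suc a * suc a +_) (cong (2 *_) (*-zeroʳ a))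
∣-∣²+2* (suc a) (suc b) = trans (split ∣ a - b ∣ a b)
  (trans (cong (_+ 2 * (1 + a + b)) (∣-∣²+2* a b)) (merge a b))
  where
  split : ∀ d a b → d * d + 2 * (suc a * suc b) ≡ d * d + 2 * (a * b) + 2 * (1 + a + b)
  split = solve-∀
  merge : ∀ a b → a * a + b * b + 2 * (1 + a + b) ≡ suc a * suc a + suc b * suc b
  merge = solve-∀

∣-∣-+ : ∀ a b c d → ∣ a + c - b + d ∣ ≤ ∣ a - b ∣ + ∣ c - d ∣
∣-∣-+ a b c d = ≤-trans (∣-∣-triangle (a + c) (b + c) (b + d))
  (≤-reflexive (cong₂ _+_ (trans (cong₂ ∣_-_∣ (+-comm a c) (+-comm b c)) (∣m+n-m+o∣≡∣n-o∣ c a b))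
                          (∣m+n-m+o∣≡∣n-o∣ b c d)))

∑-∣-∣ : {A : Set} (as : List A) (f g : A → ℕ) → ∣ ∑ as f - ∑ as g ∣ ≤ ∑[ a ∈ as ] ∣ f a - g a ∣
∑-∣-∣ []       f g = z≤n
∑-∣-∣ (a ∷ as) f g = ≤-trans (∣-∣-+ (f a) (g a) (∑ as f) (∑ as g)) (+-monoʳ-≤ _ (∑-∣-∣ as f g))

2*≤²+² : ∀ a b → 2 * (a * b) ≤ a * a + b * b
2*≤²+² a b = ≤-trans (m≤n+m _ (∣ a - b ∣ * ∣ a - b ∣)) (≤-reflexive (∣-∣²+2* a b))

cauchy-schwarz : {A : Set} (as : List A) (f : A → ℕ) →
                 ∑ as f * ∑ as f ≤ length as * (∑[ a ∈ as ] (f a * f a))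
cauchy-schwarz []       f = z≤n
cauchy-schwarz (a ∷ as) f = begin
  (x + S) * (x + S)                                  ≡⟨ expand x S ⟩
  x * x + 2 * (x * S) + S * S                        ≤⟨ +-mono-≤ (+-monoʳ-≤ (x * x) cross) (cauchy-schwarz as f) ⟩
  x * x + (length as * (x * x) + S₂) + length as * S₂ ≡⟨ collect (x * x) (length as) S₂ ⟩
  suc (length as) * (x * x + S₂)                     ∎
  where
  open ≤-Reasoning
  x = f a
  S = ∑ as f
  S₂ = ∑[ a ∈ as ] (f a * f a)
  expand : ∀ x S → (x + S) * (x + S) ≡ x * x + 2 * (x * S) + S * S
  expand = solve-∀
  collect : ∀ q l s → q + (l * q + s) + l * s ≡ suc l * (q + s)
  collect = solve-∀
  cross : 2 * (x * S) ≤ length as * (x * x) + S₂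
  cross = begin
    2 * (x * S)                            ≡⟨ cong (2 *_) (∑-*ˡ as x f) ⟨
    2 * (∑[ b ∈ as ] (x * f b))            ≡⟨ ∑-*ˡ as 2 _ ⟨
    (∑[ b ∈ as ] (2 * (x * f b)))          ≤⟨ ∑-mono as (λ b → 2*≤²+² x (f b)) ⟩
    (∑[ b ∈ as ] (x * x + f b * f b))      ≡⟨ ∑-distrib-+ as _ _ ⟩
    (∑[ b ∈ as ] (x * x)) + S₂             ≡⟨ cong (_+ S₂) (∑-const as (x * x)) ⟩
    length as * (x * x) + S₂               ∎

module ProductGraph {A : Set} (_≟_ : DecidableEquality A) (as : List A)
                    (complete : ∀ a → a ∈ as) (unique : Unique as)
                    (r : ℕ) (length≡ : length as ≡ suc r) where

  -- The empty product is a single vertex with a loop, the unit of the direct product. This starts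
  -- the inductions on `k`; loops are absent only from dimension 1 on.
  adj : ∀ {k} → Vec A k → Vec A k → Bool
  adj []      []      = true
  adj (a ∷ u) (b ∷ v) = not (does (a ≟ b)) ∧ adj u v

  does-sym : ∀ a b → does (a ≟ b) ≡ does (b ≟ a)
  does-sym a b with a ≟ b
  ... | yes p = sym (dec-true (b ≟ a) (sym p))
  ... | no ¬p = sym (dec-false (b ≟ a) (¬p ∘ sym))

  adj-sym : ∀ {k} (u v : Vec A k) → adj u v ≡ adj v u
  adj-sym []      []      = refl
  adj-sym (a ∷ u) (b ∷ v) = cong₂ (λ x y → not x ∧ y) (does-sym a b) (adj-sym u v)

  adj-irr : ∀ {k} (v : Vec A (suc k)) → adj v v ≡ false
  adj-irr (a ∷ v) rewrite dec-true (a ≟ a) refl = refl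

  vertices : ∀ k → List (Vec A k)
  vertices = vecs as

  vertices-complete : ∀ {k} (v : Vec A k) → v ∈ vertices k
  vertices-complete v = ∈-vecs (all v)
    where
    all : ∀ {k} (v : Vec A k) → VAll.All (_∈ as) v
    all []      = VAll.[]
    all (a ∷ v) = complete a VAll.∷ all v

  vertices-unique : ∀ k → Unique (vertices k)
  vertices-unique = vecs-unique unique

  form : ∀ {k} → (Vec A k → ℕ) → (Vec A k → ℕ) → ℕ
  form {k} f g = ∑[ u ∈ vertices k ] ∑[ v ∈ vertices k ] (⟦ adj u v ⟧ * (f u * g v))

  -- The Dirichlet form, with each edge counted in both directions. By regularity it is twice
  -- `r ^ k * normSq f - form f f`, a quantity that is thereby visibly nonnegative.
  energy : ∀ {k} → (Vec A k → ℕ) → ℕ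
  energy {k} f = ∑[ u ∈ vertices k ] ∑[ v ∈ vertices k ] (⟦ adj u v ⟧ * (∣ f u - f v ∣ * ∣ f u - f v ∣))

  normSq : ∀ {k} → (Vec A k → ℕ) → ℕ
  normSq {k} f = ∑[ v ∈ vertices k ] (f v * f v)

  slice : ∀ {k} → (Vec A (suc k) → ℕ) → A → Vec A k → ℕ
  slice f a v = f (a ∷ v)

  marginal : ∀ {k} → (Vec A (suc k) → ℕ) → Vec A k → ℕ
  marginal f v = ∑[ a ∈ as ] f (a ∷ v)

  ∑-off-diagonal : ∀ a h → (∑[ b ∈ as ] (⟦ not (does (a ≟ b)) ⟧ * h b)) + h a ≡ ∑ as h
  ∑-off-diagonal a h = begin
    (∑[ b ∈ as ] (⟦ not (does (a ≟ b)) ⟧ * h b)) + h a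
      ≡⟨ cong ((∑[ b ∈ as ] (⟦ not (does (a ≟ b)) ⟧ * h b)) +_) (∑-pick _≟_ unique (complete a) h) ⟨
    (∑[ b ∈ as ] (⟦ not (does (a ≟ b)) ⟧ * h b)) + (∑[ b ∈ as ] (⟦ does (a ≟ b) ⟧ * h b))
      ≡⟨ ∑-distrib-+ as _ _ ⟨
    (∑[ b ∈ as ] (⟦ not (does (a ≟ b)) ⟧ * h b + ⟦ does (a ≟ b) ⟧ * h b))
      ≡⟨ ∑-cong as (λ b → trans (sym (*-distribʳ-+ (h b) ⟦ not (does (a ≟ b)) ⟧ _))
           (trans (cong (_* h b) (trans (+-comm ⟦ not (does (a ≟ b)) ⟧ _) (⟦not⟧ (does (a ≟ b))))) (*-identityˡ (h b)))) ⟩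
    ∑ as h ∎
    where open ≡-Reasoning

  degree : ∀ {k} (u : Vec A k) → ∑[ v ∈ vertices k ] ⟦ adj u v ⟧ ≡ r ^ k
  degree []              = refl
  degree {suc k} (a ∷ u) = begin
    ∑ (vertices (suc k)) (λ v → ⟦ adj (a ∷ u) v ⟧)
      ≡⟨ ∑-vecs as k _ ⟩
    (∑[ b ∈ as ] ∑[ v ∈ vertices k ] ⟦ not (does (a ≟ b)) ∧ adj u v ⟧)
      ≡⟨ ∑-cong as (λ b → trans (∑-cong (vertices k) (λ v → ⟦⟧-∧ (not (does (a ≟ b))) (adj u v)))
           (trans (∑-*ˡ (vertices k) ⟦ not (does (a ≟ b)) ⟧ _) (cong (⟦ not (does (a ≟ b)) ⟧ *_) (degree u)))) ⟩
    (∑[ b ∈ as ] (⟦ not (does (a ≟ b)) ⟧ * r ^ k))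
      ≡⟨ +-cancelʳ-≡ (r ^ k) _ _ (trans (∑-off-diagonal a (λ _ → r ^ k))
           (trans (∑-const as (r ^ k)) (trans (cong (_* r ^ k) length≡) (+-comm (r ^ k) _)))) ⟩
    r * r ^ k ∎
    where open ≡-Reasoning

  energy+2form : ∀ {k} (f : Vec A k → ℕ) → energy f + 2 * form f f ≡ 2 * (r ^ k * normSq f)
  energy+2form {k} f = begin
    energy f + 2 * form f f
      ≡⟨ cong (energy f +_) (trans (sym (∑-*ˡ vs 2 _)) (∑-cong vs (λ u → sym (∑-*ˡ vs 2 _)))) ⟩
    energy f + (∑[ u ∈ vs ] ∑[ v ∈ vs ] (2 * (⟦ adj u v ⟧ * (f u * f v))))
      ≡⟨ trans (sym (∑-distrib-+ vs _ _)) (∑-cong vs (λ u → sym (∑-distrib-+ vs _ _))) ⟩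
    (∑[ u ∈ vs ] ∑[ v ∈ vs ] (⟦ adj u v ⟧ * (∣ f u - f v ∣ * ∣ f u - f v ∣) + 2 * (⟦ adj u v ⟧ * (f u * f v))))
      ≡⟨ ∑-cong vs (λ u → ∑-cong vs (λ v → trans (regroup ⟦ adj u v ⟧ (∣ f u - f v ∣ * ∣ f u - f v ∣) (f u * f v))
           (trans (cong (⟦ adj u v ⟧ *_) (∣-∣²+2* (f u) (f v))) (*-distribˡ-+ ⟦ adj u v ⟧ _ _)))) ⟩
    (∑[ u ∈ vs ] ∑[ v ∈ vs ] (⟦ adj u v ⟧ * (f u * f u) + ⟦ adj u v ⟧ * (f v * f v)))
      ≡⟨ trans (∑-cong vs (λ u → ∑-distrib-+ vs _ _)) (∑-distrib-+ vs _ _) ⟩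
    (∑[ u ∈ vs ] ∑[ v ∈ vs ] (⟦ adj u v ⟧ * (f u * f u))) + (∑[ u ∈ vs ] ∑[ v ∈ vs ] (⟦ adj u v ⟧ * (f v * f v)))
      ≡⟨ cong₂ _+_ outer (trans (∑-swap vs vs _)
           (trans (∑-cong vs (λ v → ∑-cong vs (λ u → cong (λ z → ⟦ z ⟧ * (f v * f v)) (adj-sym u v)))) outer)) ⟩
    r ^ k * normSq f + r ^ k * normSq f
      ≡⟨ cong (r ^ k * normSq f +_) (+-identityʳ _) ⟨
    2 * (r ^ k * normSq f) ∎
    where
    open ≡-Reasoning
    vs = vertices k
    regroup : ∀ a d p → a * d + 2 * (a * p) ≡ a * (d + 2 * p)
    regroup = solve-∀
    outer : ∑[ u ∈ vs ] ∑[ v ∈ vs ] (⟦ adj u v ⟧ * (f u * f u)) ≡ r ^ k * normSq f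
    outer = trans (∑-cong vs (λ u → trans (∑-*ʳ vs (f u * f u) _) (cong (_* (f u * f u)) (degree u))))
                  (∑-*ˡ vs (r ^ k) _)

  form-marginal : ∀ {k} (f : Vec A (suc k) → ℕ) →
    form (marginal f) (marginal f) ≡ ∑[ a ∈ as ] ∑[ b ∈ as ] form (slice f a) (slice f b)
  form-marginal {k} f = begin
    (∑[ u ∈ vs ] ∑[ v ∈ vs ] (⟦ adj u v ⟧ * (marginal f u * marginal f v)))
      ≡⟨ ∑-cong vs (λ u → ∑-cong vs (λ v → expand u v)) ⟩
    (∑[ u ∈ vs ] ∑[ v ∈ vs ] ∑[ a ∈ as ] ∑[ b ∈ as ] t a b u v)
      ≡⟨ ∑-cong vs (λ u → ∑-swap vs as (λ v a → ∑[ b ∈ as ] t a b u v)) ⟩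
    (∑[ u ∈ vs ] ∑[ a ∈ as ] ∑[ v ∈ vs ] ∑[ b ∈ as ] t a b u v)
      ≡⟨ ∑-swap vs as (λ u a → ∑[ v ∈ vs ] ∑[ b ∈ as ] t a b u v) ⟩
    (∑[ a ∈ as ] ∑[ u ∈ vs ] ∑[ v ∈ vs ] ∑[ b ∈ as ] t a b u v)
      ≡⟨ ∑-cong as (λ a → trans (∑-cong vs (λ u → ∑-swap vs as (λ v b → t a b u v)))
           (∑-swap vs as (λ u b → ∑[ v ∈ vs ] t a b u v))) ⟩
    (∑[ a ∈ as ] ∑[ b ∈ as ] form (slice f a) (slice f b)) ∎
    where
    open ≡-Reasoning
    vs = vertices k
    t : A → A → Vec A k → Vec A k → ℕ
    t a b u v = ⟦ adj u v ⟧ * (f (a ∷ u) * f (b ∷ v))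
    expand : ∀ u v → ⟦ adj u v ⟧ * (marginal f u * marginal f v) ≡ ∑[ a ∈ as ] ∑[ b ∈ as ] t a b u v
    expand u v = trans (cong (⟦ adj u v ⟧ *_) (trans (sym (∑-*ʳ as (marginal f v) _))
        (∑-cong as (λ a → sym (∑-*ˡ as (f (a ∷ u)) _)))))
      (trans (sym (∑-*ˡ as ⟦ adj u v ⟧ _)) (∑-cong as (λ a → sym (∑-*ˡ as ⟦ adj u v ⟧ _))))

  form-suc : ∀ {k} (f : Vec A (suc k) → ℕ) →
    form f f ≡ ∑[ a ∈ as ] ∑[ b ∈ as ] (⟦ not (does (a ≟ b)) ⟧ * form (slice f a) (slice f b))
  form-suc {k} f = begin
    form f f
      ≡⟨ trans (∑-vecs as k _) (∑-cong as (λ a → ∑-cong vs (λ u → ∑-vecs as k _))) ⟩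
    (∑[ a ∈ as ] ∑[ u ∈ vs ] ∑[ b ∈ as ] ∑[ v ∈ vs ] (⟦ not (does (a ≟ b)) ∧ adj u v ⟧ * (f (a ∷ u) * f (b ∷ v))))
      ≡⟨ ∑-cong as (λ a → ∑-swap vs as _) ⟩
    (∑[ a ∈ as ] ∑[ b ∈ as ] ∑[ u ∈ vs ] ∑[ v ∈ vs ] (⟦ not (does (a ≟ b)) ∧ adj u v ⟧ * (f (a ∷ u) * f (b ∷ v))))
      ≡⟨ ∑-cong as (λ a → ∑-cong as (λ b → factor a b)) ⟩
    (∑[ a ∈ as ] ∑[ b ∈ as ] (⟦ not (does (a ≟ b)) ⟧ * form (slice f a) (slice f b))) ∎
    where
    open ≡-Reasoning
    vs = vertices k
    factor : ∀ a b → ∑[ u ∈ vs ] ∑[ v ∈ vs ] (⟦ not (does (a ≟ b)) ∧ adj u v ⟧ * (f (a ∷ u) * f (b ∷ v)))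
                   ≡ ⟦ not (does (a ≟ b)) ⟧ * form (slice f a) (slice f b)
    factor a b = trans (∑-cong vs (λ u → trans (∑-cong vs (λ v →
        trans (cong (_* (f (a ∷ u) * f (b ∷ v))) (⟦⟧-∧ (not (does (a ≟ b))) (adj u v)))
              (*-assoc ⟦ not (does (a ≟ b)) ⟧ _ _)))
        (∑-*ˡ vs ⟦ not (does (a ≟ b)) ⟧ _)))
      (∑-*ˡ vs ⟦ not (does (a ≟ b)) ⟧ _)

  -- The adjacency matrix of the product is `(J - I) ⊗ A`, with `J` the all-ones matrix. The `J`
  -- part sees only the marginal of `f`, and the `I` part is the sum over the slices.
  form+diagonal : ∀ {k} (f : Vec A (suc k) → ℕ) →
    form f f + (∑[ a ∈ as ] form (slice f a) (slice f a)) ≡ form (marginal f) (marginal f)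
  form+diagonal f = trans (cong (_+ (∑[ a ∈ as ] form (slice f a) (slice f a))) (form-suc f))
    (trans (sym (∑-distrib-+ as _ _))
      (trans (∑-cong as (λ a → ∑-off-diagonal a (λ b → form (slice f a) (slice f b))))
             (sym (form-marginal f))))

  energy-marginal : ∀ {k} (f : Vec A (suc k) → ℕ) →
    energy (marginal f) ≤ suc r * (∑[ a ∈ as ] energy (slice f a))
  energy-marginal {k} f = begin
    energy (marginal f)
      ≤⟨ ∑-mono vs (λ u → ∑-mono vs (λ v → *-monoʳ-≤ ⟦ adj u v ⟧ (bound u v))) ⟩
    (∑[ u ∈ vs ] ∑[ v ∈ vs ] (⟦ adj u v ⟧ * (suc r * (∑[ a ∈ as ] d a u v))))
      ≡⟨ ∑-cong vs (λ u → trans (∑-cong vs (λ v → trans (shuffle ⟦ adj u v ⟧ (suc r) _)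
           (cong (suc r *_) (sym (∑-*ˡ as ⟦ adj u v ⟧ _))))) (∑-*ˡ vs (suc r) _)) ⟩
    (∑[ u ∈ vs ] (suc r * (∑[ v ∈ vs ] ∑[ a ∈ as ] (⟦ adj u v ⟧ * d a u v))))
      ≡⟨ ∑-*ˡ vs (suc r) _ ⟩
    suc r * (∑[ u ∈ vs ] ∑[ v ∈ vs ] ∑[ a ∈ as ] (⟦ adj u v ⟧ * d a u v))
      ≡⟨ cong (suc r *_) (trans (∑-cong vs (λ u → ∑-swap vs as _)) (∑-swap vs as _)) ⟩
    suc r * (∑[ a ∈ as ] energy (slice f a)) ∎
    where
    open ≤-Reasoning
    vs = vertices k
    d : A → Vec A k → Vec A k → ℕ
    d a u v = ∣ f (a ∷ u) - f (a ∷ v) ∣ * ∣ f (a ∷ u) - f (a ∷ v) ∣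
    shuffle : ∀ x y z → x * (y * z) ≡ y * (x * z)
    shuffle = solve-∀
    bound : ∀ u v → ∣ marginal f u - marginal f v ∣ * ∣ marginal f u - marginal f v ∣ ≤ suc r * (∑[ a ∈ as ] d a u v)
    bound u v = ≤-trans (*-mono-≤ tri tri)
      (≤-trans (cauchy-schwarz as (λ a → ∣ f (a ∷ u) - f (a ∷ v) ∣)) (*-monoˡ-≤ _ (≤-reflexive length≡)))
      where
      tri = ∑-∣-∣ as (λ a → f (a ∷ u)) (λ a → f (a ∷ v))

  normSq-suc : ∀ {k} (f : Vec A (suc k) → ℕ) → normSq f ≡ ∑[ a ∈ as ] normSq (slice f a)
  normSq-suc f = ∑-vecs as _ _

  -- Hoffman's bound: form f f + r^j |f|² is positive semidefinite because the least
  -- eigenvalue of the graph is -r^j; passing to the marginal keeps track of the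
  -- component of f along the constants.
  hoffman : ∀ {j} (f : Vec A (suc j) → ℕ) →
    r ^ j * (∑ (vertices (suc j)) f * ∑ (vertices (suc j)) f) ≤ suc r ^ j * (form f f + r ^ j * normSq f)
  hoffman {zero} f = ≤-reflexive (cong (1 *_) (sym (begin
    form f f + 1 * normSq f
      ≡⟨ cong (form f f +_) (trans (*-identityˡ _) (trans (normSq-suc f) (∑-cong as (λ a → point (f (a ∷ []) * f (a ∷ [])))))) ⟩
    form f f + (∑[ a ∈ as ] form (slice f a) (slice f a))
      ≡⟨ form+diagonal f ⟩
    form (marginal f) (marginal f)
      ≡⟨ trans (+-identityʳ _) (trans (+-identityʳ _) (+-identityʳ _)) ⟩
    marginal f [] * marginal f []
      ≡⟨ cong₂ _*_ total total ⟨
    ∑ (vertices 1) f * ∑ (vertices 1) f ∎)))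
    where
    open ≡-Reasoning
    point : ∀ x → x + 0 ≡ x + 0 + 0 + 0
    point = solve-∀
    total : ∑ (vertices 1) f ≡ marginal f []
    total = trans (∑-vecs as 0 f) (∑-cong as (λ a → +-identityʳ _))
  hoffman {suc j} f = *-cancelˡ-≤ 2 (begin
    2 * (r * r ^ j * (S * S))
      ≡⟨ e₁ r (r ^ j) (S * S) ⟩
    2 * r * (r ^ j * (S * S))
      ≤⟨ *-monoʳ-≤ (2 * r) (subst (λ z → r ^ j * (z * z) ≤ suc r ^ j * (form F F + r ^ j * normSq F)) (sym total) (hoffman F)) ⟩
    2 * r * (suc r ^ j * (form F F + r ^ j * normSq F))
      ≡⟨ e₂ r (suc r ^ j) (form F F) (r ^ j) (normSq F) ⟩
    suc r ^ j * (2 * (r * form F F) + 2 * (r * r ^ j * normSq F))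
      -- After `form f f` is rewritten by `form+diagonal`, what remains to be shown is that
      -- `r ^ suc j * normSq F - form F F` is at most `suc r` times the sum of the same quantity
      -- over the slices. Doubled, this is `energy-marginal`, so the norm is traded for the energy.
      ≡⟨ cong (λ z → suc r ^ j * (2 * (r * form F F) + z)) (energy+2form F) ⟨
    suc r ^ j * (2 * (r * form F F) + (energy F + 2 * form F F))
      ≤⟨ *-monoʳ-≤ (suc r ^ j) (+-monoʳ-≤ (2 * (r * form F F)) (+-monoˡ-≤ (2 * form F F) (energy-marginal f))) ⟩
    suc r ^ j * (2 * (r * form F F) + (suc r * ΣE + 2 * form F F))
      ≡⟨ e₃ (suc r ^ j) r (form F F) ΣE ⟩
    suc r * suc r ^ j * (ΣE + 2 * form F F)
      ≡⟨ cong (λ z → suc r * suc r ^ j * (ΣE + 2 * z)) (form+diagonal f) ⟨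
    suc r * suc r ^ j * (ΣE + 2 * (form f f + ΣQ))
      ≡⟨ e₄ (suc r * suc r ^ j) ΣE (form f f) ΣQ ⟩
    suc r * suc r ^ j * (2 * form f f + (ΣE + 2 * ΣQ))
      ≡⟨ cong (λ z → suc r * suc r ^ j * (2 * form f f + z)) slices ⟩
    suc r * suc r ^ j * (2 * form f f + 2 * (r * r ^ j * normSq f))
      ≡⟨ e₅ (suc r * suc r ^ j) (form f f) (r * r ^ j * normSq f) ⟩
    2 * (suc r * suc r ^ j * (form f f + r * r ^ j * normSq f)) ∎)
    where
    open ≤-Reasoning
    S = ∑ (vertices (suc (suc j))) f
    F = marginal f
    ΣE = ∑[ a ∈ as ] energy (slice f a)
    ΣQ = ∑[ a ∈ as ] form (slice f a) (slice f a)
    total : S ≡ ∑ (vertices (suc j)) F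
    total = trans (∑-vecs as (suc j) f) (∑-swap as (vertices (suc j)) _)
    slices : ΣE + 2 * ΣQ ≡ 2 * (r * r ^ j * normSq f)
    slices = trans (cong (ΣE +_) (sym (∑-*ˡ as 2 _))) (trans (sym (∑-distrib-+ as _ _))
      (trans (∑-cong as (λ a → energy+2form (slice f a))) (trans (∑-*ˡ as 2 _)
        (cong (2 *_) (trans (∑-*ˡ as (r * r ^ j) _) (cong (r * r ^ j *_) (sym (normSq-suc f))))))))
    e₁ : ∀ r p x → 2 * (r * p * x) ≡ 2 * r * (p * x)
    e₁ = solve-∀
    e₂ : ∀ r s q p n → 2 * r * (s * (q + p * n)) ≡ s * (2 * (r * q) + 2 * (r * p * n))
    e₂ = solve-∀
    e₃ : ∀ s r q e → s * (2 * (r * q) + ((1 + r) * e + 2 * q)) ≡ (1 + r) * s * (e + 2 * q)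
    e₃ = solve-∀
    e₄ : ∀ s e q d → s * (e + 2 * (q + d)) ≡ s * (2 * q + (e + 2 * d))
    e₄ = solve-∀
    e₅ : ∀ s q n → s * (2 * q + 2 * n) ≡ 2 * (s * (q + n))
    e₅ = solve-∀

  -- Hoffman's bound for an indicator of size `n` reads `r^j n² ≤ s^j (Q + r^j n)` with `s = suc r`.
  -- For `n ≥ 2s^j` the last term is at most half of the left side, and `s ≤ 2r` replaces `(s/r)^j`
  -- by `2^j`.
  supersaturation : suc r ≤ 2 * r → ∀ {j} (S : Vec A (suc j) → Bool) →
    2 * suc r ^ j ≤ ∑[ v ∈ vertices (suc j) ] ⟦ S v ⟧ →
    (∑[ v ∈ vertices (suc j) ] ⟦ S v ⟧) * (∑[ v ∈ vertices (suc j) ] ⟦ S v ⟧) ≤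
    2 ^ suc j * form (λ v → ⟦ S v ⟧) (λ v → ⟦ S v ⟧)
  supersaturation s≤2r {j} S big = *-cancelˡ-≤ (r ^ j) {{m^n≢0 r j {{r≢0}}}} (+-cancelʳ-≤ (r ^ j * (n * n)) _ _ (begin
    r ^ j * (n * n) + r ^ j * (n * n)
      ≤⟨ +-mono-≤ (hoffman (λ v → ⟦ S v ⟧)) (hoffman (λ v → ⟦ S v ⟧)) ⟩
    suc r ^ j * (Q + r ^ j * normSq ⟦S⟧) + suc r ^ j * (Q + r ^ j * normSq ⟦S⟧)
      ≡⟨ cong (λ x → suc r ^ j * (Q + r ^ j * x) + suc r ^ j * (Q + r ^ j * x)) norm ⟩
    suc r ^ j * (Q + r ^ j * n) + suc r ^ j * (Q + r ^ j * n)
      ≡⟨ regroup (suc r ^ j) Q (r ^ j) n ⟩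
    2 * suc r ^ j * Q + r ^ j * (2 * suc r ^ j * n)
      ≤⟨ +-mono-≤ (*-monoˡ-≤ Q (*-monoʳ-≤ 2 (^-monoˡ-≤ j s≤2r))) (*-monoʳ-≤ (r ^ j) (*-monoˡ-≤ n big)) ⟩
    2 * (2 * r) ^ j * Q + r ^ j * (n * n)
      ≡⟨ cong (λ x → 2 * x * Q + r ^ j * (n * n)) (^-distribʳ-* 2 r j) ⟩
    2 * (2 ^ j * r ^ j) * Q + r ^ j * (n * n)
      ≡⟨ cong (_+ r ^ j * (n * n)) (regroup′ (2 ^ j) (r ^ j) Q) ⟩
    r ^ j * (2 * 2 ^ j * Q) + r ^ j * (n * n) ∎))
    where
    open ≤-Reasoning
    ⟦S⟧ : Vec A (suc j) → ℕ
    ⟦S⟧ v = ⟦ S v ⟧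
    n = ∑[ v ∈ vertices (suc j) ] ⟦ S v ⟧
    Q = form ⟦S⟧ ⟦S⟧
    r≢0 : NonZero r
    r≢0 = ≢-nonZero λ { refl → n≮0 s≤2r }
    square : ∀ b → ⟦ b ⟧ * ⟦ b ⟧ ≡ ⟦ b ⟧
    square true  = refl
    square false = refl
    norm : normSq ⟦S⟧ ≡ n
    norm = ∑-cong (vertices (suc j)) (λ v → square (S v))
    regroup : ∀ s q p n → s * (q + p * n) + s * (q + p * n) ≡ 2 * s * q + p * (2 * s * n)
    regroup = solve-∀
    regroup′ : ∀ a b q → 2 * (a * b) * q ≡ b * (2 * a * q)
    regroup′ = solve-∀

-- Containers

module Elements {V : Set} (_≟_ : DecidableEquality V) (vs : List V)
                (complete : ∀ v → v ∈ vs) (unique : Unique vs) where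

  open Finite _≟_ vs complete unique

  elements : (V → Bool) → List V
  elements S = filter (λ v → S v Boolₚ.≟ true) vs

  elements⁻ : ∀ S → All (λ v → S v ≡ true) (elements S)
  elements⁻ S = Allₚ.all-filter (λ v → S v Boolₚ.≟ true) vs

  elements⁺ : ∀ S {v} → S v ≡ true → v ∈ elements S
  elements⁺ S h = ∈-filter⁺ (λ v → S v Boolₚ.≟ true) (complete _) h

  elements-unique : ∀ S → Unique (elements S)
  elements-unique S = Uniq.filter⁺ (λ v → S v Boolₚ.≟ true) unique

  length-elements : ∀ S → length (elements S) ≡ # S
  length-elements S = go vs
    where
    go : ∀ us → length (filter (λ v → S v Boolₚ.≟ true) us) ≡ ∑[ v ∈ us ] ⟦ S v ⟧
    go []       = refl
    go (u ∷ us) with S u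
    ... | true  = cong suc (go us)
    ... | false = go us

  ∑-elements≤ : ∀ {w ys : List V} → Unique ys → All (_∈ w) ys → ∀ (h : V → ℕ) →
                ∑ ys h ≤ ∑[ v ∈ vs ] (⟦ mem w v ⟧ * h v)
  ∑-elements≤ {w} {ys} ys! ys⊆ h = ≤-trans (go ys ys!)
    (∑-mono vs (λ v → *-monoˡ-≤ (h v) (mono v)))
    where
    mono : ∀ v → ⟦ mem ys v ⟧ ≤ ⟦ mem w v ⟧
    mono v with mem ys v in eq
    ... | false = z≤n
    ... | true rewrite ∈⇒mem {w} {v} (All.lookup ys⊆ (mem⇒∈ ys eq)) = ≤-refl
    go : ∀ ys → Unique ys → ∑ ys h ≤ ∑[ v ∈ vs ] (⟦ mem ys v ⟧ * h v)
    go []       _           = z≤n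
    go (y ∷ ys) (y∉ ∷ ys!) = begin
      h y + ∑ ys h
        ≤⟨ +-mono-≤ (≤-reflexive (sym (∑-pick _≟_ unique (complete y) h))) (go ys ys!) ⟩
      (∑[ v ∈ vs ] (⟦ does (y ≟ v) ⟧ * h v)) + (∑[ v ∈ vs ] (⟦ mem ys v ⟧ * h v))
        ≡⟨ ∑-distrib-+ vs _ _ ⟨
      (∑[ v ∈ vs ] (⟦ does (y ≟ v) ⟧ * h v + ⟦ mem ys v ⟧ * h v))
        ≤⟨ ∑-mono vs (λ v → ≤-trans (≤-reflexive (sym (*-distribʳ-+ (h v) ⟦ does (y ≟ v) ⟧ _)))
             (*-monoˡ-≤ (h v) (disjoint v))) ⟩
      (∑[ v ∈ vs ] (⟦ mem (y ∷ ys) v ⟧ * h v)) ∎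
      where
      open ≤-Reasoning
      disjoint : ∀ v → ⟦ does (y ≟ v) ⟧ + ⟦ mem ys v ⟧ ≤ ⟦ mem (y ∷ ys) v ⟧
      disjoint v with y ≟ v
      ... | yes refl rewrite ∈⇒mem {y ∷ ys} {y} (here refl)
                           | dec-false (y ∈? ys) (λ y∈ → All.lookup y∉ y∈ refl) = ≤-refl
      ... | no _ with mem ys v in eq
      ...   | false = z≤n
      ...   | true rewrite ∨-zeroʳ (does (v ≟ y)) = ≤-refl

  #mem≤length : ∀ w → # (mem w) ≤ length w
  #mem≤length []      = ≤-reflexive (∑-zero vs)
  #mem≤length (x ∷ w) = begin
    # (mem (x ∷ w))
      ≤⟨ ∑-mono vs split ⟩
    (∑[ v ∈ vs ] (⟦ does (x ≟ v) ⟧ * 1 + ⟦ mem w v ⟧))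
      ≡⟨ ∑-distrib-+ vs _ _ ⟩
    (∑[ v ∈ vs ] (⟦ does (x ≟ v) ⟧ * 1)) + # (mem w)
      ≤⟨ +-mono-≤ (≤-reflexive (∑-pick _≟_ unique (complete x) (λ _ → 1))) (#mem≤length w) ⟩
    suc (length w) ∎
    where
    open ≤-Reasoning
    split : ∀ v → ⟦ mem (x ∷ w) v ⟧ ≤ ⟦ does (x ≟ v) ⟧ * 1 + ⟦ mem w v ⟧
    split v with mem (x ∷ w) v in eq
    ... | false = z≤n
    ... | true with mem⇒∈ (x ∷ w) eq
    ...   | here refl rewrite dec-true (v ≟ v) refl = s≤s z≤n
    ...   | there v∈  rewrite ∈⇒mem {w} {v} v∈ = m≤n+m 1 _

  pick-elements : ∀ S y → y ≤ # S → ∃ λ w → length w ≡ y × Unique w × All (λ v → S v ≡ true) w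
  pick-elements S y y≤ = take y (elements S)
    , trans (length-take y (elements S)) (m≤n⇒m⊓n≡m (≤-trans y≤ (≤-reflexive (sym (length-elements S)))))
    , Uniq.take⁺ y (elements-unique S)
    , Allₚ.take⁺ y (elements⁻ S)

  -- The word is padded with copies of `v₀` to have length exactly `y`, the only length that is
  -- enumerated.
  cover-elements : V → ∀ S y → # S ≤ y → ∃ λ w → length w ≡ y × (∀ {v} → S v ≡ true → mem w v ≡ true)
  cover-elements v₀ S y S≤ = elements S ++ replicate (y ∸ # S) v₀
    , trans (length-++ (elements S)) (trans (cong₂ _+_ (length-elements S) (length-replicate (y ∸ # S))) (m+[n∸m]≡n S≤))
    , λ h → ∈⇒mem (∈-++⁺ˡ (elements⁺ S h))

-- A round deletes at least a fraction `1/(4Λ)` of the current set, so the set shrinks by the factor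
-- `z / suc z`; writing `4 * Λ` as `suc z` keeps this free of subtraction. `v₀` is only a padding
-- value.
module Containers {V : Set} (_≟_ : DecidableEquality V) (vs : List V)
                  (complete : ∀ v → v ∈ vs) (unique : Unique vs) (v₀ : V)
                  (adj : V → V → Bool) (adj-sym : ∀ u v → adj u v ≡ adj v u) (adj-irr : ∀ v → adj v v ≡ false)
                  (lt : V → V → Bool) (lt-total : ∀ {u v} → u ≢ v → lt u v ≡ not (lt v u))
                  (Λ R : ℕ)
                  (supersaturated : ∀ S → R ≤ Finite.# _≟_ vs complete unique S →
                     Finite.# _≟_ vs complete unique S * Finite.# _≟_ vs complete unique S ≤
                     Λ * (∑[ u ∈ vs ] ∑[ v ∈ vs ] (⟦ adj u v ⟧ * (⟦ S u ⟧ * ⟦ S v ⟧))))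
                  (y E : ℕ) (0<y : 0 < y) (y-large : 8 * (Λ * E) ≤ y * y)
                  (z : ℕ) (4Λ≡ : 4 * Λ ≡ suc z) where

  open Finite _≟_ vs complete unique
  open Elements _≟_ vs complete unique
  open Orient _≟_ vs complete unique adj adj-sym adj-irr lt lt-total

  _⊆_ : (V → Bool) → (V → Bool) → Set
  S ⊆ T = ∀ {v} → S v ≡ true → T v ≡ true

  deg : (V → Bool) → V → ℕ
  deg S v = ∑[ u ∈ vs ] (⟦ adj v u ⟧ * ⟦ S u ⟧)

  deg-list : List V → V → ℕ
  deg-list Y v = ∑[ u ∈ Y ] ⟦ adj u v ⟧

  high : (V → Bool) → V → Bool
  high S v = S v ∧ does (# S ≤? 2 * Λ * deg S v)

  joined : (V → Bool) → List V → V → Bool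
  joined S Y v = S v ∧ does (y ≤? 4 * Λ * deg-list Y v)

  _∖_ : (V → Bool) → (V → Bool) → V → Bool
  (S ∖ X) v = S v ∧ not (X v)

  private
    double-≤ : ∀ {a b c} → a + a ≤ b + a → b ≤ c → a ≤ c
    double-≤ {a} {b} h b≤c = ≤-trans (+-cancelʳ-≤ a a b h) b≤c

    -- Averaging, one summand at a time: an element below the threshold contributes less than `s`,
    -- any other at most `s * c`. Summed over the vertices it bounds from below the number of
    -- elements above the threshold, for both `high` and `joined`.
    threshold : ∀ c s d b → d ≤ s → c * (⟦ b ⟧ * d) ≤ s * c * ⟦ b ∧ does (s ≤? c * d) ⟧ + s * ⟦ b ⟧
    threshold c s d false d≤s = ≤-trans (≤-reflexive (*-zeroʳ c)) z≤n
    threshold c s d true  d≤s with s ≤ᵇ c * d in eq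
    ... | true  = ≤-trans (*-monoʳ-≤ c (≤-trans (≤-reflexive (*-identityˡ d)) d≤s))
                    (≤-trans (≤-reflexive (trans (*-comm c s) (sym (*-identityʳ _)))) (m≤m+n _ _))
    ... | false = ≤-trans (≤-reflexive (cong (c *_) (*-identityˡ d)))
                    (≤-trans (<⇒≤ (≰⇒> λ s≤ → subst T eq (≤⇒≤ᵇ s≤)))
                      (≤-trans (≤-reflexive (sym (*-identityʳ s))) (m≤n+m _ _)))

    #-*ˡ : ∀ c S → ∑[ v ∈ vs ] (c * ⟦ S v ⟧) ≡ c * # S
    #-*ˡ c S = ∑-*ˡ vs c _

    #high : ∀ S → 0 < # S → # S * # S ≤ Λ * (∑[ u ∈ vs ] ∑[ v ∈ vs ] (⟦ adj u v ⟧ * (⟦ S u ⟧ * ⟦ S v ⟧))) →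
            # S ≤ 2 * Λ * # (high S)
    #high S S>0 sat = *-cancelˡ-≤ (# S) {{>-nonZero S>0}} (double-≤ (begin
      # S * # S + # S * # S
        ≤⟨ +-mono-≤ sat sat ⟩
      Λ * Q + Λ * Q
        ≡⟨ two Λ Q ⟩
      2 * Λ * Q
        ≡⟨ cong (2 * Λ *_) (∑-cong vs (λ u → trans (∑-cong vs (λ v → comm ⟦ adj u v ⟧ ⟦ S u ⟧ ⟦ S v ⟧)) (∑-*ˡ vs ⟦ S u ⟧ _))) ⟩
      2 * Λ * (∑[ u ∈ vs ] (⟦ S u ⟧ * deg S u))
        ≡⟨ ∑-*ˡ vs (2 * Λ) _ ⟨
      (∑[ u ∈ vs ] (2 * Λ * (⟦ S u ⟧ * deg S u)))
        ≤⟨ ∑-mono vs (λ u → threshold (2 * Λ) (# S) (deg S u) (S u) (deg≤ u)) ⟩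
      (∑[ u ∈ vs ] (# S * (2 * Λ) * ⟦ high S u ⟧ + # S * ⟦ S u ⟧))
        ≡⟨ ∑-distrib-+ vs _ _ ⟩
      (∑[ u ∈ vs ] (# S * (2 * Λ) * ⟦ high S u ⟧)) + (∑[ u ∈ vs ] (# S * ⟦ S u ⟧))
        ≡⟨ cong₂ _+_ (#-*ˡ (# S * (2 * Λ)) (high S)) (#-*ˡ (# S) S) ⟩
      # S * (2 * Λ) * # (high S) + # S * # S ∎) (≤-reflexive (*-assoc (# S) (2 * Λ) (# (high S)))))
      where
      open ≤-Reasoning
      Q = ∑[ u ∈ vs ] ∑[ v ∈ vs ] (⟦ adj u v ⟧ * (⟦ S u ⟧ * ⟦ S v ⟧))
      two : ∀ a b → a * b + a * b ≡ 2 * a * b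
      two = solve-∀
      comm : ∀ a b c → a * (b * c) ≡ b * (a * c)
      comm = solve-∀
      deg≤ : ∀ u → deg S u ≤ # S
      deg≤ u = ∑-mono vs (λ v → ≤-trans (*-monoˡ-≤ ⟦ S v ⟧ (⟦⟧≤1 (adj u v))) (≤-reflexive (*-identityˡ _)))

    -- Every vertex of `Y` has at least `# S / (2Λ)` neighbours in `S`. Counting these edges from
    -- the side of `S`, the vertices below the threshold `y / (4Λ)` account for at most half of
    -- them.
    #joined : ∀ S Y → length Y ≡ y → All (λ v → high S v ≡ true) Y → # S ≤ 4 * Λ * # (joined S Y)
    #joined S Y len Y⊆ = *-cancelˡ-≤ y {{>-nonZero 0<y}} (double-≤ (begin
      y * # S + y * # S
        ≤⟨ +-mono-≤ rich rich ⟩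
      2 * Λ * ∑ Y (deg S) + 2 * Λ * ∑ Y (deg S)
        ≡⟨ two Λ (∑ Y (deg S)) ⟩
      4 * Λ * ∑ Y (deg S)
        ≡⟨ cong (4 * Λ *_) (trans (∑-swap Y vs _) (∑-cong vs (λ v → trans (∑-*ʳ Y ⟦ S v ⟧ _) (*-comm _ ⟦ S v ⟧)))) ⟩
      4 * Λ * (∑[ v ∈ vs ] (⟦ S v ⟧ * deg-list Y v))
        ≡⟨ ∑-*ˡ vs (4 * Λ) _ ⟨
      (∑[ v ∈ vs ] (4 * Λ * (⟦ S v ⟧ * deg-list Y v)))
        ≤⟨ ∑-mono vs (λ v → threshold (4 * Λ) y (deg-list Y v) (S v) (deg≤ v)) ⟩
      (∑[ v ∈ vs ] (y * (4 * Λ) * ⟦ joined S Y v ⟧ + y * ⟦ S v ⟧))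
        ≡⟨ ∑-distrib-+ vs _ _ ⟩
      (∑[ v ∈ vs ] (y * (4 * Λ) * ⟦ joined S Y v ⟧)) + (∑[ v ∈ vs ] (y * ⟦ S v ⟧))
        ≡⟨ cong₂ _+_ (#-*ˡ (y * (4 * Λ)) (joined S Y)) (#-*ˡ y S) ⟩
      y * (4 * Λ) * # (joined S Y) + y * # S ∎) (≤-reflexive (*-assoc y (4 * Λ) (# (joined S Y)))))
      where
      open ≤-Reasoning
      two : ∀ a b → 2 * a * b + 2 * a * b ≡ 4 * a * b
      two = solve-∀
      rich : y * # S ≤ 2 * Λ * ∑ Y (deg S)
      rich = begin
        y * # S                        ≡⟨ cong (_* # S) len ⟨
        length Y * # S                 ≡⟨ ∑-const Y (# S) ⟨
        (∑[ _ ∈ Y ] # S)               ≤⟨ ∑-mono-∈ Y (λ v v∈ →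
                                            does⇒ (# S ≤? _) (proj₂ (∧-split (S v) (All.lookup Y⊆ v∈)))) ⟩
        (∑[ v ∈ Y ] (2 * Λ * deg S v)) ≡⟨ ∑-*ˡ Y (2 * Λ) _ ⟩
        2 * Λ * ∑ Y (deg S)            ∎
      deg≤ : ∀ v → deg-list Y v ≤ y
      deg≤ v = ≤-trans (∑≤length* Y 1 (λ u _ → ⟦⟧≤1 (adj u v))) (≤-reflexive (trans (*-identityʳ _) len))

    -- Otherwise take `y` vertices of `U` in `joined S Y`. Each has at least `y / (4Λ)` neighbours
    -- in `Y`, so together with `Y` they are `2y` vertices of `U` spanning at least `y² / (4Λ) ≥ 2E`
    -- ordered edges.
    joined-meets-sparse : ∀ S U Y → length Y ≡ y → Unique Y → All (λ v → U v ≡ true) Y → Sparse (y + y) E U →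
                          # (λ v → joined S Y v ∧ U v) ≤ y
    joined-meets-sparse S U Y len Y! Y⊆U sparse with # (λ v → joined S Y v ∧ U v) ≤? y
    ... | yes p = p
    ... | no ¬p with pick-elements (λ v → joined S Y v ∧ U v) y (<⇒≤ (≰⇒> ¬p))
    ...   | Z , len′ , Z! , Z⊆ = ⊥-elim (<-irrefl refl (begin-strict
      y * y                              ≡⟨ cong (_* y) len′ ⟨
      length Z * y                       ≡⟨ ∑-const Z y ⟨
      (∑[ _ ∈ Z ] y)                     ≤⟨ ∑-mono-∈ Z (λ z z∈ → does⇒ (y ≤? _) (proj₂ (∧-split (S z)
                                              (proj₁ (∧-split (joined S Y z) (All.lookup Z⊆ z∈)))))) ⟩
      (∑[ z ∈ Z ] (4 * Λ * deg-list Y z)) ≡⟨ ∑-*ˡ Z (4 * Λ) _ ⟩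
      4 * Λ * (∑[ z ∈ Z ] deg-list Y z)  ≤⟨ *-monoʳ-≤ (4 * Λ) edges ⟩
      4 * Λ * e₂ (Y ++ Z)                <⟨ *-monoʳ-< (4 * Λ) {{4Λ≢0}} (sparse (Y ++ Z) (trans (length-++ Y) (cong₂ _+_ len len′))
                                              (Allₚ.++⁺ Y⊆U (All.map (λ {v} h → proj₂ (∧-split (joined S Y v) h)) Z⊆))) ⟩
      4 * Λ * (2 * E)                    ≡⟨ regroup Λ E ⟩
      8 * (Λ * E)                        ≤⟨ y-large ⟩
      y * y                              ∎))
      where
      open ≤-Reasoning
      regroup : ∀ a b → 4 * a * (2 * b) ≡ 8 * (a * b)
      regroup = solve-∀
      4Λ≢0 : NonZero (4 * Λ)
      4Λ≢0 = ≢-nonZero λ eq → 1+n≢0 (trans (sym 4Λ≡) eq)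
      W = Y ++ Z
      edges : ∑[ z ∈ Z ] deg-list Y z ≤ e₂ W
      edges = begin
        (∑[ z ∈ Z ] ∑[ u ∈ Y ] ⟦ adj u z ⟧)
          ≡⟨ ∑-swap Z Y _ ⟩
        (∑[ u ∈ Y ] ∑[ z ∈ Z ] ⟦ adj u z ⟧)
          ≤⟨ ∑-elements≤ Y! (All.tabulate (∈-++⁺ˡ {xs = Y} {Z})) _ ⟩
        (∑[ u ∈ vs ] (⟦ mem W u ⟧ * (∑[ z ∈ Z ] ⟦ adj u z ⟧)))
          ≤⟨ ∑-mono vs (λ u → *-monoʳ-≤ ⟦ mem W u ⟧ (∑-elements≤ Z! (All.tabulate (∈-++⁺ʳ Y {Z})) _)) ⟩
        (∑[ u ∈ vs ] (⟦ mem W u ⟧ * (∑[ v ∈ vs ] (⟦ mem W v ⟧ * ⟦ adj u v ⟧))))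
          ≡⟨ ∑-cong vs (λ u → trans (sym (∑-*ˡ vs ⟦ mem W u ⟧ _)) (∑-cong vs (λ v →
               trans (shuffle ⟦ mem W u ⟧ ⟦ mem W v ⟧ ⟦ adj u v ⟧)
                 (trans (cong (⟦ adj u v ⟧ *_) (sym (⟦⟧-∧ (mem W u) (mem W v)))) (sym (⟦⟧-∧ (adj u v) _)))))) ⟩
        e₂ W ∎
        where
        shuffle : ∀ a b c → a * (b * c) ≡ c * (a * b)
        shuffle = solve-∀

    #-∖ : ∀ S X → X ⊆ S → # (S ∖ X) + # X ≡ # S
    #-∖ S X X⊆S = trans (sym (∑-distrib-+ vs _ _)) (∑-cong vs term)
      where
      term : ∀ v → ⟦ S v ∧ not (X v) ⟧ + ⟦ X v ⟧ ≡ ⟦ S v ⟧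
      term v with X v in eq
      ... | true rewrite X⊆S eq = refl
      ... | false with S v
      ...   | true  = refl
      ...   | false = refl

  -- An acyclic set `U` need not be independent, so no single vertex of `U` forces its neighbours
  -- out. Two kinds of deletion replace this: if `U` has at most `y` vertices in `high S`, delete
  -- `high S`; otherwise `y` of them form `Y`, and `U` has at most `y` vertices in `joined S Y`.
  -- Either way the deleted set is large and nearly free of `U`.
  removals : (V → Bool) → List (V → Bool)
  removals S = high S ∷ map (joined S) (filter (all? (λ v → high S v Boolₚ.≟ true)) (words y))

  _∪_ : List V → (V → Bool) → V → Bool
  (J ∪ K) v = mem J v ∨ K v

  -- Each round branches over the deleted set `X` and over a word `J` of length `y` that restores
  -- the at most `y` vertices of `U` lost with `X`. The number `j` caps the rounds.
  containers : ℕ → (V → Bool) → List (V → Bool)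
  containers zero    S = S ∷ []
  containers (suc j) S = if # S ≤ᵇ R then (S ∷ [])
    else concatMap (λ X → cartesianProductWith _∪_ (words y) (containers j (S ∖ X))) (removals S)

  branching : ℕ
  branching = suc (N ^ y) * N ^ y

  private
    ∈-map-filter⁻ : ∀ {S X} → X ∈ map (joined S) (filter (all? (λ v → high S v Boolₚ.≟ true)) (words y)) →
      ∃ λ Y → X ≡ joined S Y × length Y ≡ y × All (λ v → high S v ≡ true) Y
    ∈-map-filter⁻ {S} X∈ with ∈-map⁻ (joined S) X∈
    ... | Y , Y∈ , X≡ with ∈-filter⁻ (all? (λ v → high S v Boolₚ.≟ true)) {xs = words y} Y∈
    ...   | Y∈words , Y-high = Y , X≡ , ∈-words⁻ Y∈words , Y-high

    removals-⊆ : ∀ {S X} → X ∈ removals S → X ⊆ S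
    removals-⊆ {S} (here refl) h = proj₁ (∧-split (S _) h)
    removals-⊆ {S} (there X∈)  h with ∈-map-filter⁻ {S} X∈
    ... | Y , refl , _ = proj₁ (∧-split (S _) h)

    removals-large : ∀ {S X} → R < # S → X ∈ removals S → # S ≤ 4 * Λ * # X
    removals-large {S} R<S (here refl) =
      ≤-trans (#high S (≤-trans (s≤s z≤n) R<S) (supersaturated S (<⇒≤ R<S)))
              (*-monoˡ-≤ (# (high S)) (*-monoˡ-≤ Λ (s≤s (s≤s (z≤n {2})))))
    removals-large {S} R<S (there X∈) with ∈-map-filter⁻ {S} X∈
    ... | Y , refl , len , Y-high = #joined S Y len Y-high

    shrink : ∀ {S X} → R < # S → X ∈ removals S → suc z * # (S ∖ X) ≤ z * # S
    shrink {S} {X} R<S X∈ = +-cancelʳ-≤ (# S) _ _ (begin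
      suc z * # (S ∖ X) + # S           ≤⟨ +-monoʳ-≤ (suc z * # (S ∖ X)) (removals-large R<S X∈) ⟩
      suc z * # (S ∖ X) + 4 * Λ * # X   ≡⟨ cong (λ x → suc z * # (S ∖ X) + x * # X) 4Λ≡ ⟩
      suc z * # (S ∖ X) + suc z * # X   ≡⟨ *-distribˡ-+ (suc z) (# (S ∖ X)) (# X) ⟨
      suc z * (# (S ∖ X) + # X)         ≡⟨ cong (suc z *_) (#-∖ S X (removals-⊆ X∈)) ⟩
      suc z * # S                       ≡⟨ +-comm (# S) (z * # S) ⟩
      z * # S + # S                     ∎)
      where open ≤-Reasoning

    removal-for : ∀ S U → Sparse (y + y) E U → ∃ λ X → X ∈ removals S × # (λ v → X v ∧ U v) ≤ y
    removal-for S U sparse with # (λ v → high S v ∧ U v) ≤? y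
    ... | yes p = high S , here refl , p
    ... | no ¬p with pick-elements (λ v → high S v ∧ U v) y (<⇒≤ (≰⇒> ¬p))
    ...   | Y , len , Y! , Y⊆ = joined S Y
      , there (∈-map⁺ (joined S) (∈-filter⁺ (all? (λ v → high S v Boolₚ.≟ true)) (∈-words len)
          (All.map (λ {v} h → proj₁ (∧-split (high S v) h)) Y⊆)))
      , joined-meets-sparse S U Y len Y! (All.map (λ {v} h → proj₂ (∧-split (high S v) h)) Y⊆) sparse

    length-concatMap : ∀ {A B : Set} (g : A → List B) xs → length (concatMap g xs) ≡ ∑ xs (length ∘ g)
    length-concatMap g []       = refl
    length-concatMap g (x ∷ xs) = trans (length-++ (g x)) (cong (length (g x) +_) (length-concatMap g xs))

    0<N : 0 < N
    0<N = ≤-trans (s≤s z≤n) (Finₚ.toℕ<n (index (complete v₀)))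

    length-removals : ∀ S → length (removals S) ≤ suc (N ^ y)
    length-removals S = s≤s (≤-trans (≤-reflexive (length-map (joined S) (filter (all? (λ v → high S v Boolₚ.≟ true)) (words y))))
      (≤-trans (length-filter (all? (λ v → high S v Boolₚ.≟ true)) (words y)) (≤-reflexive (length-words y))))

  length-containers : ∀ j S → length (containers j S) ≤ branching ^ j
  length-containers zero    S = ≤-refl
  length-containers (suc j) S with # S ≤ᵇ R
  ... | true  = m^n>0 branching {{>-nonZero (*-mono-≤ (s≤s (z≤n {N ^ y})) (m^n>0 N {{>-nonZero 0<N}} y))}} (suc j)
  ... | false = begin
    length (concatMap g (removals S))         ≡⟨ length-concatMap g (removals S) ⟩
    ∑ (removals S) (length ∘ g)               ≤⟨ ∑≤length* (removals S) (N ^ y * branching ^ j) (λ X _ →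
         ≤-trans (≤-reflexive (length-cartesianProductWith _∪_ (words y) (containers j (S ∖ X))))
                 (*-mono-≤ (≤-reflexive (length-words y)) (length-containers j (S ∖ X)))) ⟩
    length (removals S) * (N ^ y * branching ^ j) ≤⟨ *-monoˡ-≤ (N ^ y * branching ^ j) (length-removals S) ⟩
    suc (N ^ y) * (N ^ y * branching ^ j)     ≡⟨ *-assoc (suc (N ^ y)) (N ^ y) (branching ^ j) ⟨
    branching ^ suc j                         ∎
    where
    open ≤-Reasoning
    g : (V → Bool) → List (V → Bool)
    g X = cartesianProductWith _∪_ (words y) (containers j (S ∖ X))

  private
    #-∪ : ∀ J K → # (J ∪ K) ≤ length J + # K
    #-∪ J K = ≤-trans (∑-mono vs (λ v → split (mem J v) (K v)))
      (≤-trans (≤-reflexive (∑-distrib-+ vs _ _)) (+-monoˡ-≤ (# K) (#mem≤length J)))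
      where
      split : ∀ a b → ⟦ a ∨ b ⟧ ≤ ⟦ a ⟧ + ⟦ b ⟧
      split true  b = m≤m+n 1 ⟦ b ⟧
      split false b = ≤-refl

    ≤ᵇ-true : ∀ m n → (m ≤ᵇ n) ≡ true → m ≤ n
    ≤ᵇ-true m n eq = ≤ᵇ⇒≤ m n (subst T (sym eq) _)

    ≤ᵇ-false : ∀ m n → (m ≤ᵇ n) ≡ false → n < m
    ≤ᵇ-false m n eq = ≰⇒> λ m≤n → subst T eq (≤⇒≤ᵇ m≤n)

    next-bound : ∀ j {S X} → R < # S → X ∈ removals S →
                 # S * z ^ suc j ≤ R * suc z ^ suc j → # (S ∖ X) * z ^ j ≤ R * suc z ^ j
    next-bound j {S} {X} R<S X∈ bound = *-cancelˡ-≤ (suc z) (begin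
      suc z * (# (S ∖ X) * z ^ j)   ≡⟨ *-assoc (suc z) (# (S ∖ X)) (z ^ j) ⟨
      suc z * # (S ∖ X) * z ^ j     ≤⟨ *-monoˡ-≤ (z ^ j) (shrink R<S X∈) ⟩
      z * # S * z ^ j               ≡⟨ shuffle z (# S) (z ^ j) ⟩
      # S * (z * z ^ j)             ≤⟨ bound ⟩
      R * (suc z * suc z ^ j)       ≡⟨ shuffle′ R (suc z) (suc z ^ j) ⟩
      suc z * (R * suc z ^ j)       ∎)
      where
      open ≤-Reasoning
      shuffle : ∀ a b c → a * b * c ≡ b * (a * c)
      shuffle = solve-∀
      shuffle′ : ∀ a b c → a * (b * c) ≡ b * (a * c)
      shuffle′ = solve-∀

  -- The invariant says that `j` further rounds, each shrinking by `z / suc z`, bring `S` down to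
  -- size `R`. Each round undone adds one word of length `y`.
  #containers≤ : ∀ j S → # S * z ^ j ≤ R * suc z ^ j → ∀ {K} → K ∈ containers j S → # K ≤ R + j * y
  #containers≤ zero S bound (here refl) =
    ≤-trans (≤-reflexive (sym (*-identityʳ (# S)))) (≤-trans bound
      (≤-reflexive (trans (*-identityʳ R) (sym (+-identityʳ R)))))
  #containers≤ (suc j) S bound {K} K∈ with # S ≤ᵇ R in eq
  #containers≤ (suc j) S bound {K} (here refl) | true = ≤-trans (≤ᵇ-true (# S) R eq) (m≤m+n _ _)
  ... | false with find (∈-concatMap⁻ (λ X → cartesianProductWith _∪_ (words y) (containers j (S ∖ X))) {xs = removals S} K∈)
  ...   | X , X∈ , K∈X with ∈-cartesianProductWith⁻ _∪_ (words y) (containers j (S ∖ X)) K∈X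
  ...     | J , K′ , J∈ , K′∈ , refl = begin
    # (J ∪ K′)        ≤⟨ #-∪ J K′ ⟩
    length J + # K′   ≤⟨ +-mono-≤ (≤-reflexive (∈-words⁻ J∈))
                           (#containers≤ j (S ∖ X) (next-bound j {S} {X} (≤ᵇ-false (# S) R eq) X∈ bound) K′∈) ⟩
    y + (R + j * y)   ≡⟨ shuffle y R (j * y) ⟩
    R + (y + j * y)   ∎
    where
    open ≤-Reasoning
    shuffle : ∀ a b c → a + (b + c) ≡ b + (a + c)
    shuffle = solve-∀

  -- The recursion is applied to the part of `U` outside `X`, which is sparse as a subset of `U`.
  container-for : ∀ j S → # S * z ^ j ≤ R * suc z ^ j → ∀ U → Sparse (y + y) E U → U ⊆ S →
                  ∃ λ K → K ∈ containers j S × U ⊆ K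
  container-for zero S bound U sparse U⊆S = S , here refl , U⊆S
  container-for (suc j) S bound U sparse U⊆S with # S ≤ᵇ R in eq
  ... | true  = S , here refl , U⊆S
  ... | false with removal-for S U sparse
  ...   | X , X∈ , X∩U≤ with cover-elements v₀ (λ v → X v ∧ U v) y X∩U≤
  ...     | J , len , J⊇ with container-for j (S ∖ X) (next-bound j {S} {X} (≤ᵇ-false (# S) R eq) X∈ bound)
                                (λ v → U v ∧ not (X v))
                                (λ w lw U∋ → sparse w lw (All.map (λ {v} h → proj₁ (∧-split (U v) h)) U∋))
                                (λ {v} h → let u , nx = ∧-split (U v) h in cong₂ _∧_ (U⊆S u) nx)
  ...       | K , K∈ , ⊆K = J ∪ K
    , ∈-concatMap⁺ (λ X → cartesianProductWith _∪_ (words y) (containers j (S ∖ X))) {xs = removals S}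
        (lose X∈ (∈-cartesianProductWith⁺ _∪_ {a = J} {b = K} (∈-words len) K∈))
    , covered
    where
    covered : U ⊆ (J ∪ K)
    covered {v} u with X v in x
    ... | true  rewrite J⊇ {v} (cong₂ _∧_ x u) = refl
    ... | false = trans (cong (mem J v ∨_) (⊆K (cong₂ _∧_ u (cong not x)))) (∨-zeroʳ (mem J v))

-- List assignments

-- Bernoulli's `(1 + 1/a)^n ≥ 1 + n/a` with denominators cleared.
bernoulli : ∀ a n → a ^ n * (a + n) ≤ a * suc a ^ n
bernoulli a zero    = ≤-reflexive (trans (*-identityˡ (a + 0)) (trans (+-identityʳ a) (sym (*-identityʳ a))))
bernoulli a (suc n) = begin
  a * a ^ n * (a + suc n)                 ≤⟨ m≤m+n _ (a ^ n * n) ⟩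
  a * a ^ n * (a + suc n) + a ^ n * n     ≡⟨ shuffle a n (a ^ n) ⟩
  suc a * (a ^ n * (a + n))               ≤⟨ *-monoʳ-≤ (suc a) (bernoulli a n) ⟩
  suc a * (a * suc a ^ n)                 ≡⟨ shuffle′ a (suc a) (suc a ^ n) ⟩
  a * (suc a * suc a ^ n)                 ∎
  where
  open ≤-Reasoning
  shuffle : ∀ a n p → a * p * (a + suc n) + p * n ≡ suc a * (p * (a + n))
  shuffle = solve-∀
  shuffle′ : ∀ a b c → b * (a * c) ≡ a * (b * c)
  shuffle′ = solve-∀

2*a^[1+a]≤[1+a]^[1+a] : ∀ a → 2 * a ^ suc a ≤ suc a ^ suc a
2*a^[1+a]≤[1+a]^[1+a] zero      = z≤n
2*a^[1+a]≤[1+a]^[1+a] a@(suc _) = *-cancelˡ-≤ a (begin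
  a * (2 * a ^ suc a)           ≡⟨ shuffle a (a ^ suc a) ⟩
  a ^ suc a * (a + a)           ≤⟨ *-monoʳ-≤ (a ^ suc a) (+-monoʳ-≤ a (n≤1+n a)) ⟩
  a ^ suc a * (a + suc a)       ≤⟨ bernoulli a (suc a) ⟩
  a * suc a ^ suc a             ∎)
  where
  open ≤-Reasoning
  shuffle : ∀ a p → a * (2 * p) ≡ p * (a + a)
  shuffle = solve-∀

-- With `P = suc a` this is `(1 - 1/P)^(Pt) ≤ 2^-t`. It serves twice: for the shrinking of
-- containers and for the probability that all vertices fail.
2^t*a^[[1+a]t]≤ : ∀ a t → 2 ^ t * a ^ (suc a * t) ≤ suc a ^ (suc a * t)
2^t*a^[[1+a]t]≤ a t = begin
  2 ^ t * a ^ (suc a * t)      ≡⟨ cong (2 ^ t *_) (^-*-assoc a (suc a) t) ⟨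
  2 ^ t * (a ^ suc a) ^ t      ≡⟨ ^-distribʳ-* 2 (a ^ suc a) t ⟨
  (2 * a ^ suc a) ^ t          ≤⟨ ^-monoˡ-≤ t (2*a^[1+a]≤[1+a]^[1+a] a) ⟩
  (suc a ^ suc a) ^ t          ≡⟨ ^-*-assoc (suc a) (suc a) t ⟩
  suc a ^ (suc a * t)          ∎
  where open ≤-Reasoning

size : ∀ {M} → Vec Bool M → ℕ
size []      = 0
size (b ∷ A) = ⟦ b ⟧ + size A

misses : ∀ {M} → Vec Bool M → Vec Bool M → Bool
misses []      []      = true
misses (c ∷ C) (a ∷ A) = not (c ∧ a) ∧ misses C A

misses⇒ : ∀ {M} (C A : Vec Bool M) → misses C A ≡ true → ∀ i → lookup C i ≡ true → lookup A i ≡ false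
misses⇒ (c ∷ C) (a ∷ A) h (suc i) Ci = misses⇒ C A (proj₂ (∧-split (not (c ∧ a)) h)) i Ci
misses⇒ (true ∷ C) (a ∷ A) h zero refl = not-split (proj₁ (∧-split (not a) h))

private
  free : ∀ {M} → Vec Bool M → ℕ
  free []      = 0
  free (c ∷ C) = ⟦ not c ⟧ + free C

  size+free : ∀ {M} (C : Vec Bool M) → size C + free C ≡ M
  size+free []          = refl
  size+free (true  ∷ C) = cong suc (size+free C)
  size+free (false ∷ C) = trans (+-suc (size C) (free C)) (cong suc (size+free C))

  zeros : ∀ {M} → Vec Bool M → Vec Bool M → ℕ
  zeros []      []      = 0
  zeros (c ∷ C) (a ∷ A) = ⟦ not c ∧ not a ⟧ + zeros C A

  size+zeros : ∀ {M} (C A : Vec Bool M) → misses C A ≡ true → size A + zeros C A ≡ free C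
  size+zeros []          []          _ = refl
  size+zeros (true ∷ C)  (false ∷ A) h = size+zeros C A h
  size+zeros (false ∷ C) (true ∷ A)  h = cong suc (size+zeros C A h)
  size+zeros (false ∷ C) (false ∷ A) h = trans (+-suc (size A) _) (cong suc (size+zeros C A h))

  ∑-misses : ∀ {M} (C : Vec Bool M) → ∑[ A ∈ vecs bools M ] ⟦ misses C A ⟧ ≡ 2 ^ free C
  ∑-misses []          = refl
  ∑-misses {suc M} (true ∷ C)  = trans (∑-vecs bools M _)
    (trans (cong₂ _+_ (∑-zero (vecs bools M)) (trans (+-identityʳ _) (∑-misses C))) refl)
  ∑-misses {suc M} (false ∷ C) = trans (∑-vecs bools M _)
    (cong₂ _+_ (∑-misses C) (cong (_+ 0) (∑-misses C)))

  -- A generating function: a position outside `C` contributes 1 if chosen and 2 if not, a position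
  -- of `C` contributes 1.
  ∑-misses-zeros : ∀ {M} (C : Vec Bool M) → ∑[ A ∈ vecs bools M ] (⟦ misses C A ⟧ * 2 ^ zeros C A) ≡ 3 ^ free C
  ∑-misses-zeros []          = refl
  ∑-misses-zeros {suc M} (true ∷ C)  = trans (∑-vecs bools M _)
    (trans (cong₂ _+_ (∑-zero (vecs bools M)) (trans (+-identityʳ _) (∑-misses-zeros C))) refl)
  ∑-misses-zeros {suc M} (false ∷ C) = trans (∑-vecs bools M _)
    (trans (cong₂ _+_ (∑-misses-zeros C) (cong (_+ 0) (trans
      (∑-cong (vecs bools M) (λ A → shuffle ⟦ misses C A ⟧ (2 ^ zeros C A)))
      (trans (∑-*ˡ (vecs bools M) 2 _) (cong (2 *_) (∑-misses-zeros C))))))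
      (three (3 ^ free C)))
    where
    shuffle : ∀ a b → a * (2 * b) ≡ 2 * (a * b)
    shuffle = solve-∀
    three : ∀ x → x + (2 * x + 0) ≡ 3 * x
    three = solve-∀

  -- The leading 2 is absorbed into another `2 ^ m`, and the rest is
  -- `3^6 * 2 * 2 = 2916 ≤ 4096 = 4^6`. This is the origin of the `6m` colours that must stay free.
  2*3^F*2^m≤4^F : ∀ m F → 0 < m → 6 * m ≤ F → 2 * (3 ^ F * 2 ^ m) ≤ 4 ^ F
  2*3^F*2^m≤4^F m F 0<m 6m≤F with e , refl ← m≤n⇒∃[o]m+o≡n 6m≤F = begin
    2 * (3 ^ (6 * m + e) * 2 ^ m)           ≡⟨ cong (λ x → 2 * (x * 2 ^ m)) (^-distribˡ-+-* 3 (6 * m) e) ⟩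
    2 * (3 ^ (6 * m) * 3 ^ e * 2 ^ m)       ≤⟨ *-monoˡ-≤ _ (^-monoʳ-≤ 2 0<m) ⟩
    2 ^ m * (3 ^ (6 * m) * 3 ^ e * 2 ^ m)   ≡⟨ cong (λ x → 2 ^ m * (x * 3 ^ e * 2 ^ m)) (^-*-assoc 3 6 m) ⟨
    2 ^ m * (729 ^ m * 3 ^ e * 2 ^ m)       ≡⟨ shuffle (2 ^ m) (729 ^ m) (3 ^ e) ⟩
    729 ^ m * (2 ^ m * 2 ^ m) * 3 ^ e       ≡⟨ cong (λ x → 729 ^ m * x * 3 ^ e) (^-distribʳ-* 2 2 m) ⟨
    729 ^ m * 4 ^ m * 3 ^ e                 ≡⟨ cong (_* 3 ^ e) (^-distribʳ-* 729 4 m) ⟨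
    2916 ^ m * 3 ^ e                        ≤⟨ *-mono-≤ (^-monoˡ-≤ m {2916} {4096} (≤ᵇ⇒≤ 2916 4096 _)) (^-monoˡ-≤ e {3} {4} (≤ᵇ⇒≤ 3 4 _)) ⟩
    4096 ^ m * 4 ^ e                        ≡⟨ cong (_* 4 ^ e) (^-*-assoc 4 6 m) ⟩
    4 ^ (6 * m) * 4 ^ e                     ≡⟨ ^-distribˡ-+-* 4 (6 * m) e ⟨
    4 ^ (6 * m + e)                         ∎
    where
    open ≤-Reasoning
    shuffle : ∀ a b c → a * (b * c * a) ≡ b * (a * a) * c
    shuffle = solve-∀

large : ∀ {M} → ℕ → Vec Bool M → Bool
large m A = m ≤ᵇ size A

-- Sets of size below m are rare: weighting A by 2^-|A| turns their count into 3^F 2^m / 2^F.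
half-large : ∀ {M} m g (C : Vec Bool M) → 0 < m → 6 * m + g ≤ M → size C ≤ g →
  2 ^ M ≤ 2 ^ suc g * (∑[ A ∈ vecs bools M ] ⟦ large m A ∧ misses C A ⟧)
half-large {M} m g C 0<m 6m+g≤M C≤g = begin
  2 ^ M                 ≡⟨ cong (2 ^_) (size+free C) ⟨
  2 ^ (size C + F)      ≤⟨ ^-monoʳ-≤ 2 (+-monoˡ-≤ F C≤g) ⟩
  2 ^ (g + F)           ≡⟨ ^-distribˡ-+-* 2 g F ⟩
  2 ^ g * 2 ^ F         ≤⟨ *-monoʳ-≤ (2 ^ g) 2^F≤ ⟩
  2 ^ g * (2 * Large)   ≡⟨ shuffle (2 ^ g) Large ⟩
  2 ^ suc g * Large     ∎
  where
  open ≤-Reasoning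
  F = free C
  As = vecs bools M
  Large = ∑[ A ∈ As ] ⟦ large m A ∧ misses C A ⟧
  Small = ∑[ A ∈ As ] ⟦ not (large m A) ∧ misses C A ⟧
  shuffle : ∀ a b → a * (2 * b) ≡ 2 * a * b
  shuffle = solve-∀
  6m≤F : 6 * m ≤ F
  6m≤F = +-cancelʳ-≤ g (6 * m) F (≤-trans 6m+g≤M (≤-trans (≤-reflexive (sym (size+free C)))
    (≤-trans (+-monoˡ-≤ F C≤g) (≤-reflexive (+-comm g F)))))
  sum : Large + Small ≡ 2 ^ F
  sum = trans (sym (∑-distrib-+ As _ _)) (trans (∑-cong As (λ A → split (large m A) (misses C A))) (∑-misses C))
    where
    split : ∀ a b → ⟦ a ∧ b ⟧ + ⟦ not a ∧ b ⟧ ≡ ⟦ b ⟧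
    split true  b = +-identityʳ ⟦ b ⟧
    split false b = refl
  term : ∀ A → 2 ^ F * ⟦ not (large m A) ∧ misses C A ⟧ ≤ 2 ^ m * (⟦ misses C A ⟧ * 2 ^ zeros C A)
  term A with m ≤ᵇ size A in eq | misses C A in miss
  ... | true  | _     = ≤-trans (≤-reflexive (*-zeroʳ (2 ^ F))) z≤n
  ... | false | false = ≤-trans (≤-reflexive (*-zeroʳ (2 ^ F))) z≤n
  ... | false | true  = begin
    2 ^ F * 1                       ≡⟨ *-identityʳ (2 ^ F) ⟩
    2 ^ F                           ≡⟨ cong (2 ^_) (size+zeros C A miss) ⟨
    2 ^ (size A + zeros C A)        ≡⟨ ^-distribˡ-+-* 2 (size A) (zeros C A) ⟩
    2 ^ size A * 2 ^ zeros C A      ≤⟨ *-mono-≤ (^-monoʳ-≤ 2 {size A} {m} (<⇒≤ (≰⇒> λ m≤ → subst T eq (≤⇒≤ᵇ m≤))))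
                                        (≤-reflexive (sym (*-identityˡ (2 ^ zeros C A)))) ⟩
    2 ^ m * (1 * 2 ^ zeros C A)     ∎
  small : 2 * Small ≤ 2 ^ F
  small = *-cancelˡ-≤ (2 ^ F) {{m^n≢0 2 F}} (begin
    2 ^ F * (2 * Small)
      ≡⟨ shuffle₃ (2 ^ F) Small ⟩
    2 * (2 ^ F * Small)
      ≡⟨ cong (2 *_) (∑-*ˡ As (2 ^ F) _) ⟨
    2 * (∑[ A ∈ As ] (2 ^ F * ⟦ not (large m A) ∧ misses C A ⟧))
      ≤⟨ *-monoʳ-≤ 2 (∑-mono As term) ⟩
    2 * (∑[ A ∈ As ] (2 ^ m * (⟦ misses C A ⟧ * 2 ^ zeros C A)))
      ≡⟨ cong (2 *_) (trans (∑-*ˡ As (2 ^ m) _) (trans (cong (2 ^ m *_) (∑-misses-zeros C)) (*-comm (2 ^ m) _))) ⟩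
    2 * (3 ^ F * 2 ^ m)
      ≤⟨ 2*3^F*2^m≤4^F m F 0<m 6m≤F ⟩
    4 ^ F
      ≡⟨ ^-distribʳ-* 2 2 F ⟩
    2 ^ F * 2 ^ F ∎)
    where
    shuffle₃ : ∀ a b → a * (2 * b) ≡ 2 * (a * b)
    shuffle₃ = solve-∀
  2^F≤ : 2 ^ F ≤ 2 * Large
  2^F≤ = +-cancelʳ-≤ (2 ^ F) _ _ (begin
    2 ^ F + 2 ^ F              ≡⟨ cong₂ _+_ (sym sum) (sym sum) ⟩
    Large + Small + (Large + Small) ≡⟨ double Large Small ⟩
    2 * Large + 2 * Small      ≤⟨ +-monoʳ-≤ (2 * Large) small ⟩
    2 * Large + 2 ^ F          ∎)
    where
    double : ∀ a b → a + b + (a + b) ≡ 2 * a + 2 * b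
    double = solve-∀

module ListAssignment {V : Set} (_≟_ : DecidableEquality V) (vs : List V)
                      (complete : ∀ v → v ∈ vs) (unique : Unique vs)
                      (𝒦 : List (V → Bool)) (B m M g τ : ℕ)
                      (𝒦-size : ∀ {K} → K ∈ 𝒦 → Finite.# _≟_ vs complete unique K ≤ B)
                      (0<m : 0 < m) (palette : 6 * m + g ≤ M)
                      (average : 2 * (M * B) ≤ suc g * length vs)
                      (𝒦-few : length 𝒦 ^ M < 2 ^ τ)
                      (N-large : 2 * (2 ^ suc g * τ) ≤ length vs) where

  open Finite _≟_ vs complete unique

  colours-at : ∀ {M} → Vec (V → Bool) M → V → Vec Bool M
  colours-at κ v = Vec.map (λ K → K v) κ

  private
    P′ : ℕ
    P′ = 2 ^ suc g ∸ 1

    P≡ : 2 ^ suc g ≡ suc P′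
    P≡ = sym (m+[n∸m]≡n (m^n>0 2 (suc g)))

    As : List (Vec Bool M)
    As = vecs bools M

    f : Vec (V → Bool) M → V → Vec Bool M → ℕ
    f κ v A = ⟦ not (large m A ∧ misses (colours-at κ v) A) ⟧

    good : Vec (V → Bool) M → V → Bool
    good κ v = size (colours-at κ v) ≤ᵇ g

    ∑f+large : ∀ κ v → ∑ As (f κ v) + (∑[ A ∈ As ] ⟦ large m A ∧ misses (colours-at κ v) A ⟧) ≡ 2 ^ M
    ∑f+large κ v = trans (sym (∑-distrib-+ As _ _)) (trans
      (∑-cong As (λ A → trans (+-comm (f κ v A) _) (⟦not⟧ (large m A ∧ misses (colours-at κ v) A))))
      (trans (sym (length≡∑1 As)) (length-vecs bools M)))

    -- Over the denominator `suc P′ = 2 ^ suc g`, an upper bound for the probability that the list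
    -- at `v` is small or meets a colour whose container holds `v`; at vertices that are not good
    -- the bound is the trivial 1.
    factor : Vec (V → Bool) M → V → ℕ
    factor κ v = if good κ v then P′ else suc P′

    ∑f≤ : ∀ κ v → suc P′ * ∑ As (f κ v) ≤ factor κ v * 2 ^ M
    ∑f≤ κ v with size (colours-at κ v) ≤ᵇ g in eq
    ... | false = *-monoʳ-≤ (suc P′) (≤-trans (m≤m+n _ _) (≤-reflexive (∑f+large κ v)))
    ... | true  = +-cancelʳ-≤ (2 ^ M) _ _ (begin
      suc P′ * ∑ As (f κ v) + 2 ^ M
        ≤⟨ +-monoʳ-≤ (suc P′ * ∑ As (f κ v)) (half-large m g (colours-at κ v) 0<m palette (≤ᵇ⇒≤ _ g (subst T (sym eq) _))) ⟩
      suc P′ * ∑ As (f κ v) + 2 ^ suc g * L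
        ≡⟨ cong (λ x → suc P′ * ∑ As (f κ v) + x * L) P≡ ⟩
      suc P′ * ∑ As (f κ v) + suc P′ * L
        ≡⟨ *-distribˡ-+ (suc P′) _ L ⟨
      suc P′ * (∑ As (f κ v) + L)
        ≡⟨ cong (suc P′ *_) (∑f+large κ v) ⟩
      suc P′ * 2 ^ M
        ≡⟨ +-comm (2 ^ M) _ ⟩
      P′ * 2 ^ M + 2 ^ M ∎)
      where
      open ≤-Reasoning
      L = ∑[ A ∈ As ] ⟦ large m A ∧ misses (colours-at κ v) A ⟧

    ∑-size : ∀ {M} (κ : Vec (V → Bool) M) → VAll.All (_∈ 𝒦) κ → ∑[ v ∈ vs ] size (colours-at κ v) ≤ M * B
    ∑-size []      VAll.[]         = ≤-reflexive (∑-zero vs)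
    ∑-size (K ∷ κ) (K∈ VAll.∷ κ∈) = ≤-trans (≤-reflexive (∑-distrib-+ vs _ _)) (+-mono-≤ (𝒦-size K∈) (∑-size κ κ∈))

    -- Markov's inequality: by `average` a vertex lies on average in at most `suc g / 2` of the
    -- chosen containers, so at most half of the vertices lie in more than `g`; `N-large` compares
    -- the other half with `2 ^ suc g * τ`.
    #good : ∀ κ → VAll.All (_∈ 𝒦) κ → 2 ^ suc g * τ ≤ # (good κ)
    #good κ κ∈ = *-cancelˡ-≤ 2 (+-cancelʳ-≤ N _ _ (begin
      2 * (2 ^ suc g * τ) + N             ≤⟨ +-monoˡ-≤ N N-large ⟩
      N + N                               ≡⟨ cong₂ _+_ (sym total) (sym total) ⟩
      # (good κ) + bad + (# (good κ) + bad) ≡⟨ double (# (good κ)) bad ⟩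
      2 * # (good κ) + 2 * bad            ≤⟨ +-monoʳ-≤ (2 * # (good κ)) 2bad≤ ⟩
      2 * # (good κ) + N                  ∎))
      where
      open ≤-Reasoning
      bad = # (λ v → not (good κ v))
      double : ∀ a b → a + b + (a + b) ≡ 2 * a + 2 * b
      double = solve-∀
      shuffle : ∀ a b → a * (2 * b) ≡ 2 * (a * b)
      shuffle = solve-∀
      total : # (good κ) + bad ≡ N
      total = trans (sym (∑-distrib-+ vs _ _)) (trans (∑-cong vs (λ v → ⟦not⟧ (good κ v))) (sym (length≡∑1 vs)))
      term : ∀ v → suc g * ⟦ not (good κ v) ⟧ ≤ size (colours-at κ v)
      term v with size (colours-at κ v) ≤ᵇ g in eq
      ... | true  = ≤-trans (≤-reflexive (*-zeroʳ (suc g))) z≤n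
      ... | false = ≤-trans (≤-reflexive (*-identityʳ (suc g))) (≰⇒> λ le → subst T eq (≤⇒≤ᵇ le))
      2bad≤ : 2 * bad ≤ N
      2bad≤ = *-cancelˡ-≤ (suc g) (begin
        suc g * (2 * bad)                                ≡⟨ shuffle (suc g) bad ⟩
        2 * (suc g * bad)                                ≡⟨ cong (2 *_) (∑-*ˡ vs (suc g) _) ⟨
        2 * (∑[ v ∈ vs ] (suc g * ⟦ not (good κ v) ⟧))   ≤⟨ *-monoʳ-≤ 2 (∑-mono vs term) ⟩
        2 * (∑[ v ∈ vs ] size (colours-at κ v))          ≤⟨ *-monoʳ-≤ 2 (∑-size κ κ∈) ⟩
        2 * (M * B)                                      ≤⟨ average ⟩
        suc g * N                                        ∎)

    ∏-*ʳ : ∀ (us : List V) h c → ∏[ v ∈ us ] (h v * c) ≡ ∏ us h * c ^ length us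
    ∏-*ʳ []       h c = refl
    ∏-*ʳ (u ∷ us) h c = trans (cong (h u * c *_) (∏-*ʳ us h c)) (shuffle (h u) c (∏ us h) (c ^ length us))
      where
      shuffle : ∀ a b c d → a * b * (c * d) ≡ a * c * (b * d)
      shuffle = solve-∀

    ∏-factor : ∀ κ (us : List V) →
      ∏ us (factor κ) * suc P′ ^ (∑[ v ∈ us ] ⟦ good κ v ⟧) ≡ P′ ^ (∑[ v ∈ us ] ⟦ good κ v ⟧) * suc P′ ^ length us
    ∏-factor κ []       = refl
    ∏-factor κ (u ∷ us) with good κ u
    ... | true  = trans (shuffle P′ (∏ us (factor κ)) (suc P′) (suc P′ ^ G)) (trans (cong (P′ * suc P′ *_) (∏-factor κ us))
                    (shuffle P′ (suc P′) (P′ ^ G) (suc P′ ^ length us)))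
      where
      G = ∑[ v ∈ us ] ⟦ good κ v ⟧
      shuffle : ∀ a b c d → a * b * (c * d) ≡ a * c * (b * d)
      shuffle = solve-∀
    ... | false = trans (*-assoc (suc P′) (∏ us (factor κ)) _) (trans (cong (suc P′ *_) (∏-factor κ us))
                    (shuffle (suc P′) (P′ ^ (∑[ v ∈ us ] ⟦ good κ v ⟧)) (suc P′ ^ length us)))
      where
      shuffle : ∀ a b c → a * (b * c) ≡ b * (a * c)
      shuffle = solve-∀

    2^τ*∏factor≤ : ∀ κ → VAll.All (_∈ 𝒦) κ → 2 ^ τ * ∏ vs (factor κ) ≤ suc P′ ^ N
    2^τ*∏factor≤ κ κ∈ with e , eq ← m≤n⇒∃[o]m+o≡n (≤-trans (≤-reflexive (cong (_* τ) (sym P≡))) (#good κ κ∈)) =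
      *-cancelʳ-≤ _ _ (suc P′ ^ G) {{m^n≢0 (suc P′) G}} (begin
        2 ^ τ * ∏ vs (factor κ) * suc P′ ^ G      ≡⟨ *-assoc (2 ^ τ) _ _ ⟩
        2 ^ τ * (∏ vs (factor κ) * suc P′ ^ G)    ≡⟨ cong (2 ^ τ *_) (∏-factor κ vs) ⟩
        2 ^ τ * (P′ ^ G * suc P′ ^ N)             ≡⟨ *-assoc (2 ^ τ) (P′ ^ G) _ ⟨
        2 ^ τ * P′ ^ G * suc P′ ^ N               ≤⟨ *-monoˡ-≤ (suc P′ ^ N) powers ⟩
        suc P′ ^ G * suc P′ ^ N                   ≡⟨ *-comm (suc P′ ^ G) _ ⟩
        suc P′ ^ N * suc P′ ^ G                   ∎)
      where
      open ≤-Reasoning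
      G = # (good κ)
      powers : 2 ^ τ * P′ ^ G ≤ suc P′ ^ G
      powers = begin
        2 ^ τ * P′ ^ G                            ≡⟨ cong (λ x → 2 ^ τ * P′ ^ x) eq ⟨
        2 ^ τ * P′ ^ (suc P′ * τ + e)             ≡⟨ cong (2 ^ τ *_) (^-distribˡ-+-* P′ (suc P′ * τ) e) ⟩
        2 ^ τ * (P′ ^ (suc P′ * τ) * P′ ^ e)      ≡⟨ *-assoc (2 ^ τ) _ _ ⟨
        2 ^ τ * P′ ^ (suc P′ * τ) * P′ ^ e        ≤⟨ *-mono-≤ (2^t*a^[[1+a]t]≤ P′ τ) (^-monoˡ-≤ e (n≤1+n P′)) ⟩
        suc P′ ^ (suc P′ * τ) * suc P′ ^ e        ≡⟨ ^-distribˡ-+-* (suc P′) (suc P′ * τ) e ⟨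
        suc P′ ^ (suc P′ * τ + e)                 ≡⟨ cong (suc P′ ^_) eq ⟩
        suc P′ ^ G                                ∎

    term : ∀ κ → VAll.All (_∈ 𝒦) κ → 2 ^ τ * (∏[ v ∈ vs ] ∑ As (f κ v)) ≤ (2 ^ M) ^ N
    term κ κ∈ = *-cancelʳ-≤ _ _ (suc P′ ^ N) {{m^n≢0 (suc P′) N}} (begin
      2 ^ τ * (∏[ v ∈ vs ] ∑ As (f κ v)) * suc P′ ^ N
        ≡⟨ *-assoc (2 ^ τ) _ _ ⟩
      2 ^ τ * ((∏[ v ∈ vs ] ∑ As (f κ v)) * suc P′ ^ N)
        ≡⟨ cong (2 ^ τ *_) (∏-*ʳ vs (λ v → ∑ As (f κ v)) (suc P′)) ⟨
      2 ^ τ * (∏[ v ∈ vs ] (∑ As (f κ v) * suc P′))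
        ≤⟨ *-monoʳ-≤ (2 ^ τ) (∏-mono vs (λ v → ≤-trans (≤-reflexive (*-comm _ (suc P′))) (∑f≤ κ v))) ⟩
      2 ^ τ * (∏[ v ∈ vs ] (factor κ v * 2 ^ M))
        ≡⟨ cong (2 ^ τ *_) (∏-*ʳ vs (factor κ) (2 ^ M)) ⟩
      2 ^ τ * (∏ vs (factor κ) * (2 ^ M) ^ N)
        ≡⟨ *-assoc (2 ^ τ) _ _ ⟨
      2 ^ τ * ∏ vs (factor κ) * (2 ^ M) ^ N
        ≤⟨ *-monoˡ-≤ ((2 ^ M) ^ N) (2^τ*∏factor≤ κ κ∈) ⟩
      suc P′ ^ N * (2 ^ M) ^ N
        ≡⟨ *-comm (suc P′ ^ N) _ ⟩
      (2 ^ M) ^ N * suc P′ ^ N ∎)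
      where open ≤-Reasoning

    vecs⁻ : ∀ M {κ : Vec (V → Bool) M} → κ ∈ vecs 𝒦 M → VAll.All (_∈ 𝒦) κ
    vecs⁻ zero    {[]}    _  = VAll.[]
    vecs⁻ (suc M) κ∈ with ∈-cartesianProductWith⁻ _∷_ 𝒦 (vecs 𝒦 M) κ∈
    ... | K , κ , K∈ , κ∈′ , refl = K∈ VAll.∷ vecs⁻ M κ∈′

    few : ∑[ κ ∈ vecs 𝒦 M ] ∏[ v ∈ vs ] ∑ As (f κ v) < length As ^ N
    few = *-cancelˡ-< (2 ^ τ) _ _ (begin-strict
      2 ^ τ * (∑[ κ ∈ vecs 𝒦 M ] ∏[ v ∈ vs ] ∑ As (f κ v))
        ≡⟨ ∑-*ˡ (vecs 𝒦 M) (2 ^ τ) _ ⟨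
      (∑[ κ ∈ vecs 𝒦 M ] (2 ^ τ * (∏[ v ∈ vs ] ∑ As (f κ v))))
        ≤⟨ ∑≤length* (vecs 𝒦 M) ((2 ^ M) ^ N) (λ κ κ∈ → term κ (vecs⁻ M κ∈)) ⟩
      length (vecs 𝒦 M) * (2 ^ M) ^ N
        ≡⟨ cong (_* (2 ^ M) ^ N) (length-vecs 𝒦 M) ⟩
      length 𝒦 ^ M * (2 ^ M) ^ N
        <⟨ *-monoˡ-< ((2 ^ M) ^ N) {{m^n≢0 (2 ^ M) N {{m^n≢0 2 M}}}} 𝒦-few ⟩
      2 ^ τ * (2 ^ M) ^ N
        ≡⟨ cong (λ x → 2 ^ τ * x ^ N) (length-vecs bools M) ⟨
      2 ^ τ * length As ^ N ∎)
      where open ≤-Reasoning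

    all∈bools : ∀ {M} (A : Vec Bool M) → VAll.All (_∈ bools) A
    all∈bools []          = VAll.[]
    all∈bools (true ∷ A)  = here refl VAll.∷ all∈bools A
    all∈bools (false ∷ A) = there (here refl) VAll.∷ all∈bools A

  -- For a fixed `κ` the good vertices fail independently, all of them together with probability at
  -- most `2^-τ`; by `𝒦-few` there are fewer than `2 ^ τ` choices of `κ`.
  lists-missing-some-vertex : ∃ λ (ω : V → Vec Bool M) → ∀ (κ : Vec (V → Bool) M) → VAll.All (_∈ 𝒦) κ →
    ∃ λ v → m ≤ size (ω v) × misses (colours-at κ v) (ω v) ≡ true
  lists-missing-some-vertex
    with ω , h ← union-bound _≟_ As (∈-vecs (all∈bools (Vec.replicate M true))) (vecs 𝒦 M) f vs unique few
    = ω , λ κ κ∈ → missed κ ω (h {κ} (∈-vecs κ∈))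
    where
    missed : ∀ κ (ω : V → Vec Bool M) → (∃ λ v → f κ v (ω v) ≡ 0) →
             ∃ λ v → m ≤ size (ω v) × misses (colours-at κ v) (ω v) ≡ true
    missed κ ω (v , eq) with large m (ω v) in l | misses (colours-at κ v) (ω v) in miss
    ... | true | true = v , ≤ᵇ⇒≤ m _ (subst T (sym l) _) , miss

-- Orientation, containers and lists combined

module NonColourable {V : Set} (_≟_ : DecidableEquality V) (vs : List V)
                     (complete : ∀ v → v ∈ vs) (unique : Unique vs) (v₀ : V)
                     (adj : V → V → Bool) (adj-sym : ∀ u v → adj u v ≡ adj v u) (adj-irr : ∀ v → adj v v ≡ false)
                     (lt : V → V → Bool) (lt-total : ∀ {u v} → u ≢ v → lt u v ≡ not (lt v u))
                     (Λ R : ℕ)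
                     (supersaturated : ∀ S → R ≤ Finite.# _≟_ vs complete unique S →
                        Finite.# _≟_ vs complete unique S * Finite.# _≟_ vs complete unique S ≤
                        Λ * (∑[ u ∈ vs ] ∑[ v ∈ vs ] (⟦ adj u v ⟧ * (⟦ S u ⟧ * ⟦ S v ⟧))))
                     (0<Λ : 0 < Λ) (0<R : 0 < R)
                     (e₀ : ℕ) (0<e₀ : 0 < e₀) (N≤2^e₀ : length vs ≤ 2 ^ e₀) where

  open Finite _≟_ vs complete unique
  open Orient _≟_ vs complete unique adj adj-sym adj-irr lt lt-total

  -- `E = 2ye₀ + 1` makes `N ^ (2y) < 2 ^ E`, and `y = 32Λe₀` is large enough for `8ΛE ≤ y²`. After
  -- `J = 4Λe₀` rounds the shrinking factor is at most `2^-e₀ ≤ 1/N`, so every set has come down to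
  -- `R`. The exponent `κ` bounds the logarithm of `branching ^ J`.
  y J κ : ℕ
  y = 32 * (Λ * e₀)
  J = 4 * Λ * e₀
  κ = 3 * (e₀ * y) * J

  private
    E z : ℕ
    E = suc (e₀ * (y + y))
    z = 4 * Λ ∸ 1

    4Λ≡ : 4 * Λ ≡ suc z
    4Λ≡ = sym (m+[n∸m]≡n (*-mono-≤ (s≤s (z≤n {3})) 0<Λ))

    0<Λe₀ : 0 < Λ * e₀
    0<Λe₀ = *-mono-≤ 0<Λ 0<e₀

    0<y : 0 < y
    0<y = *-mono-≤ (s≤s (z≤n {31})) 0<Λe₀

    y-large : 8 * (Λ * E) ≤ y * y
    y-large = begin
      8 * (Λ * suc (e₀ * (y + y)))            ≡⟨ e₁ Λ e₀ y ⟩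
      8 * (Λ * 1) + 16 * (Λ * e₀) * y         ≤⟨ +-monoˡ-≤ _ (*-monoʳ-≤ 8 (*-monoʳ-≤ Λ 0<e₀)) ⟩
      8 * (Λ * e₀) + 16 * (Λ * e₀) * y        ≡⟨ cong (_+ 16 * (Λ * e₀) * y) (*-identityʳ (8 * (Λ * e₀))) ⟨
      8 * (Λ * e₀) * 1 + 16 * (Λ * e₀) * y    ≤⟨ +-monoˡ-≤ _ (*-mono-≤ (*-monoˡ-≤ (Λ * e₀) (≤ᵇ⇒≤ 8 16 _)) 0<y) ⟩
      16 * (Λ * e₀) * y + 16 * (Λ * e₀) * y   ≡⟨ e₂′ (Λ * e₀) y ⟩
      32 * (Λ * e₀) * y                       ∎
      where
      open ≤-Reasoning
      e₁ : ∀ l e y → 8 * (l * suc (e * (y + y))) ≡ 8 * (l * 1) + 16 * (l * e) * y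
      e₁ = solve-∀
      e₂′ : ∀ x y → 16 * x * y + 16 * x * y ≡ 32 * x * y
      e₂′ = solve-∀

    N^≤ : ∀ t → N ^ t ≤ 2 ^ (e₀ * t)
    N^≤ t = ≤-trans (^-monoˡ-≤ t N≤2^e₀) (≤-reflexive (^-*-assoc 2 e₀ t))

    oriented = sparse-orientation (y + y) E
      (≤-<-trans (N^≤ (y + y)) (^-monoʳ-< 2 (s≤s (s≤s z≤n)) (n<1+n (e₀ * (y + y)))))

    open Containers _≟_ vs complete unique v₀ adj adj-sym adj-irr lt lt-total Λ R supersaturated
                    y E 0<y y-large z 4Λ≡

    everything : V → Bool
    everything _ = true

    start : # everything * z ^ J ≤ R * suc z ^ J
    start = begin
      # everything * z ^ J           ≡⟨ cong (_* z ^ J) (length≡∑1 vs) ⟨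
      N * z ^ J                      ≤⟨ *-monoˡ-≤ (z ^ J) N≤2^e₀ ⟩
      2 ^ e₀ * z ^ J                 ≡⟨ cong (λ x → 2 ^ e₀ * z ^ (x * e₀)) 4Λ≡ ⟩
      2 ^ e₀ * z ^ (suc z * e₀)      ≤⟨ 2^t*a^[[1+a]t]≤ z e₀ ⟩
      suc z ^ (suc z * e₀)           ≡⟨ cong (λ x → suc z ^ (x * e₀)) 4Λ≡ ⟨
      suc z ^ J                      ≡⟨ *-identityˡ (suc z ^ J) ⟨
      1 * suc z ^ J                  ≤⟨ *-monoˡ-≤ (suc z ^ J) 0<R ⟩
      R * suc z ^ J                  ∎
      where open ≤-Reasoning

    𝒦 : List (V → Bool)
    𝒦 = containers J everything

    branching≤ : branching ≤ 2 ^ (3 * (e₀ * y))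
    branching≤ = begin
      suc (N ^ y) * N ^ y                          ≤⟨ *-mono-≤ (s≤s (N^≤ y)) (N^≤ y) ⟩
      suc (2 ^ (e₀ * y)) * 2 ^ (e₀ * y)            ≤⟨ *-monoˡ-≤ (2 ^ (e₀ * y)) (^-monoʳ-< 2 (s≤s (s≤s z≤n)) (n<1+n (e₀ * y))) ⟩
      2 ^ suc (e₀ * y) * 2 ^ (e₀ * y)              ≡⟨ ^-distribˡ-+-* 2 (suc (e₀ * y)) (e₀ * y) ⟨
      2 ^ (suc (e₀ * y) + e₀ * y)                  ≤⟨ ^-monoʳ-≤ 2 (+-monoˡ-≤ (e₀ * y) (+-monoˡ-≤ (e₀ * y) (*-mono-≤ 0<e₀ 0<y))) ⟩
      2 ^ (e₀ * y + e₀ * y + e₀ * y)               ≡⟨ cong (2 ^_) (three (e₀ * y)) ⟩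
      2 ^ (3 * (e₀ * y))                           ∎
      where
      open ≤-Reasoning
      three : ∀ x → x + x + x ≡ 3 * x
      three = solve-∀

    𝒦-few : ∀ M → length 𝒦 ^ M < 2 ^ suc (κ * M)
    𝒦-few M = begin-strict
      length 𝒦 ^ M                        ≤⟨ ^-monoˡ-≤ M (≤-trans (length-containers J everything) (^-monoˡ-≤ J branching≤)) ⟩
      ((2 ^ (3 * (e₀ * y))) ^ J) ^ M      ≡⟨ cong (_^ M) (^-*-assoc 2 (3 * (e₀ * y)) J) ⟩
      (2 ^ κ) ^ M                         ≡⟨ ^-*-assoc 2 κ M ⟩
      2 ^ (κ * M)                         <⟨ ^-monoʳ-< 2 (s≤s (s≤s z≤n)) (n<1+n (κ * M)) ⟩
      2 ^ suc (κ * M)                     ∎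
      where open ≤-Reasoning

  -- Put each colour class into a container. The lists then have a vertex `v` that is offered no
  -- colour whose container holds `v`, although the container of the class of `f v` does hold it.
  -- Only vertices with at least `m` colours can arise as `v`, so acceptance is asked only there.
  no-colouring : ∀ m M g → 0 < m → 6 * m + g ≤ M → 2 * (M * (R + J * y)) ≤ suc g * length vs →
    2 * (2 ^ suc g * suc (κ * M)) ≤ length vs →
    ∃ λ (b : V × V → Bool) → ∃ λ (ω : V → Vec Bool M) → ∀ (f : V → Fin M) →
      (∀ v → m ≤ size (ω v) → lookup (ω v) (f v) ≡ true) →
      (∀ c → Acyclic (arc b) (λ v → does (f v Finₚ.≟ c))) → ⊥
  no-colouring m M g 0<m palette average N-large =
    proj₁ oriented , proj₁ lists , λ f accepted acyclic →
      let cont : ∀ c → ∃ λ K → K ∈ 𝒦 × (λ v → does (f v Finₚ.≟ c)) ⊆ K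
          cont c = container-for J everything start (λ v → does (f v Finₚ.≟ c))
                     (acyclic⇒sparse {E = E} {b = proj₁ oriented} (proj₂ oriented) (acyclic c)) (λ _ → refl)
          Ks = Vec.tabulate (λ c → proj₁ (cont c))
          v , m≤ , miss = proj₂ lists Ks (VAllₚ.tabulate⁺ (λ c → proj₁ (proj₂ (cont c))))
          hit : lookup (colours-at Ks v) (f v) ≡ true
          hit = trans (Vecₚ.lookup-map (f v) (λ K → K v) Ks)
                  (trans (cong (λ K → K v) (Vecₚ.lookup∘tabulate (λ c → proj₁ (cont c)) (f v)))
                    (proj₂ (proj₂ (cont (f v))) (dec-true (f v Finₚ.≟ f v) refl)))
      in true≢false (trans (sym (accepted v m≤)) (misses⇒ (colours-at Ks v) _ miss (f v) hit))
    where
    open ListAssignment _≟_ vs complete unique 𝒦 (R + J * y) m M g (suc (κ * M))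
           (#containers≤ J everything start) 0<m palette average (𝒦-few M) N-large
    lists = lists-missing-some-vertex

-- Kneser graphs

colours : ∀ {M} → Vec Bool M → ℕ → List ℕ
colours []          i = []
colours (true ∷ A)  i = i ∷ colours A (suc i)
colours (false ∷ A) i = colours A (suc i)

length-colours : ∀ {M} (A : Vec Bool M) i → length (colours A i) ≡ size A
length-colours []          i = refl
length-colours (true ∷ A)  i = cong suc (length-colours A (suc i))
length-colours (false ∷ A) i = length-colours A (suc i)

colours-≥ : ∀ {M} (A : Vec Bool M) i → All (i ≤_) (colours A i)
colours-≥ []          i = []
colours-≥ (true ∷ A)  i = ≤-refl ∷ All.map (≤-trans (n≤1+n i)) (colours-≥ A (suc i))
colours-≥ (false ∷ A) i = All.map (≤-trans (n≤1+n i)) (colours-≥ A (suc i))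

colours-unique : ∀ {M} (A : Vec Bool M) i → Unique (colours A i)
colours-unique []          i = []
colours-unique (true ∷ A)  i = All.map (λ i<c i≡c → <-irrefl i≡c i<c) (colours-≥ A (suc i)) ∷ colours-unique A (suc i)
colours-unique (false ∷ A) i = colours-unique A (suc i)

colours⁻ : ∀ {M} (A : Vec Bool M) i {c} → c ∈ colours A i → ∃ λ j → c ≡ i + toℕ j × lookup A j ≡ true
colours⁻ (true ∷ A)  i (here refl) = zero , sym (+-identityʳ i) , refl
colours⁻ (true ∷ A)  i (there c∈)  with colours⁻ A (suc i) c∈
... | j , eq , h = suc j , trans eq (sym (+-suc i (toℕ j))) , h
colours⁻ (false ∷ A) i c∈ with colours⁻ A (suc i) c∈
... | j , eq , h = suc j , trans eq (sym (+-suc i (toℕ j))) , h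

size-replicate : ∀ M → size (Vec.replicate M true) ≡ M
size-replicate zero    = refl
size-replicate (suc M) = cong suc (size-replicate M)

-- A vertex whose random set is too small gets the whole palette; the argument never looks at its
-- colour.
padded : ∀ {M} → ℕ → Vec Bool M → Vec Bool M
padded {M} m A = if large m A then A else Vec.replicate M true

-- Numbering from 1 makes the colours positive. Trimming to `m` colours is harmless, since a subset
-- of a list that avoids certain colours avoids them too.
colour-list : ∀ {M} → ℕ → Vec Bool M → List ℕ
colour-list m A = take m (colours (padded m A) 1)

length-colour-list : ∀ {M} m (A : Vec Bool M) → m ≤ M → length (colour-list m A) ≡ m
length-colour-list {M} m A m≤M = trans (length-take m (colours (padded m A) 1))
  (m≤n⇒m⊓n≡m (≤-trans m≤ (≤-reflexive (sym (length-colours (padded m A) 1)))))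
  where
  m≤ : m ≤ size (padded m A)
  m≤ with m ≤ᵇ size A in eq
  ... | true  = ≤ᵇ⇒≤ m (size A) (subst T (sym eq) _)
  ... | false = ≤-trans m≤M (≤-reflexive (sym (size-replicate M)))

take⁻ : ∀ {A : Set} n {xs : List A} {x} → x ∈ take n xs → x ∈ xs
take⁻ (suc n) {_ ∷ xs} (here px)  = here px
take⁻ (suc n) {_ ∷ xs} (there x∈) = there (take⁻ n x∈)

colour-list⁻ : ∀ {M} m (A : Vec Bool M) {c} → c ∈ colour-list m A →
               ∃ λ j → c ≡ suc (toℕ j) × (m ≤ size A → lookup A j ≡ true)
colour-list⁻ m A c∈ with m ≤ᵇ size A in eq
... | true  = let j , c≡ , h = colours⁻ A 1 (take⁻ m c∈) in j , c≡ , λ _ → h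
... | false = let j , c≡ , _ = colours⁻ (Vec.replicate _ true) 1 (take⁻ m c∈) in
  j , c≡ , λ m≤ → ⊥-elim (subst T eq (≤⇒≤ᵇ m≤))

lex : ∀ {n} → Subset n → Subset n → Bool
lex []      []      = false
lex (x ∷ p) (y ∷ q) = if does (x Boolₚ.≟ y) then lex p q else y

lex-total : ∀ {n} {p q : Subset n} → p ≢ q → lex p q ≡ not (lex q p)
lex-total {p = []}        {[]}        p≢q = ⊥-elim (p≢q refl)
lex-total {p = true ∷ p}  {true ∷ q}  p≢q = lex-total (p≢q ∘ cong (true ∷_))
lex-total {p = false ∷ p} {false ∷ q} p≢q = lex-total (p≢q ∘ cong (false ∷_))
lex-total {p = true ∷ p}  {false ∷ q} p≢q = refl
lex-total {p = false ∷ p} {true ∷ q}  p≢q = refl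

∣++∣ : ∀ {a b} (p : Subset a) (q : Subset b) → ∣ p Vec.++ q ∣ ≡ ∣ p ∣ + ∣ q ∣
∣++∣ []          q = refl
∣++∣ (true ∷ p)  q = cong suc (∣++∣ p q)
∣++∣ (false ∷ p) q = ∣++∣ p q

⊥++⊥ : ∀ a {b} → ⊥ₛ {a} Vec.++ ⊥ₛ {b} ≡ ⊥ₛ
⊥++⊥ zero    = refl
⊥++⊥ (suc a) = cong (false ∷_) (⊥++⊥ a)

-- The size of `k` blocks of size `s` and `l` leftover points, defined by recursion so that the
-- concatenation of blocks in `φ` has this length definitionally.
ground : ℕ → ℕ → ℕ → ℕ
ground s l zero    = l
ground s l (suc i) = s + ground s l i

ground≡ : ∀ s l i → ground s l i ≡ i * s + l
ground≡ s l zero    = refl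
ground≡ s l (suc i) = trans (cong (s +_) (ground≡ s l i)) (sym (+-assoc s (i * s) l))

-- KG(n,k) contains the k-fold product of K_s, as the k-sets that meet each of k
-- disjoint blocks of size s exactly once.
module Kneser (r l j : ℕ) where

  s k : ℕ
  s = suc r
  k = suc j

  open ProductGraph Finₚ._≟_ (allFin s) ∈-allFin (Uniq.allFin⁺ s) r (length-tabulate {n = s} (λ i → i))

  φ : ∀ {i} → Vec (Fin s) i → Subset (ground s l i)
  φ []      = ⊥ₛ
  φ (a ∷ v) = ⁅ a ⁆ Vec.++ φ v

  ∣φ∣ : ∀ {i} (v : Vec (Fin s) i) → ∣ φ v ∣ ≡ i
  ∣φ∣ []      = ∣⊥∣≡0 l
  ∣φ∣ (a ∷ v) = trans (∣++∣ ⁅ a ⁆ (φ v)) (cong₂ _+_ (∣⁅x⁆∣≡1 a) (∣φ∣ v))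

  φ-injective : ∀ {i} {u v : Vec (Fin s) i} → φ u ≡ φ v → u ≡ v
  φ-injective {u = []}    {[]}    _  = refl
  φ-injective {u = a ∷ u} {b ∷ v} eq with Vecₚ.++-injective ⁅ a ⁆ ⁅ b ⁆ eq
  ... | h , t = cong₂ _∷_ (x∈⁅y⁆⇒x≡y b (subst (a ∈ₛ_) h (x∈⁅x⁆ a))) (φ-injective t)

  φ-disjoint : ∀ {i} (u v : Vec (Fin s) i) → adj u v ≡ true → φ u ∩ φ v ≡ ⊥ₛ
  φ-disjoint []      []      _ = ∩-idem ⊥ₛ
  φ-disjoint (a ∷ u) (b ∷ v) h with ∧-split (not (does (a Finₚ.≟ b))) h
  ... | a≠b , h′ = trans (Vecₚ.zipWith-++ _∧_ ⁅ a ⁆ (φ u) ⁅ b ⁆ (φ v))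
    (trans (cong₂ Vec._++_ singletons (φ-disjoint u v h′)) (⊥++⊥ s))
    where
    a≢b : a ≢ b
    a≢b eq = true≢false (trans (sym (dec-true (a Finₚ.≟ b) eq)) (not-split a≠b))
    singletons : ⁅ a ⁆ ∩ ⁅ b ⁆ ≡ ⊥ₛ
    singletons = Empty-unique λ { (x , x∈) → let x∈a , x∈b = x∈p∩q⁻ ⁅ a ⁆ ⁅ b ⁆ x∈ in
      a≢b (trans (sym (x∈⁅y⁆⇒x≡y a x∈a)) (x∈⁅y⁆⇒x≡y b x∈b)) }

  V : Set
  V = Vec (Fin s) k

  v₀ : V
  v₀ = Vec.replicate k zero

  _≟ᵥ_ : DecidableEquality V
  _≟ᵥ_ = Vecₚ.≡-dec Finₚ._≟_

  emb : V → Graph.V (KG (ground s l k) k)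
  emb v = φ v , ∣φ∣ v

  -- A left inverse of `φ` made total. It lets the coins and the lists, chosen only on the product
  -- graph, be extended to all of the Kneser graph; sets outside the image are treated like `v₀`.
  decode : Subset (ground s l k) → V
  decode p with any? (λ v → Vecₚ.≡-dec Boolₚ._≟_ (φ v) p) (vertices k)
  ... | yes a = proj₁ (find a)
  ... | no _  = v₀

  decode-φ : ∀ v → decode (φ v) ≡ v
  decode-φ v with any? (λ u → Vecₚ.≡-dec Boolₚ._≟_ (φ u) (φ v)) (vertices k)
  ... | yes a = φ-injective (proj₂ (proj₂ (find a)))
  ... | no ¬a = ⊥-elim (¬a (lose (vertices-complete v) refl))

  lt : V → V → Bool
  lt u v = lex (φ u) (φ v)

  lt-total : ∀ {u v} → u ≢ v → lt u v ≡ not (lt v u)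
  lt-total u≢v = lex-total (u≢v ∘ φ-injective)

  module _ (b : V × V → Bool) where

    -- The sets themselves are compared, not their decodings: distinct sets may decode to the same
    -- vertex, and antisymmetry must hold for every pair of them.
    dir : Subset (ground s l k) → Subset (ground s l k) → Bool
    dir p q = if lex p q then b (decode p , decode q) else not (b (decode q , decode p))

    dir-antisym : ∀ {p q} → p ≢ q → dir p q ≡ not (dir q p)
    dir-antisym {p} {q} p≢q rewrite lex-total p≢q with lex q p
    ... | true  = refl
    ... | false = sym (Boolₚ.not-involutive _)

    orientation : Orientation (KG (ground s l k) k)
    orientation = record
      { Arc     = λ u v → Empty (proj₁ u ∩ proj₁ v) × dir (proj₁ u) (proj₁ v) ≡ true
      ; arc⇒adj = proj₁
      ; adj⇒one = λ {u} {v} → one u v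
      }
      where
      one : ∀ (u v : Graph.V (KG (ground s l k) k)) → Empty (proj₁ u ∩ proj₁ v) →
            ((Empty (proj₁ u ∩ proj₁ v) × dir (proj₁ u) (proj₁ v) ≡ true) ×
             ¬ (Empty (proj₁ v ∩ proj₁ u) × dir (proj₁ v) (proj₁ u) ≡ true)) ⊎
            ((Empty (proj₁ v ∩ proj₁ u) × dir (proj₁ v) (proj₁ u) ≡ true) ×
             ¬ (Empty (proj₁ u ∩ proj₁ v) × dir (proj₁ u) (proj₁ v) ≡ true))
      one (p , ∣p∣≡k) (q , _) empty with dir p q in pq | dir q p in qp | dir-antisym {p} {q} p≢q
        where
        p≢q : p ≢ q
        p≢q refl = 0≢1+n (trans (sym (∣⊥∣≡0 (ground s l k)))
          (trans (cong ∣_∣ (sym (Empty-unique (subst Empty (∩-idem p) empty)))) ∣p∣≡k))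
      ... | true  | false | _ = inj₁ ((empty , refl) , λ { (_ , ()) })
      ... | false | true  | _ = inj₂ ((subst Empty (∩-comm p q) empty , refl) , λ { (_ , ()) })

  private
    module O = Orient _≟ᵥ_ (vertices k) vertices-complete (vertices-unique k) adj adj-sym adj-irr lt lt-total
    module F = Finite _≟ᵥ_ (vertices k) vertices-complete (vertices-unique k)

    arc⇒Arc : ∀ b u v → O.arc b u v ≡ true → Orientation.Arc (orientation b) (emb u) (emb v)
    arc⇒Arc b u v h with ∧-split (adj u v) h
    ... | a , d = subst Empty (sym (φ-disjoint u v a)) (λ { (_ , x∈) → ∉⊥ x∈ })
      , trans (cong₂ (λ x y → if lex (φ u) (φ v) then b (x , y) else not (b (y , x))) (decode-φ u) (decode-φ v)) d

    acyclic-class : ∀ b (f : Graph.V (KG (ground s l k) k) → ℕ) → Proper (orientation b) f →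
      ∀ {M} (g : V → Fin M) → (∀ v → f (emb v) ≡ suc (toℕ (g v))) →
      ∀ c → F.Acyclic (O.arc b) (λ v → does (g v Finₚ.≟ c))
    acyclic-class b f proper g f≡ c C = proper
      record { len   = len
             ; w     = emb ∘ w
             ; inj   = λ eq → inj (φ-injective (cong proj₁ eq))
             ; steps = λ i → arc⇒Arc b (w (inject₁ i)) (w (suc i)) (steps i)
             ; close = arc⇒Arc b (w (fromℕ len)) (w zero) close }
      (λ i → trans (colour i) (sym (colour zero)))
      where
      open F.Cycle C
      colour : ∀ i → f (emb (w i)) ≡ suc (toℕ c)
      colour i = trans (f≡ (w i)) (cong (suc ∘ toℕ) (does⇒ (g (w i) Finₚ.≟ c) (inU i)))

    N≡ : length (vertices k) ≡ s ^ k
    N≡ = trans (length-vecs (allFin s) k) (cong (_^ k) (length-tabulate {n = s} (λ i → i)))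

  colourable⇒0<m : ∀ m → (∀ (D : Orientation (KG (ground s l k) k)) → ListDiColourable D m) → 0 < m
  colourable⇒0<m (suc m) _          = s≤s z≤n
  colourable⇒0<m zero    colourable
    with f , accepts , _ ← colourable (orientation (λ _ → true)) (λ _ → []) (λ _ → refl , [] , [])
    with () ← accepts (emb v₀)

  module _ (1≤r : 1 ≤ r) (e₀ : ℕ) (0<e₀ : 0 < e₀) (N≤2^e₀ : s ^ k ≤ 2 ^ e₀) where

    open NonColourable _≟ᵥ_ (vertices k) vertices-complete (vertices-unique k) v₀ adj adj-sym adj-irr lt lt-total
           (2 ^ k) (2 * s ^ j) (supersaturation (≤-trans (+-monoˡ-≤ r 1≤r) (≤-reflexive (cong (r +_) (sym (+-identityʳ r))))))
           (m^n>0 2 k) (*-mono-≤ (s≤s (z≤n {1})) (m^n>0 s j)) e₀ 0<e₀ (≤-trans (≤-reflexive N≡) N≤2^e₀)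
      using (y; J; κ; no-colouring)

    kneser-not-colourable : ∀ m M g → 0 < m → 6 * m + g ≤ M → 2 * (M * (2 * s ^ j + J * y)) ≤ suc g * s ^ k →
      2 * (2 ^ suc g * suc (κ * M)) ≤ s ^ k →
      ¬ (∀ (D : Orientation (KG (ground s l k) k)) → ListDiColourable D m)
    kneser-not-colourable m M g 0<m palette average N-large colourable =
      contradictory (λ v → proj₁ (chosen v)) (λ v → proj₂ (proj₂ (chosen v)))
        (acyclic-class b f (proj₂ (proj₂ coloured)) (λ v → proj₁ (chosen v)) (λ v → proj₁ (proj₂ (chosen v))))
      where
      found = no-colouring m M g 0<m palette
        (≤-trans average (≤-reflexive (cong (suc g *_) (sym N≡)))) (≤-trans N-large (≤-reflexive (sym N≡)))
      b = proj₁ found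
      ω = proj₁ (proj₂ found)
      contradictory = proj₂ (proj₂ found)
      coloured = colourable (orientation b) (λ u → colour-list m (ω (decode (proj₁ u))))
        (λ u → length-colour-list m (ω (decode (proj₁ u))) (≤-trans (m≤n*m m 6) (m+n≤o⇒m≤o (6 * m) palette))
             , Uniq.take⁺ m (colours-unique (padded m (ω (decode (proj₁ u)))) 1)
             , Allₚ.take⁺ m (colours-≥ (padded m (ω (decode (proj₁ u)))) 1))
      f = proj₁ coloured
      chosen : ∀ v → ∃ λ i → f (emb v) ≡ suc (toℕ i) × (m ≤ size (ω v) → lookup (ω v) i ≡ true)
      chosen v = colour-list⁻ m (ω v)
        (subst (λ u → f (emb v) ∈ colour-list m (ω u)) (decode-φ v) (proj₁ (proj₂ coloured) (emb v)))

-- The choice of parameters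

^-cancelˡ-≤ : ∀ e .{{_ : NonZero e}} {a b} → a ^ e ≤ b ^ e → a ≤ b
^-cancelˡ-≤ e {a} {b} h with a ≤? b
... | yes p = p
... | no ¬p = ⊥-elim (<⇒≱ (^-monoˡ-< e (≰⇒> ¬p)) h)

^-cancelʳ-< : ∀ c .{{_ : NonZero c}} {a b} → c ^ a < c ^ b → a < b
^-cancelʳ-< c {a} {b} h with b ≤? a
... | yes p = ⊥-elim (<⇒≱ h (^-monoʳ-≤ c p))
... | no ¬p = ≰⇒> ¬p

n<2^n : ∀ n → n < 2 ^ n
n<2^n zero    = s≤s z≤n
n<2^n (suc n) = ≤-trans (+-mono-≤ (m^n>0 2 n) (n<2^n n)) (≤-reflexive (cong (2 ^ n +_) (sym (+-identityʳ (2 ^ n)))))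

log₂-bounds : ∀ n → ∃ λ L → 2 ^ L ≤ suc n × suc n < 2 ^ suc L
log₂-bounds zero    = 0 , ≤-refl , ≤-refl
log₂-bounds (suc n) with log₂-bounds n
... | L , lo , hi with 2 ^ suc L ≤? suc (suc n)
...   | no ¬p = L , ≤-trans lo (n≤1+n _) , ≰⇒> ¬p
...   | yes p = suc L , p , ≤-<-trans hi (^-monoʳ-< 2 (s≤s (s≤s z≤n)) (n<1+n (suc L)))

-- With h = e + 1 and L = xh + O(h), 2^L ≥ (2^x)^h ≥ (L/h)^h.
poly≤exp : ∀ c e → ∃ λ L₀ → ∀ L → L₀ ≤ L → c * L ^ e ≤ 2 ^ L
poly≤exp c e = c * h ^ h , λ L L₀≤L → *-cancelˡ-≤ (h ^ h) {{m^n≢0 h h}} (begin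
  h ^ h * (c * L ^ e)               ≡⟨ shuffle (h ^ h) c (L ^ e) ⟩
  c * h ^ h * L ^ e                 ≤⟨ *-monoˡ-≤ (L ^ e) L₀≤L ⟩
  L ^ h                             ≤⟨ ^-monoˡ-≤ h (<⇒≤ (m<n*[1+m/n] L)) ⟩
  (h * suc (L / h)) ^ h             ≡⟨ ^-distribʳ-* h (suc (L / h)) h ⟩
  h ^ h * suc (L / h) ^ h           ≤⟨ *-monoʳ-≤ (h ^ h) (^-monoˡ-≤ h (n<2^n (L / h))) ⟩
  h ^ h * (2 ^ (L / h)) ^ h         ≡⟨ cong (h ^ h *_) (^-*-assoc 2 (L / h) h) ⟩
  h ^ h * 2 ^ (L / h * h)           ≤⟨ *-monoʳ-≤ (h ^ h) (^-monoʳ-≤ 2 (m/n*n≤m L h)) ⟩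
  h ^ h * 2 ^ L                     ∎)
  where
  open ≤-Reasoning
  h = suc e
  shuffle : ∀ a b c → a * (b * c) ≡ b * a * c
  shuffle = solve-∀
  m<n*[1+m/n] : ∀ L → L < h * suc (L / h)
  m<n*[1+m/n] L = begin-strict
    L                      ≡⟨ m≡m%n+[m/n]*n L h ⟩
    L % h + L / h * h      <⟨ +-monoˡ-< (L / h * h) (m%n<n L h) ⟩
    h + L / h * h          ≡⟨ cong (h +_) (*-comm (L / h) h) ⟩
    h + h * (L / h)        ≡⟨ *-suc h (L / h) ⟨
    h * suc (L / h)        ∎

n!≤x^n : ∀ {x} n → n ≤ x → n ! ≤ x ^ n
n!≤x^n zero    _   = ≤-refl
n!≤x^n (suc n) n<x = *-mono-≤ n<x (n!≤x^n n (<⇒≤ n<x))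

^≤expT : ∀ m t → m ^ t ≤ expT m t
^≤expT m zero    = ≤-refl
^≤expT m (suc t) = m≤n+m (m ^ suc t) _

-- The x-th Taylor term (2x)^x / x! of e^(2x) is already at least 2^x.
expGe-2* : ∀ x {N} → N ≤ 2 ^ x → ExpGe (2 * x) N
expGe-2* x {N} N≤ = x , (begin
  N * x !            ≤⟨ *-mono-≤ N≤ (n!≤x^n x ≤-refl) ⟩
  2 ^ x * x ^ x      ≡⟨ ^-distribʳ-* 2 x x ⟨
  (2 * x) ^ x        ≤⟨ ^≤expT (2 * x) x ⟩
  expT (2 * x) x     ∎)
  where open ≤-Reasoning

-- With q = 2p + d the hypotheses read k ≤ n^(d/2q), τ ≤ n^(p/2q) and 2^g ≤ n^(pk/2q).
module Growth (p d n k s τ g : ℕ) (0<p : 0 < p) (2≤k : 2 ≤ k) (0<n : 0 < n)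
              (k^≤n^ : k ^ (2 * (2 * p + d)) ≤ n ^ d) (n≤2sk : n ≤ 2 * s * k)
              (τ^≤ : τ ^ (2 * (2 * p + d)) ≤ n ^ p) (2^g≤ : (2 ^ g) ^ (2 * (2 * p + d)) ≤ n ^ (p * k)) where

  private
    Q : ℕ
    Q = 2 * (2 * p + d)

    instance
      n≢0 : NonZero n
      n≢0 = >-nonZero 0<n
      Q≢0 : NonZero Q
      Q≢0 = >-nonZero (*-mono-≤ (s≤s (z≤n {1})) (≤-trans (*-mono-≤ (s≤s (z≤n {1})) 0<p) (m≤m+n (2 * p) d)))

  -- From `2s ≥ n/k` and `k ≤ n^(d/2q)`. The resulting exponent `(4p + d)/2q` equals `1/2 + p/q`.
  n^≤[2s]^ : n ^ (4 * p + d) ≤ (2 * s) ^ Q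
  n^≤[2s]^ = *-cancelʳ-≤ _ _ (n ^ d) {{m^n≢0 n d}} (begin
    n ^ (4 * p + d) * n ^ d        ≡⟨ ^-distribˡ-+-* n (4 * p + d) d ⟨
    n ^ (4 * p + d + d)            ≡⟨ cong (n ^_) (e p d) ⟩
    n ^ Q                          ≤⟨ ^-monoˡ-≤ Q n≤2sk ⟩
    (2 * s * k) ^ Q                ≡⟨ ^-distribʳ-* (2 * s) k Q ⟩
    (2 * s) ^ Q * k ^ Q            ≤⟨ *-monoʳ-≤ ((2 * s) ^ Q) k^≤n^ ⟩
    (2 * s) ^ Q * n ^ d            ∎)
    where
    open ≤-Reasoning
    e : ∀ p d → 4 * p + d + d ≡ 2 * (2 * p + d)
    e = solve-∀

  τ⁴≤2s : τ ^ 4 ≤ 2 * s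
  τ⁴≤2s = ^-cancelˡ-≤ Q (begin
    (τ ^ 4) ^ Q          ≡⟨ trans (^-*-assoc τ 4 Q) (trans (cong (τ ^_) (*-comm 4 Q)) (sym (^-*-assoc τ Q 4))) ⟩
    (τ ^ Q) ^ 4          ≤⟨ ^-monoˡ-≤ 4 τ^≤ ⟩
    (n ^ p) ^ 4          ≡⟨ trans (^-*-assoc n p 4) (cong (n ^_) (*-comm p 4)) ⟩
    n ^ (4 * p)          ≤⟨ ^-monoʳ-≤ n (m≤m+n (4 * p) d) ⟩
    n ^ (4 * p + d)      ≤⟨ n^≤[2s]^ ⟩
    (2 * s) ^ Q          ∎)
    where open ≤-Reasoning

  n2^gτ^k≤2^ks^k : n * 2 ^ g * τ ^ k ≤ 2 ^ k * s ^ k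
  n2^gτ^k≤2^ks^k = ^-cancelˡ-≤ Q (begin
    (n * 2 ^ g * τ ^ k) ^ Q                   ≡⟨ trans (^-distribʳ-* (n * 2 ^ g) (τ ^ k) Q) (cong (_* (τ ^ k) ^ Q) (^-distribʳ-* n (2 ^ g) Q)) ⟩
    n ^ Q * (2 ^ g) ^ Q * (τ ^ k) ^ Q         ≡⟨ cong (n ^ Q * (2 ^ g) ^ Q *_) (swap τ k Q) ⟩
    n ^ Q * (2 ^ g) ^ Q * (τ ^ Q) ^ k         ≤⟨ *-mono-≤ (*-monoʳ-≤ (n ^ Q) 2^g≤) (^-monoˡ-≤ k τ^≤) ⟩
    n ^ Q * n ^ (p * k) * (n ^ p) ^ k         ≡⟨ cong (n ^ Q * n ^ (p * k) *_) (^-*-assoc n p k) ⟩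
    n ^ Q * n ^ (p * k) * n ^ (p * k)         ≡⟨ trans (cong (_* n ^ (p * k)) (sym (^-distribˡ-+-* n Q (p * k)))) (sym (^-distribˡ-+-* n (Q + p * k) (p * k))) ⟩
    n ^ (Q + p * k + p * k)                   ≤⟨ ^-monoʳ-≤ n exponents ⟩
    n ^ ((4 * p + d) * k)                     ≡⟨ ^-*-assoc n (4 * p + d) k ⟨
    (n ^ (4 * p + d)) ^ k                     ≤⟨ ^-monoˡ-≤ k n^≤[2s]^ ⟩
    ((2 * s) ^ Q) ^ k                         ≡⟨ swap (2 * s) Q k ⟩
    ((2 * s) ^ k) ^ Q                         ≡⟨ cong (_^ Q) (^-distribʳ-* 2 s k) ⟩
    (2 ^ k * s ^ k) ^ Q                       ∎)
    where
    open ≤-Reasoning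
    swap : ∀ a b c → (a ^ b) ^ c ≡ (a ^ c) ^ b
    swap a b c = trans (^-*-assoc a b c) (trans (cong (a ^_) (*-comm b c)) (sym (^-*-assoc a c b)))
    e₁ : ∀ p d x → 2 * (2 * p + d) + x + x ≡ (2 * p + d) * 2 + 2 * x
    e₁ = solve-∀
    e₂ : ∀ p d k → (2 * p + d) * k + 2 * (p * k) ≡ (4 * p + d) * k
    e₂ = solve-∀
    -- The summand `Q` belongs to the factor `n`, the two summands `p * k` to `2 ^ g` and `τ ^ k`.
    -- Only `Q = (2p + d) * 2` needs `2 ≤ k`.
    exponents : Q + p * k + p * k ≤ (4 * p + d) * k
    exponents = begin
      Q + p * k + p * k                ≡⟨ e₁ p d (p * k) ⟩
      (2 * p + d) * 2 + 2 * (p * k)    ≤⟨ +-monoˡ-≤ (2 * (p * k)) (*-monoʳ-≤ (2 * p + d) 2≤k) ⟩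
      (2 * p + d) * k + 2 * (p * k)    ≡⟨ e₂ p d k ⟩
      (4 * p + d) * k                  ∎

module Containment (k L : ℕ) (0<k : 0 < k) (0<L : 0 < L) where

  e₀ y J κ : ℕ
  e₀ = 2 * (k * L)
  y = 32 * (2 ^ k * e₀)
  J = 4 * 2 ^ k * e₀
  κ = 3 * (e₀ * y) * J

  -- Chosen so that `τ ^ k` dominates `8 * 2^k * κ * L`. Since `κ` carries `2^(3k)` and
  -- `e₀³ = 8k³L³`, this product is `24576 * 2^(3k) * k³ * L⁴`, with `24576 = 8 * 3 * 32 * 4 * 8`;
  -- then `k³ ≤ 2^(3k)` gives the base 64.
  τ : ℕ
  τ = 24576 * 64 * L ^ 4

  0<e₀ : 0 < e₀
  0<e₀ = *-mono-≤ (s≤s (z≤n {1})) (*-mono-≤ 0<k 0<L)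

  0<κ : 0 < κ
  0<κ = *-mono-≤ (*-mono-≤ (s≤s (z≤n {2})) (*-mono-≤ 0<e₀ (*-mono-≤ (s≤s (z≤n {31})) 2^ke₀))) (*-mono-≤ (*-mono-≤ (s≤s (z≤n {3})) (m^n>0 2 k)) 0<e₀)
    where
    2^ke₀ : 0 < 2 ^ k * e₀
    2^ke₀ = *-mono-≤ (m^n>0 2 k) 0<e₀

  1≤L⁴ : 1 ≤ L ^ 4
  1≤L⁴ = m^n>0 L {{>-nonZero 0<L}} 4

  private
    a≤a^k : ∀ a → 0 < a → a ≤ a ^ k
    a≤a^k a 0<a = ≤-trans (≤-reflexive (sym (^-identityʳ a))) (^-monoʳ-≤ a {{>-nonZero 0<a}} 0<k)

  8*2^k*κ*L≤τ^k : 8 * 2 ^ k * κ * L ≤ τ ^ k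
  8*2^k*κ*L≤τ^k = begin
    8 * 2 ^ k * κ * L
      ≡⟨ e₁ 8 3 32 4 (2 ^ k) e₀ L ⟩
    8 * 3 * 32 * 4 * (2 ^ k * 2 ^ k * 2 ^ k) * (e₀ * e₀ * e₀ * L)
      ≡⟨ e₂ (8 * 3 * 32 * 4) 2 k L (2 ^ k * 2 ^ k * 2 ^ k) ⟩
    24576 * (2 ^ k * 2 ^ k * 2 ^ k * (k * k * k)) * L ^ 4
      ≤⟨ *-monoˡ-≤ (L ^ 4) (*-monoʳ-≤ 24576 (*-monoʳ-≤ (2 ^ k * 2 ^ k * 2 ^ k) (*-mono-≤ (*-mono-≤ k≤ k≤) k≤))) ⟩
    24576 * (2 ^ k * 2 ^ k * 2 ^ k * (2 ^ k * 2 ^ k * 2 ^ k)) * L ^ 4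
      ≡⟨ cong (λ x → 24576 * x * L ^ 4) pow ⟩
    24576 * 64 ^ k * L ^ 4
      ≤⟨ *-mono-≤ (*-monoˡ-≤ (64 ^ k) (a≤a^k 24576 (s≤s z≤n))) (a≤a^k (L ^ 4) 1≤L⁴) ⟩
    24576 ^ k * 64 ^ k * (L ^ 4) ^ k
      ≡⟨ cong (_* (L ^ 4) ^ k) (^-distribʳ-* 24576 64 k) ⟨
    (24576 * 64) ^ k * (L ^ 4) ^ k
      ≡⟨ ^-distribʳ-* (24576 * 64) (L ^ 4) k ⟨
    τ ^ k ∎
    where
    open ≤-Reasoning
    k≤ : k ≤ 2 ^ k
    k≤ = <⇒≤ (n<2^n k)
    e₁ : ∀ a b c d x e l → a * x * (b * (e * (c * (x * e))) * (d * x * e)) * l ≡ a * b * c * d * (x * x * x) * (e * e * e * l)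
    e₁ = solve-∀
    e₂ : ∀ a b k l x → a * x * (b * (k * l) * (b * (k * l)) * (b * (k * l)) * l) ≡ a * (b * b * b) * (x * (k * k * k)) * (l * (l * (l * (l * 1))))
    e₂ = solve-∀
    pow : 2 ^ k * 2 ^ k * 2 ^ k * (2 ^ k * 2 ^ k * 2 ^ k) ≡ 64 ^ k
    pow = trans (sixth (2 ^ k)) (trans (^-*-assoc 2 k 6) (trans (cong (2 ^_) (*-comm k 6)) (sym (^-*-assoc 2 6 k))))
      where
      sixth : ∀ x → x * x * x * (x * x * x) ≡ x * (x * (x * (x * (x * (x * 1)))))
      sixth = solve-∀

  κ≤τ^k : κ ≤ τ ^ k
  κ≤τ^k = ≤-trans (m≤n*m κ (8 * 2 ^ k) {{>-nonZero (*-mono-≤ (s≤s (z≤n {7})) (m^n>0 2 k))}})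
    (≤-trans (m≤m*n (8 * 2 ^ k * κ) L {{>-nonZero 0<L}}) 8*2^k*κ*L≤τ^k)

  J*y≤τ^k : J * y ≤ τ ^ k
  J*y≤τ^k = ≤-trans (≤-trans (m≤n*m (J * y) (3 * e₀) {{>-nonZero (*-mono-≤ (s≤s (z≤n {2})) 0<e₀)}})
    (≤-reflexive (e e₀ y J))) κ≤τ^k
    where
    e : ∀ a b c → 3 * a * (c * b) ≡ 3 * (a * b) * c
    e = solve-∀

  12≤τ : 12 ≤ τ
  12≤τ = ≤-trans (≤ᵇ⇒≤ 12 (24576 * 64) _) (m≤m*n (24576 * 64) (L ^ 4) {{>-nonZero 1≤L⁴}})

module LowerBound (p d L r l j m b : ℕ) (0<p : 0 < p) (1≤j : 1 ≤ j) (0<L : 0 < L) (0<m : 0 < m) where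

  n k s q : ℕ
  n = ground (suc r) l (suc j)
  k = suc j
  s = suc r
  q = 2 * p + d

  open Containment k L (s≤s z≤n) 0<L

  not-colourable : l < k → k ^ (2 * q) ≤ n ^ d → 2 ^ L ≤ n → n < 2 ^ suc L → τ ^ (2 * q) ≤ 2 ^ L →
    576 * q ≤ b → 2 ^ (b * m) < n ^ n → ¬ (∀ (D : Orientation (KG n k)) → ListDiColourable D m)
  not-colourable l<k k^≤ 2^L≤n n<2^ τ^≤ 576q≤b few =
    Kneser.kneser-not-colourable r l j 1≤r e₀ 0<e₀ s^k≤ m (12 * m) g 0<m palette average N-large
    where
    open ≤-Reasoning
    -- `72 = 2 * 12 * 3`: Markov's factor 2, a palette of `12m` colours and containers of size at
    -- most `3 * s ^ j`.
    g = 72 * m / s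

    2≤k : 2 ≤ k
    2≤k = s≤s 1≤j

    n≡ : n ≡ k * s + l
    n≡ = ground≡ s l k

    0<n : 0 < n
    0<n = ≤-trans (m^n>0 2 L) 2^L≤n

    n≤2sk : n ≤ 2 * s * k
    n≤2sk = begin
      n               ≡⟨ n≡ ⟩
      k * s + l       ≤⟨ +-monoʳ-≤ (k * s) (≤-trans (<⇒≤ l<k) (m≤m*n k s)) ⟩
      k * s + k * s   ≡⟨ e k s ⟩
      2 * s * k       ∎
      where
      e : ∀ k s → k * s + k * s ≡ 2 * s * k
      e = solve-∀

    s≤n : s ≤ n
    s≤n = ≤-trans (m≤n*m s k) (≤-trans (m≤m+n (k * s) l) (≤-reflexive (sym n≡)))

    1+L≤2L : suc L ≤ 2 * L
    1+L≤2L = ≤-trans (+-monoˡ-≤ L 0<L) (≤-reflexive (cong (L +_) (sym (+-identityʳ L))))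

    bm≤2Ln : b * m ≤ 2 * L * n
    bm≤2Ln = ≤-trans (<⇒≤ (^-cancelʳ-< 2 (begin-strict
      2 ^ (b * m)        <⟨ few ⟩
      n ^ n              ≤⟨ ^-monoˡ-≤ n (<⇒≤ n<2^) ⟩
      (2 ^ suc L) ^ n    ≡⟨ ^-*-assoc 2 (suc L) n ⟩
      2 ^ (suc L * n)    ∎))) (*-monoˡ-≤ n 1+L≤2L)

    gs≤72m : g * s ≤ 72 * m
    gs≤72m = m/n*n≤m (72 * m) s

    72m≤[1+g]s : 72 * m ≤ suc g * s
    72m≤[1+g]s = begin
      72 * m                       ≡⟨ m≡m%n+[m/n]*n (72 * m) s ⟩
      (72 * m) % s + g * s         ≤⟨ +-monoˡ-≤ (g * s) (<⇒≤ (m%n<n (72 * m) s)) ⟩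
      s + g * s                    ∎

    -- Gives `2 ^ g ≤ n^(k/2q)`. The constant in `b` is `576 = 2 * 72 * 4`: the 4 comes from
    -- `b * m ≤ 2Ln` together with `n ≤ 2sk`, the 2 from the exponent `2q`.
    gQ≤Lk : g * (2 * q) ≤ L * k
    gQ≤Lk = *-cancelˡ-≤ (s * 288) (begin
      s * 288 * (g * (2 * q))      ≡⟨ e₁ s g q ⟩
      576 * q * (g * s)            ≤⟨ *-mono-≤ 576q≤b gs≤72m ⟩
      b * (72 * m)                 ≡⟨ e₂ b m ⟩
      72 * (b * m)                 ≤⟨ *-monoʳ-≤ 72 (≤-trans bm≤2Ln (*-monoʳ-≤ (2 * L) n≤2sk)) ⟩
      72 * (2 * L * (2 * s * k))   ≡⟨ e₃ L s k ⟩
      s * 288 * (L * k)            ∎)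
      where
      e₁ : ∀ s g q → s * 288 * (g * (2 * q)) ≡ 576 * q * (g * s)
      e₁ = solve-∀
      e₂ : ∀ b m → b * (72 * m) ≡ 72 * (b * m)
      e₂ = solve-∀
      e₃ : ∀ l s k → 72 * (2 * l * (2 * s * k)) ≡ s * 288 * (l * k)
      e₃ = solve-∀

    2^g≤ : (2 ^ g) ^ (2 * q) ≤ n ^ (p * k)
    2^g≤ = begin
      (2 ^ g) ^ (2 * q)    ≡⟨ ^-*-assoc 2 g (2 * q) ⟩
      2 ^ (g * (2 * q))    ≤⟨ ^-monoʳ-≤ 2 (≤-trans gQ≤Lk (*-monoʳ-≤ L (m≤n*m k p {{>-nonZero 0<p}}))) ⟩
      2 ^ (L * (p * k))    ≡⟨ ^-*-assoc 2 L (p * k) ⟨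
      (2 ^ L) ^ (p * k)    ≤⟨ ^-monoˡ-≤ (p * k) 2^L≤n ⟩
      n ^ (p * k)          ∎

    τ^≤n^p : τ ^ (2 * q) ≤ n ^ p
    τ^≤n^p = ≤-trans τ^≤ (≤-trans 2^L≤n (≤-trans (≤-reflexive (sym (^-identityʳ n)))
      (^-monoʳ-≤ n {{>-nonZero 0<n}} 0<p)))

    open Growth p d n k s τ g 0<p 2≤k 0<n k^≤ n≤2sk τ^≤n^p 2^g≤

    τ²≤s : τ * τ ≤ s
    τ²≤s = *-cancelˡ-≤ 2 (begin
      2 * (τ * τ)           ≤⟨ *-monoˡ-≤ (τ * τ) (≤-trans (≤-trans (≤ᵇ⇒≤ 2 12 _) 12≤τ) (m≤m*n τ τ {{>-nonZero (≤-trans (≤ᵇ⇒≤ 1 12 _) 12≤τ)}})) ⟩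
      τ * τ * (τ * τ)       ≡⟨ e τ ⟩
      τ ^ 4                 ≤⟨ τ⁴≤2s ⟩
      2 * s                 ∎)
      where
      e : ∀ t → t * t * (t * t) ≡ t * (t * (t * (t * 1)))
      e = solve-∀

    instance
      τ≢0 : NonZero τ
      τ≢0 = >-nonZero (≤-trans (≤ᵇ⇒≤ 1 12 _) 12≤τ)

    12≤s : 12 ≤ s
    12≤s = ≤-trans 12≤τ (≤-trans (m≤m*n τ τ) τ²≤s)

    1≤r : 1 ≤ r
    1≤r = s≤s⁻¹ (≤-trans (≤ᵇ⇒≤ 2 12 _) 12≤s)

    s^k≤ : s ^ k ≤ 2 ^ e₀
    s^k≤ = begin
      s ^ k                  ≤⟨ ^-monoˡ-≤ k (≤-trans s≤n (<⇒≤ n<2^)) ⟩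
      (2 ^ suc L) ^ k        ≡⟨ ^-*-assoc 2 (suc L) k ⟩
      2 ^ (suc L * k)        ≤⟨ ^-monoʳ-≤ 2 (≤-trans (*-monoˡ-≤ k 1+L≤2L) (≤-reflexive (e L k))) ⟩
      2 ^ (2 * (k * L))      ∎
      where
      e : ∀ l k → 2 * l * k ≡ 2 * (k * l)
      e = solve-∀

    palette : 6 * m + g ≤ 12 * m
    palette = ≤-trans (+-monoʳ-≤ (6 * m) (*-cancelˡ-≤ 12 (begin
      12 * g          ≤⟨ *-monoˡ-≤ g 12≤s ⟩
      s * g           ≡⟨ *-comm s g ⟩
      g * s           ≤⟨ gs≤72m ⟩
      72 * m          ≡⟨ e₁ m ⟩
      12 * (6 * m)    ∎))) (≤-reflexive (e₂ m))
      where
      e₁ : ∀ m → 72 * m ≡ 12 * (6 * m)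
      e₁ = solve-∀
      e₂ : ∀ m → 6 * m + 6 * m ≡ 12 * m
      e₂ = solve-∀

    -- `k = j + 1 ≤ 2j` and `τ² ≤ s`. This absorbs the words added to a container, `J * y` vertices
    -- in all, into one more `s ^ j`.
    τ^k≤s^j : τ ^ k ≤ s ^ j
    τ^k≤s^j = begin
      τ ^ k             ≤⟨ ^-monoʳ-≤ τ (≤-trans (+-monoˡ-≤ j 1≤j) (≤-reflexive (cong (j +_) (sym (+-identityʳ j))))) ⟩
      τ ^ (2 * j)       ≡⟨ ^-*-assoc τ 2 j ⟨
      (τ ^ 2) ^ j       ≡⟨ cong (λ x → (τ * x) ^ j) (*-identityʳ τ) ⟩
      (τ * τ) ^ j       ≤⟨ ^-monoˡ-≤ j τ²≤s ⟩
      s ^ j             ∎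

    average : 2 * (12 * m * (2 * s ^ j + J * y)) ≤ suc g * s ^ k
    average = begin
      2 * (12 * m * (2 * s ^ j + J * y))    ≤⟨ *-monoʳ-≤ 2 (*-monoʳ-≤ (12 * m) (+-monoʳ-≤ (2 * s ^ j) (≤-trans J*y≤τ^k τ^k≤s^j))) ⟩
      2 * (12 * m * (2 * s ^ j + s ^ j))    ≡⟨ e₁ m (s ^ j) ⟩
      72 * m * s ^ j                        ≤⟨ *-monoˡ-≤ (s ^ j) 72m≤[1+g]s ⟩
      suc g * s * s ^ j                     ≡⟨ *-assoc (suc g) s (s ^ j) ⟩
      suc g * s ^ k                         ∎
      where
      e₁ : ∀ m x → 2 * (12 * m * (2 * x + x)) ≡ 72 * m * x
      e₁ = solve-∀

    12m≤Ln : 12 * m ≤ L * n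
    12m≤Ln = *-cancelˡ-≤ 2 (begin
      2 * (12 * m)       ≡⟨ e₁ m ⟩
      24 * m             ≤⟨ *-monoˡ-≤ m (≤-trans (≤-trans (≤ᵇ⇒≤ 24 576 _) (m≤m*n 576 q {{>-nonZero 0<q}})) 576q≤b) ⟩
      b * m              ≤⟨ bm≤2Ln ⟩
      2 * L * n          ≡⟨ *-assoc 2 L n ⟩
      2 * (L * n)        ∎)
      where
      0<q : 0 < q
      0<q = ≤-trans 0<p (≤-trans (m≤n*m p 2) (m≤m+n (2 * p) d))
      e₁ : ∀ m → 2 * (12 * m) ≡ 24 * m
      e₁ = solve-∀

    N-large : 2 * (2 ^ suc g * suc (κ * (12 * m))) ≤ s ^ k
    N-large = *-cancelˡ-≤ (2 ^ k) {{m^n≢0 2 k}} (begin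
      2 ^ k * (2 * (2 ^ suc g * suc (κ * (12 * m))))
        ≤⟨ *-monoʳ-≤ (2 ^ k) (*-monoʳ-≤ 2 (*-monoʳ-≤ (2 ^ suc g) (+-monoˡ-≤ (κ * (12 * m)) 1≤κM))) ⟩
      2 ^ k * (2 * (2 ^ suc g * (κ * (12 * m) + κ * (12 * m))))
        ≡⟨ e₁ (2 ^ k) (2 ^ g) κ (12 * m) ⟩
      8 * 2 ^ k * κ * (12 * m) * 2 ^ g
        ≤⟨ *-monoˡ-≤ (2 ^ g) (*-monoʳ-≤ (8 * 2 ^ k * κ) 12m≤Ln) ⟩
      8 * 2 ^ k * κ * (L * n) * 2 ^ g
        ≡⟨ e₂ (8 * 2 ^ k * κ) L n (2 ^ g) ⟩
      n * 2 ^ g * (8 * 2 ^ k * κ * L)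
        ≤⟨ *-monoʳ-≤ (n * 2 ^ g) 8*2^k*κ*L≤τ^k ⟩
      n * 2 ^ g * τ ^ k
        ≤⟨ n2^gτ^k≤2^ks^k ⟩
      2 ^ k * s ^ k ∎)
      where
      1≤κM : 1 ≤ κ * (12 * m)
      1≤κM = *-mono-≤ 0<κ (*-mono-≤ (s≤s (z≤n {11})) 0<m)
      e₁ : ∀ a x c M → a * (2 * (2 * x * (c * M + c * M))) ≡ 8 * a * c * M * x
      e₁ = solve-∀
      e₂ : ∀ a l n x → a * (l * n) * x ≡ n * x * (a * l)
      e₂ = solve-∀

-- The constant is c_ε = 1/(2b′): the summand 576q makes the counting work for large n,
-- and L₀ * 2 ^ L₀ reduces the remaining n to the trivial bound m ≥ 1.
theorem15 : ∀ (p q : ℕ) → 0 < p → 0 < q →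
    ∃ λ (a : ℕ) → ∃ λ (b : ℕ) → 0 < a × 0 < b ×
    (∀ (n k m : ℕ) → 2 ≤ k → k ^ (2 * q) ≤ n ^ (q ∸ 2 * p) →
    IsListDichromaticNumber (KG n k) m → GeCNLnN a b n m)
theorem15 p q 0<p 0<q = 1 , 2 * b′ , s≤s z≤n , *-mono-≤ (s≤s (z≤n {1})) 0<b′ , bound
  where
  C₀ : ℕ
  C₀ = 24576 * 64

  asymptotic = poly≤exp (C₀ ^ (2 * q)) (4 * (2 * q))
  -- The successor guarantees `0 < L` for every `L ≥ L₀`.
  L₀ = suc (proj₁ asymptotic)
  b′ = 576 * q + L₀ * 2 ^ L₀

  0<b′ : 0 < b′
  0<b′ = ≤-trans (*-mono-≤ (s≤s (z≤n {575})) 0<q) (m≤m+n (576 * q) (L₀ * 2 ^ L₀))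

  τ^≤2^L : ∀ L → L₀ ≤ L → (C₀ * L ^ 4) ^ (2 * q) ≤ 2 ^ L
  τ^≤2^L L L₀≤L = ≤-trans (≤-reflexive (trans (^-distribʳ-* C₀ (L ^ 4) (2 * q))
    (cong (C₀ ^ (2 * q) *_) (^-*-assoc L 4 (2 * q))))) (proj₂ asymptotic L (≤-trans (n≤1+n _) L₀≤L))

  small-n : ∀ n L m → n < 2 ^ suc L → L < L₀ → 0 < m → n ^ n ≤ 2 ^ (b′ * m)
  small-n n L m n<2^ L<L₀ 0<m = begin
    n ^ n                   ≤⟨ ^-monoˡ-≤ n n≤ ⟩
    (2 ^ L₀) ^ n            ≡⟨ ^-*-assoc 2 L₀ n ⟩
    2 ^ (L₀ * n)            ≤⟨ ^-monoʳ-≤ 2 (*-monoʳ-≤ L₀ n≤) ⟩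
    2 ^ (L₀ * 2 ^ L₀)       ≤⟨ ^-monoʳ-≤ 2 (≤-trans (m≤n+m _ (576 * q)) (m≤m*n b′ m {{>-nonZero 0<m}})) ⟩
    2 ^ (b′ * m)            ∎
    where
    open ≤-Reasoning
    n≤ : n ≤ 2 ^ L₀
    n≤ = ≤-trans (<⇒≤ n<2^) (^-monoʳ-≤ 2 L<L₀)

  reduced : ∀ d → q ≡ 2 * p + d → ∀ r l j m → 1 ≤ j → l < suc j →
    suc j ^ (2 * q) ≤ ground (suc r) l (suc j) ^ d →
    (∀ (D : Orientation (KG (ground (suc r) l (suc j)) (suc j))) → ListDiColourable D m) →
    ground (suc r) l (suc j) ^ ground (suc r) l (suc j) ≤ 2 ^ (b′ * m)
  -- The argument is the predecessor of the ground set's size: `ground (suc r) l (suc j)` unfolds to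
  -- `suc (r + ground (suc r) l j)`.
  reduced d q≡ r l j m 1≤j l<k k^≤ colourable with log₂-bounds (r + ground (suc r) l j)
  ... | L , 2^L≤n , n<2^ with L₀ ≤? L
  ...   | no L₀≰L = small-n (ground (suc r) l (suc j)) L m n<2^ (≰⇒> L₀≰L) (Kneser.colourable⇒0<m r l j m colourable)
  ...   | yes L₀≤L with ground (suc r) l (suc j) ^ ground (suc r) l (suc j) ≤? 2 ^ (b′ * m)
  ...     | yes done = done
  ...     | no ¬done = ⊥-elim (LowerBound.not-colourable p d L r l j m b′ 0<p 1≤j (≤-trans (s≤s z≤n) L₀≤L)
    (Kneser.colourable⇒0<m r l j m colourable) l<k
    (subst (λ x → suc j ^ (2 * x) ≤ ground (suc r) l (suc j) ^ d) q≡ k^≤) 2^L≤n n<2^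
    (subst (λ x → (C₀ * L ^ 4) ^ (2 * x) ≤ 2 ^ L) q≡ (τ^≤2^L L L₀≤L))
    (≤-trans (≤-reflexive (cong (576 *_) (sym q≡))) (m≤m+n (576 * q) (L₀ * 2 ^ L₀)))
    (≰⇒> ¬done) colourable)

  k≤n : ∀ d → d ≤ 2 * q → ∀ n k → 2 ≤ k → 0 < d → k ^ (2 * q) ≤ n ^ d → k ≤ n
  k≤n (suc d) _  zero      k 2≤k _ h = ⊥-elim (n≮0 (≤-trans (m^n>0 k {{>-nonZero (≤-trans (s≤s z≤n) 2≤k)}} (2 * q)) h))
  k≤n d       d≤ n@(suc _) k _   _ h =
    ^-cancelˡ-≤ (2 * q) {{>-nonZero (*-mono-≤ (s≤s (z≤n {1})) 0<q)}} (≤-trans h (^-monoʳ-≤ n d≤))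

  n^n≤ : ∀ n k m → 2 ≤ k → k ^ (2 * q) ≤ n ^ (q ∸ 2 * p) →
    (∀ (D : Orientation (KG n k)) → ListDiColourable D m) → n ^ n ≤ 2 ^ (b′ * m)
  n^n≤ n k@(suc j) m 2≤k k^≤ colourable with 2 * p <? q
  -- For `ε ≥ 1/2` the truncated exponent is 0 and the hypothesis would say `k ^ (2 * q) ≤ 1`.
  ... | no 2p≮q = ⊥-elim (<⇒≱ 1<k^ (≤-trans k^≤ (≤-reflexive (cong (n ^_) (m≤n⇒m∸n≡0 (≮⇒≥ 2p≮q))))))
    where
    1<k^ : 1 < k ^ (2 * q)
    1<k^ = ^-monoʳ-< k 2≤k {0} {2 * q} (*-mono-≤ (s≤s (z≤n {1})) 0<q)
  ... | yes 2p<q = go (n / k) refl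
    where
    d = q ∸ 2 * p

    0<n/k : 0 < n / k
    0<n/k = m≥n⇒m/n>0 (k≤n d (≤-trans (m∸n≤m q (2 * p)) (m≤n*m q 2)) n k 2≤k (m<n⇒0<n∸m 2p<q) k^≤)

    go : ∀ s → n / k ≡ s → n ^ n ≤ 2 ^ (b′ * m)
    go zero    eq = ⊥-elim (<-irrefl (sym eq) 0<n/k)
    go (suc r) eq = subst (λ x → x ^ x ≤ 2 ^ (b′ * m)) (sym n≡)
      (reduced d (sym (m+[n∸m]≡n (<⇒≤ 2p<q))) r (n % k) j m (s≤s⁻¹ 2≤k) (m%n<n n k)
        (subst (λ x → k ^ (2 * q) ≤ x ^ d) n≡ k^≤)
        (subst (λ x → ∀ (D : Orientation (KG x k)) → ListDiColourable D m) n≡ colourable))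
      where
      n≡ : n ≡ ground (suc r) (n % k) k
      n≡ = trans (m≡m%n+[m/n]*n n k) (trans (cong (λ x → n % k + x * k) eq)
        (trans (+-comm (n % k) (suc r * k)) (trans (cong (_+ n % k) (*-comm (suc r) k)) (sym (ground≡ (suc r) (n % k) k)))))

  bound : ∀ (n k m : ℕ) → 2 ≤ k → k ^ (2 * q) ≤ n ^ (q ∸ 2 * p) →
          IsListDichromaticNumber (KG n k) m → GeCNLnN 1 (2 * b′) n m
  bound n k m 2≤k k^≤ (colourable , _) = subst₂ ExpGe (sym (*-assoc 2 b′ m)) (cong (n ^_) (sym (*-identityˡ n)))
    (expGe-2* (b′ * m) (n^n≤ n k m 2≤k k^≤ colourable))
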